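{- Let $k\ge2$ be an integer. Then $$\limsup_{n\to\infty}\frac{\log \tau^{(e)}_k(n)\,\log\log n}{\log n}=\frac{\log k}{2},\qquad \limsup_{n\to\infty}\frac{\log \tau^{(e)}_{k*}(n)\,\log\log n}{\log n}=\frac12\log\binom{k+1}{2},$$ $$\limsup_{N(\alpha)\to\infty}\frac{\log {\mathfrak t}^{(e)}_k(\alpha)\,\log\log N(\alpha)}{\log N(\alpha)}=\frac{\log k}{2},\qquad \limsup_{N(\alpha)\to\infty}\frac{\log {\mathfrak t}^{(e)}_{k*}(\alpha)\,\log\log N(\alpha)}{\log N(\alpha)}=\frac12\log\binom{k+1}{2}.$$
   Context: $\mathbb{Z}[i]$ is the ring of Gaussian integers, $N(a+bi)=a^2+b^2$. For a positive integer $a$, $\tau_k(a)$ is the number of ordered $k$-tuples of positive integers $(d_1,\dots,d_k)$ with $d_1\cdots d_k=a$, and ${\mathfrak t}_k(a)$ is the number of ordered $k$-tuples $({\mathfrak d}_1,\dots,{\mathfrak d}_k)$ of nonzero Gaussian integers, each taken up to associates (i.e. up to multiplication by $\pm1,\pm i$), such that ${\mathfrak d}_1\cdots{\mathfrak d}_k$ is associated to $a$ (equivalently, the number of ordered $k$-tuples of ideals of $\mathbb{Z}[i]$ whose product is $a\mathbb{Z}[i]$). The functions $\tau^{(e)}_k,\tau^{(e)}_{k*}$ are multiplicative functions on positive integers with $\tau^{(e)}_k(p^a)=\tau_k(a)$ and $\tau^{(e)}_{k*}(p^a)={\mathfrak t}_k(a)$ for every rational prime $p$ and $a\ge1$. The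 functions ${\mathfrak t}^{(e)}_k,{\mathfrak t}^{(e)}_{k*}$ are multiplicative functions on nonzero Gaussian integers, defined by ${\mathfrak t}^{(e)}_k(\varepsilon{\mathfrak p}_1^{a_1}\cdots{\mathfrak p}_r^{a_r})=\prod_j\tau_k(a_j)$ and ${\mathfrak t}^{(e)}_{k*}(\varepsilon{\mathfrak p}_1^{a_1}\cdots{\mathfrak p}_r^{a_r})=\prod_j{\mathfrak t}_k(a_j)$ for a unit $\varepsilon$ and pairwise non-associated Gaussian primes ${\mathfrak p}_j$. -}

module Defs where

open import Algebra.Bundles using (CommutativeRing; RawSemiring)
import Algebra.Definitions.RawSemiring as SemiringDefinitions
import Algebra.Properties.CommutativeSemiring.Exp as Exp
open import Data.Empty using (⊥-elim)
import Data.Integer as ℤ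
open ℤ using (ℤ)
open import Data.List using (List; []; _∷_; map; filter; length; upTo; foldr; cartesianProductWith)
open import Data.List.Membership.Propositional using (_∈_)
open import Data.List.Relation.Unary.All using (All)
open import Data.List.Relation.Unary.AllPairs using (AllPairs)
open import Data.List.Relation.Unary.Any using (Any; any?)
open import Data.Nat as ℕ using (ℕ; zero; suc)
open import Data.Nat.Coprimality using (Coprime)
open import Data.Nat.ListAction using (product)
open import Data.Nat.Primality using (Prime)
import Data.Nat.Properties as ℕₚ
import Data.Rational.Unnormalised as ℚᵘ
import Data.Rational.Unnormalised.Properties as ℚᵘₚ
import Data.Integer.Properties as ℤₚ
open import Data.Product using (∃; ∃₂; _×_; _,_; proj₁; proj₂)
open import Data.Rational
open import Data.Rational.Literals using (fromℤ)
open import Data.Rational.Properties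
open import Data.Rational.Solver using (module +-*-Solver)
open import Data.Sum using (_⊎_; inj₁; inj₂; [_,_]′)
open import Level using (0ℓ)
open import Relation.Binary.Definitions using (tri<; tri≈; tri>)
open import Relation.Binary.PropositionalEquality using (_≡_; refl; sym; trans; cong; cong₂; subst; subst₂; module ≡-Reasoning)
open import Relation.Nullary using (¬_; Dec; yes; no)

open +-*-Solver using (solve; _:=_; _:+_; _:*_; :-_; _:-_; con)
open Exp (CommutativeRing.commutativeSemiring +-*-commutativeRing) using (_^_; ^-assocʳ; ^-distrib-*)

fromℕ : ℕ → ℚ
fromℕ n = fromℤ (ℤ.+ n)

module ℚ-Lemmas where

  <⇒0< : ∀ {p q} → p < q → 0ℚ < q - p
  <⇒0< {p} {q} p<q = subst (_< q - p) (+-inverseʳ p) (+-monoˡ-< (- p) p<q)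

  0<⇒< : ∀ {p q} → 0ℚ < q - p → p < q
  0<⇒< {p} {q} 0<q-p = subst₂ _<_ (+-identityˡ p)
    (solve 2 (λ q p → (q :- p) :+ p := q) refl q p) (+-monoˡ-< p 0<q-p)

  <-by : ∀ {p q d} → q - p ≡ d → 0ℚ < d → p < q
  <-by e 0<d = 0<⇒< (subst (0ℚ <_) (sym e) 0<d)

  ≤⇒0≤ : ∀ {p q} → p ≤ q → 0ℚ ≤ q - p
  ≤⇒0≤ {p} {q} p≤q = subst (_≤ q - p) (+-inverseʳ p) (+-monoˡ-≤ (- p) p≤q)

  ≤-by : ∀ {p q d} → q - p ≡ d → 0ℚ ≤ d → p ≤ q
  ≤-by {p} {q} {d} e 0≤d = subst₂ _≤_ (+-identityˡ p)
    (trans (cong (_+ p) (sym e)) (solve 2 (λ q p → (q :- p) :+ p := q) refl q p)) (+-monoˡ-≤ p 0≤d)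

  *-pos : ∀ {p q} → 0ℚ < p → 0ℚ < q → 0ℚ < p * q
  *-pos {p} {q} 0<p 0<q = subst (_< p * q) (*-zeroʳ p) (*-monoʳ-<-pos p {{positive 0<p}} 0<q)

  *-nonNeg : ∀ {p q} → 0ℚ ≤ p → 0ℚ ≤ q → 0ℚ ≤ p * q
  *-nonNeg {p} {q} 0≤p 0≤q = subst (_≤ p * q) (*-zeroʳ p) (*-monoˡ-≤-nonNeg p {{nonNegative 0≤p}} 0≤q)

  +-pos : ∀ {p q} → 0ℚ < p → 0ℚ < q → 0ℚ < p + q
  +-pos 0<p 0<q = +-mono-< 0<p 0<q

  +-pos-nonNeg : ∀ {p q} → 0ℚ < p → 0ℚ ≤ q → 0ℚ < p + q
  +-pos-nonNeg 0<p 0≤q = +-mono-<-≤ 0<p 0≤q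

  +-nonNeg : ∀ {p q} → 0ℚ ≤ p → 0ℚ ≤ q → 0ℚ ≤ p + q
  +-nonNeg 0≤p 0≤q = +-mono-≤ 0≤p 0≤q

  0<1 : 0ℚ < 1ℚ
  0<1 = positive⁻¹ 1ℚ

  *-monoʳ-< : ∀ r {p q} → 0ℚ < r → p < q → r * p < r * q
  *-monoʳ-< r 0<r = *-monoʳ-<-pos r {{positive 0<r}}

  *-monoˡ-< : ∀ r {p q} → 0ℚ < r → p < q → p * r < q * r
  *-monoˡ-< r 0<r = *-monoˡ-<-pos r {{positive 0<r}}

  *-monoʳ-≤ : ∀ r {p q} → 0ℚ ≤ r → p ≤ q → r * p ≤ r * q
  *-monoʳ-≤ r 0≤r = *-monoˡ-≤-nonNeg r {{nonNegative 0≤r}}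

  *-monoˡ-≤ : ∀ r {p q} → 0ℚ ≤ r → p ≤ q → p * r ≤ q * r
  *-monoˡ-≤ r 0≤r = *-monoʳ-≤-nonNeg r {{nonNegative 0≤r}}

  recip : ∀ p → 0ℚ < p → ∃ λ p⁻¹ → 0ℚ < p⁻¹ × p * p⁻¹ ≡ 1ℚ
  recip p 0<p = (1/ p) , positive⁻¹ (1/ p) {{1/pos⇒pos p}} , *-inverseʳ p
    where instance
      p-pos : Positive p
      p-pos = positive 0<p
      p-nonZero : NonZero p
      p-nonZero = pos⇒nonZero p

  0≤fromℕ : ∀ n → 0ℚ ≤ fromℕ n
  0≤fromℕ n = *≤* (subst₂ ℤ._≤_ refl (sym (ℤₚ.*-identityʳ (ℤ.+ n))) (ℤ.+≤+ ℕ.z≤n))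

  fromℕ-mono : ∀ {m n} → m ℕ.≤ n → fromℕ m ≤ fromℕ n
  fromℕ-mono {m} {n} m≤n = *≤* (subst₂ ℤ._≤_ (sym (ℤₚ.*-identityʳ (ℤ.+ m))) (sym (ℤₚ.*-identityʳ (ℤ.+ n))) (ℤ.+≤+ m≤n))

  fromℕ-suc : ∀ n → fromℕ (suc n) ≡ 1ℚ + fromℕ n
  fromℕ-suc n = toℚᵘ-injective (ℚᵘₚ.≃-trans (ℚᵘ.*≡* (cong (ℤ._* ℤ.+ 1) e)) (ℚᵘₚ.≃-sym (toℚᵘ-homo-+ 1ℚ (fromℕ n))))
    where
    e : ℤ.+ suc n ≡ ℤ.+ 1 ℤ.+ (ℤ.+ n) ℤ.* ℤ.+ 1
    e = cong (ℤ._+_ (ℤ.+ 1)) (sym (ℤₚ.*-identityʳ (ℤ.+ n)))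

  archimedean : ∀ p → ∃ λ n → p < fromℕ n
  archimedean (mkℚ (ℤ.+ a) d _) = suc a ,
    *<* (subst (ℤ._< ℤ.+ (suc a ℕ.* suc d)) (sym (ℤₚ.*-identityʳ (ℤ.+ a))) (ℤ.+<+ (ℕₚ.m≤m*n (suc a) (suc d))))
  archimedean (mkℚ ℤ.-[1+ a ] d _) = 0 , *<* ℤ.-<+

  ^-pos : ∀ {p} n → 0ℚ < p → 0ℚ < p ^ n
  ^-pos zero    0<p = 0<1
  ^-pos (suc n) 0<p = *-pos 0<p (^-pos n 0<p)

  ^-mono-≤ : ∀ {p q} n → 0ℚ < p → p ≤ q → p ^ n ≤ q ^ n
  ^-mono-≤ zero 0<p p≤q = ≤-refl
  ^-mono-≤ {p} {q} (suc n) 0<p p≤q = ≤-trans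
    (*-monoʳ-≤ p (<⇒≤ 0<p) (^-mono-≤ n 0<p p≤q))
    (*-monoˡ-≤ (q ^ n) (<⇒≤ (^-pos n (<-≤-trans 0<p p≤q))) p≤q)

  1^n≡1 : ∀ n → 1ℚ ^ n ≡ 1ℚ
  1^n≡1 zero    = refl
  1^n≡1 (suc n) = trans (*-identityˡ (1ℚ ^ n)) (1^n≡1 n)

  square-nonNeg : ∀ z → 0ℚ ≤ z * z
  square-nonNeg z = [ (λ 0≤z → *-nonNeg 0≤z 0≤z)
    , (λ z≤0 → subst (0ℚ ≤_) (solve 1 (λ x → (:- x) :* (:- x) := x :* x) refl z)
                 (*-nonNeg (neg-antimono-≤ z≤0) (neg-antimono-≤ z≤0))) ]′ (≤-total 0ℚ z)

  bernoulli : ∀ x n → 0ℚ < 1ℚ + x → 1ℚ + fromℕ n * x ≤ (1ℚ + x) ^ n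
  bernoulli x zero 0<1+x = ≤-reflexive (trans (cong (_+_ 1ℚ) (*-zeroˡ x)) (+-identityʳ 1ℚ))
  bernoulli x (suc n) 0<1+x = ≤-trans
    (≤-by {d = N * (x * x)} e (*-nonNeg (0≤fromℕ n) (square-nonNeg x)))
    (*-monoʳ-≤ (1ℚ + x) (<⇒≤ 0<1+x) (bernoulli x n 0<1+x))
    where
    N : ℚ
    N = fromℕ n
    e : (1ℚ + x) * (1ℚ + N * x) - (1ℚ + fromℕ (suc n) * x) ≡ N * (x * x)
    e = trans (cong (λ s → (1ℚ + x) * (1ℚ + N * x) - (1ℚ + s * x)) (fromℕ-suc n))
      (solve 2 (λ x N → (con 1ℚ :+ x) :* (con 1ℚ :+ N :* x) :- (con 1ℚ :+ (con 1ℚ :+ N) :* x) := N :* (x :* x)) refl x N)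

record ℝ : Set₁ where
  field
    Lower Upper     : ℚ → Set
    lower-inhabited : ∃ Lower
    upper-inhabited : ∃ Upper
    lower-closed    : ∀ {p q} → p < q → Lower q → Lower p
    upper-closed    : ∀ {p q} → p < q → Upper p → Upper q
    lower-open      : ∀ {p} → Lower p → ∃ λ q → p < q × Lower q
    upper-open      : ∀ {q} → Upper q → ∃ λ p → p < q × Upper p
    disjoint        : ∀ {q} → Lower q → ¬ Upper q
    located         : ∀ {p q} → p < q → Lower p ⊎ Upper q

open ℝ

infix 4 _<ℝ_

_<ℝ_ : ℝ → ℝ → Set
x <ℝ y = ∃ λ q → Upper x q × Lower y q

fromℚ : ℚ → ℝ
fromℚ r = record
  { Lower           = _< r
  ; Upper           = r <_
  ; lower-inhabited = r - 1ℚ , <-by (solve 1 (λ r → r :- (r :- con 1ℚ) := con 1ℚ) refl r) 0<1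
  ; upper-inhabited = r + 1ℚ , <-by (solve 1 (λ r → r :+ con 1ℚ :- r := con 1ℚ) refl r) 0<1
  ; lower-closed    = <-trans
  ; upper-closed    = λ p<q r<p → <-trans r<p p<q
  ; lower-open      = λ p<r → <-dense p<r
  ; upper-open      = λ r<q → let p , r<p , p<q = <-dense r<q in p , p<q , r<p
  ; disjoint        = <-asym
  ; located         = loc
  }
  where
  open ℚ-Lemmas
  loc : ∀ {p q} → p < q → p < r ⊎ r < q
  loc {p} p<q with p <? r
  ... | yes p<r = inj₁ p<r
  ... | no  p≮r = inj₂ (≤-<-trans (≮⇒≥ p≮r) p<q)

0ℝ : ℝ
0ℝ = fromℚ 0ℚ

module ℝ-Lemmas (x : ℝ) where
  open ℚ-Lemmas

  lower<upper : ∀ {p q} → Lower x p → Upper x q → p < q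
  lower<upper {p} {q} Lp Uq with <-cmp p q
  ... | tri< p<q _ _    = p<q
  ... | tri≈ _ refl _   = ⊥-elim (disjoint x Lp Uq)
  ... | tri> _ _ q<p    = ⊥-elim (disjoint x (lower-closed x q<p Lp) Uq)

  approximate-step : ∀ η → 0ℚ < η → ∀ n a → Lower x a → Upper x (a + fromℕ n * η) →
                     ∃ λ c → a ≤ c × Lower x c × Upper x (c + (η + η))
  approximate-step η 0<η zero a La U = ⊥-elim (disjoint x {a} La (subst (Upper x) e U))
    where
    e : a + fromℕ 0 * η ≡ a
    e = trans (cong (_+_ a) (*-zeroˡ η)) (+-identityʳ a)
  approximate-step η 0<η (suc n) a La U = step (located x {a + η} {a + (η + η)} a+η<a+2η)
    where
    a+η<a+2η : a + η < a + (η + η)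
    a+η<a+2η = <-by {a + η} {a + (η + η)} {η} (solve 2 (λ a η → a :+ (η :+ η) :- (a :+ η) := η) refl a η) 0<η
    e : a + fromℕ (suc n) * η ≡ a + η + fromℕ n * η
    e = trans (cong (λ s → a + s * η) (fromℕ-suc n))
      (solve 3 (λ a N η → a :+ (con 1ℚ :+ N) :* η := a :+ η :+ N :* η) refl a (fromℕ n) η)
    a≤a+η : a ≤ a + η
    a≤a+η = <⇒≤ (<-by {a} {a + η} {η} (solve 2 (λ a η → a :+ η :- a := η) refl a η) 0<η)
    step : Lower x (a + η) ⊎ Upper x (a + (η + η)) → ∃ λ c → a ≤ c × Lower x c × Upper x (c + (η + η))
    step (inj₂ U′) = a , ≤-refl , La , U′
    step (inj₁ L′) =
      let c , a+η≤c , Lc , Uc = approximate-step η 0<η n (a + η) L′ (subst (Upper x) e U)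
      in c , ≤-trans {a} {a + η} {c} a≤a+η a+η≤c , Lc , Uc

  approximate : ∀ a b w → 0ℚ < w → Lower x a → Upper x b →
                ∃ λ c → a ≤ c × Lower x c × Upper x (c + w)
  approximate a b w 0<w La Ub = result (recip (½ * w) 0<½w)
    where
    0<½w : 0ℚ < ½ * w
    0<½w = *-pos (positive⁻¹ ½) 0<w
    ½w+½w≡w : ½ * w + ½ * w ≡ w
    ½w+½w≡w = trans (sym (*-distribʳ-+ w ½ ½)) (*-identityˡ w)
    result : (∃ λ ν → 0ℚ < ν × (½ * w) * ν ≡ 1ℚ) → ∃ λ c → a ≤ c × Lower x c × Upper x (c + w)
    result (ν , 0<ν , e) =
      let n , bound = archimedean ((b - a) * ν)
          c , a≤c , Lc , Uc = approximate-step (½ * w) 0<½w n a La (upper-closed x {b} (b<a+nη n bound) Ub)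
      in c , a≤c , Lc , subst (λ w → Upper x (c + w)) ½w+½w≡w Uc
      where
      e₁ : (b - a) * ν * (½ * w) ≡ b - a
      e₁ = trans (*-assoc (b - a) ν (½ * w))
             (trans (cong (_*_ (b - a)) (trans (*-comm ν (½ * w)) e)) (*-identityʳ (b - a)))
      b<a+nη : ∀ n → (b - a) * ν < fromℕ n → b < a + fromℕ n * (½ * w)
      b<a+nη n bound = <-by {b} {a + fromℕ n * (½ * w)} {fromℕ n * (½ * w) - (b - a)}
        (solve 3 (λ a b z → a :+ z :- b := z :- (b :- a)) refl a b (fromℕ n * (½ * w)))
        (<⇒0< (subst (_< fromℕ n * (½ * w)) e₁ (*-monoˡ-< (½ * w) 0<½w bound)))

record Box (x y : ℝ) : Set where
  field
    a a′ b b′ : ℚ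
    a-lower   : Lower x a
    a′-upper  : Upper x a′
    b-lower   : Lower y b
    b′-upper  : Upper y b′

AllCorners : ∀ {x y} → (ℚ → Set) → Box x y → Set
AllCorners P box = P (a * b) × P (a * b′) × P (a′ * b) × P (a′ * b′)
  where open Box box

module *-Lemmas where
  open ℚ-Lemmas

  min₄ max₄ : ℚ → ℚ → ℚ → ℚ → ℚ
  min₄ s t u v = (s ⊓ t) ⊓ (u ⊓ v)
  max₄ s t u v = (s ⊔ t) ⊔ (u ⊔ v)

  <-⊓ : ∀ {q} s t → q < s → q < t → q < s ⊓ t
  <-⊓ {q} s t q<s q<t = [ (λ e → subst (q <_) (sym e) q<s) , (λ e → subst (q <_) (sym e) q<t) ]′ (⊓-sel s t)

  ⊔-< : ∀ {q} s t → s < q → t < q → s ⊔ t < q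
  ⊔-< {q} s t s<q t<q = [ (λ e → subst (_< q) (sym e) s<q) , (λ e → subst (_< q) (sym e) t<q) ]′ (⊔-sel s t)

  <-min₄ : ∀ {q} s t u v → q < s × q < t × q < u × q < v → q < min₄ s t u v
  <-min₄ s t u v (qs , qt , qu , qv) = <-⊓ (s ⊓ t) (u ⊓ v) (<-⊓ s t qs qt) (<-⊓ u v qu qv)

  max₄-< : ∀ {q} s t u v → s < q × t < q × u < q × v < q → max₄ s t u v < q
  max₄-< s t u v (qs , qt , qu , qv) = ⊔-< (s ⊔ t) (u ⊔ v) (⊔-< s t qs qt) (⊔-< u v qu qv)

  min₄-< : ∀ {q} s t u v → q < min₄ s t u v → q < s × q < t × q < u × q < v
  min₄-< s t u v q< =
      <-≤-trans q< (≤-trans (p⊓q≤p (s ⊓ t) (u ⊓ v)) (p⊓q≤p s t))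
    , <-≤-trans q< (≤-trans (p⊓q≤p (s ⊓ t) (u ⊓ v)) (p⊓q≤q s t))
    , <-≤-trans q< (≤-trans (p⊓q≤q (s ⊓ t) (u ⊓ v)) (p⊓q≤p u v))
    , <-≤-trans q< (≤-trans (p⊓q≤q (s ⊓ t) (u ⊓ v)) (p⊓q≤q u v))

  <-max₄ : ∀ {q} s t u v → max₄ s t u v < q → s < q × t < q × u < q × v < q
  <-max₄ s t u v <q =
      ≤-<-trans (≤-trans (p≤p⊔q s t) (p≤p⊔q (s ⊔ t) (u ⊔ v))) <q
    , ≤-<-trans (≤-trans (p≤q⊔p s t) (p≤p⊔q (s ⊔ t) (u ⊔ v))) <q
    , ≤-<-trans (≤-trans (p≤p⊔q u v) (p≤q⊔p (s ⊔ t) (u ⊔ v))) <q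
    , ≤-<-trans (≤-trans (p≤q⊔p u v) (p≤q⊔p (s ⊔ t) (u ⊔ v))) <q

  q-1<q : ∀ q → q - 1ℚ < q
  q-1<q q = <-by {q - 1ℚ} {q} {1ℚ} (solve 1 (λ r → r :- (r :- con 1ℚ) := con 1ℚ) refl q) 0<1

  q<q+1 : ∀ q → q < q + 1ℚ
  q<q+1 q = <-by {q} {q + 1ℚ} {1ℚ} (solve 1 (λ r → r :+ con 1ℚ :- r := con 1ℚ) refl q) 0<1

  below : ∀ s t u v → ∃ λ q → q < s × q < t × q < u × q < v
  below s t u v = min₄ s t u v - 1ℚ , min₄-< s t u v (q-1<q (min₄ s t u v))

  above : ∀ s t u v → ∃ λ q → s < q × t < q × u < q × v < q
  above s t u v = max₄ s t u v + 1ℚ , <-max₄ s t u v (q<q+1 (max₄ s t u v))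

  between-below : ∀ p s t u v → p < s × p < t × p < u × p < v →
                  ∃ λ q → p < q × (q < s × q < t × q < u × q < v)
  between-below p s t u v p< =
    let q , p<q , q<m = <-dense (<-min₄ s t u v p<) in q , p<q , min₄-< s t u v q<m

  between-above : ∀ q s t u v → s < q × t < q × u < q × v < q →
                  ∃ λ p → p < q × (s < p × t < p × u < p × v < p)
  between-above q s t u v <q =
    let p , m<p , p<q = <-dense (max₄-< s t u v <q) in p , p<q , <-max₄ s t u v m<p

  *-antimonoˡ-≤ : ∀ r {p q} → r ≤ 0ℚ → p ≤ q → q * r ≤ p * r
  *-antimonoˡ-≤ r r≤0 = *-monoʳ-≤-nonPos r {{nonPositive r≤0}}

  segment-below : ∀ q a a′ c d → a ≤ c → c ≤ a′ → q < a * d → q < a′ * d → q < c * d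
  segment-below q a a′ c d a≤c c≤a′ q<ad q<a′d = [ (λ 0≤d → <-≤-trans q<ad (*-monoˡ-≤ d 0≤d a≤c))
                                                 , (λ d≤0 → <-≤-trans q<a′d (*-antimonoˡ-≤ d d≤0 c≤a′)) ]′ (≤-total 0ℚ d)

  segment-above : ∀ q a a′ c d → a ≤ c → c ≤ a′ → a * d < q → a′ * d < q → c * d < q
  segment-above q a a′ c d a≤c c≤a′ ad<q a′d<q = [ (λ 0≤d → ≤-<-trans (*-monoˡ-≤ d 0≤d c≤a′) a′d<q)
                                                 , (λ d≤0 → ≤-<-trans (*-antimonoˡ-≤ d d≤0 a≤c) ad<q) ]′ (≤-total 0ℚ d)

  box-below : ∀ q a a′ b b′ c d → a ≤ c → c ≤ a′ → b ≤ d → d ≤ b′ →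
              q < a * b × q < a * b′ × q < a′ * b × q < a′ * b′ → q < c * d
  box-below q a a′ b b′ c d ac ca bd db (qab , qab′ , qa′b , qa′b′) =
    segment-below q a a′ c d ac ca (flip a qab qab′) (flip a′ qa′b qa′b′)
    where
    flip : ∀ e → q < e * b → q < e * b′ → q < e * d
    flip e l r = subst (q <_) (*-comm d e) (segment-below q b b′ d e bd db
      (subst (q <_) (*-comm e b) l) (subst (q <_) (*-comm e b′) r))

  box-above : ∀ q a a′ b b′ c d → a ≤ c → c ≤ a′ → b ≤ d → d ≤ b′ →
              a * b < q × a * b′ < q × a′ * b < q × a′ * b′ < q → c * d < q
  box-above q a a′ b b′ c d ac ca bd db (qab , qab′ , qa′b , qa′b′) =
    segment-above q a a′ c d ac ca (flip a qab qab′) (flip a′ qa′b qa′b′)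
    where
    flip : ∀ e → e * b < q → e * b′ < q → e * d < q
    flip e l r = subst (_< q) (*-comm d e) (segment-above q b b′ d e bd db
      (subst (_< q) (*-comm e b) l) (subst (_< q) (*-comm e b′) r))

  magnitude : ∀ a a′ → ∃ λ A → 0ℚ ≤ A × - A ≤ a × a′ ≤ A
  magnitude a a′ = A , p≤q⊔p (a′ ⊔ (- a)) 0ℚ
    , subst (- A ≤_) (solve 1 (λ a → :- (:- a) := a) refl a) (neg-antimono-≤ (≤-trans (p≤q⊔p a′ (- a)) (p≤p⊔q (a′ ⊔ (- a)) 0ℚ)))
    , ≤-trans (p≤p⊔q a′ (- a)) (p≤p⊔q (a′ ⊔ (- a)) 0ℚ)
    where
    A : ℚ
    A = (a′ ⊔ (- a)) ⊔ 0ℚ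

  -- For q - p = δ + δ, corners of a box of width w around (c , d) are within
  -- w * B < δ of c * d, so they all exceed p or are all exceeded by q.
  module Corners (p q : ℚ) (p<q : p < q) (A D : ℚ) (0≤A : 0ℚ ≤ A) (0≤D : 0ℚ ≤ D) where
    δ B : ℚ
    δ = ½ * (q - p)
    B = A + D + 1ℚ
    0<δ : 0ℚ < δ
    0<δ = *-pos (positive⁻¹ ½) (<⇒0< p<q)
    δ+δ≡q-p : δ + δ ≡ q - p
    δ+δ≡q-p = trans (sym (*-distribʳ-+ (q - p) ½ ½)) (*-identityˡ (q - p))
    0<B : 0ℚ < B
    0<B = subst (0ℚ <_) (+-comm 1ℚ (A + D)) (+-pos-nonNeg 0<1 (+-nonNeg 0≤A 0≤D))

    width : ∃ λ w → 0ℚ < w × w < 1ℚ × w * B < δ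
    width =
      let ν , 0<ν , e = recip (δ + B) (+-pos 0<δ 0<B)
      in δ * ν , *-pos 0<δ 0<ν
       , <-by {δ * ν} {1ℚ} {B * ν} (trans (cong (_- δ * ν) (sym e))
           (solve 3 (λ δ B ν → (δ :+ B) :* ν :- δ :* ν := B :* ν) refl δ B ν)) (*-pos 0<B 0<ν)
       , <-by {δ * ν * B} {δ} {δ * (δ * ν)} (trans (cong (_- δ * ν * B) (trans (sym (*-identityʳ δ)) (cong (_*_ δ) (sym e))))
           (solve 3 (λ δ B ν → δ :* ((δ :+ B) :* ν) :- δ :* ν :* B := δ :* (δ :* ν)) refl δ B ν)) (*-pos 0<δ (*-pos 0<δ 0<ν))

    module _ (w : ℚ) (0<w : 0ℚ < w) (w<1 : w < 1ℚ) (wB<δ : w * B < δ)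
             (c d : ℚ) (-A≤c : - A ≤ c) (c≤A : c ≤ A) (-D≤d : - D ≤ d) (d≤D : d ≤ D) where

      Small : ℚ → Set
      Small t = - B ≤ t × t ≤ B

      small-0 : Small 0ℚ
      small-0 = neg-antimono-≤ (<⇒≤ 0<B) , <⇒≤ 0<B

      small-c : Small c
      small-c = ≤-trans (≤-by { - B} { - A} {D + 1ℚ} (solve 2 (λ A D → (:- A) :- (:- (A :+ D :+ con 1ℚ)) := D :+ con 1ℚ) refl A D)
                  (+-nonNeg 0≤D (<⇒≤ 0<1))) -A≤c
              , ≤-trans c≤A (≤-by {A} {B} {D + 1ℚ} (solve 2 (λ A D → A :+ D :+ con 1ℚ :- A := D :+ con 1ℚ) refl A D)
                  (+-nonNeg 0≤D (<⇒≤ 0<1)))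

      small-d : Small d
      small-d = ≤-trans (≤-by { - B} { - D} {A + 1ℚ} (solve 2 (λ A D → (:- D) :- (:- (A :+ D :+ con 1ℚ)) := A :+ con 1ℚ) refl A D)
                  (+-nonNeg 0≤A (<⇒≤ 0<1))) -D≤d
              , ≤-trans d≤D (≤-by {D} {B} {A + 1ℚ} (solve 2 (λ A D → A :+ D :+ con 1ℚ :- D := A :+ con 1ℚ) refl A D)
                  (+-nonNeg 0≤A (<⇒≤ 0<1)))

      small-c+d+w : Small (c + d + w)
      small-c+d+w =
          subst (_≤ c + d + w) (solve 2 (λ A D → (:- A) :+ (:- D) :+ (:- con 1ℚ) := :- (A :+ D :+ con 1ℚ)) refl A D)
            (+-mono-≤ (+-mono-≤ -A≤c -D≤d) (≤-trans (neg-antimono-≤ (<⇒≤ 0<1)) (<⇒≤ 0<w)))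
        , +-mono-≤ (+-mono-≤ c≤A d≤D) (<⇒≤ w<1)

      all-small : (P : ℚ → Set) → (∀ t → Small t → P (c * d + w * t)) →
                  P (c * d) × P (c * (d + w)) × P ((c + w) * d) × P ((c + w) * (d + w))
      all-small P h =
          subst P (solve 3 (λ c d w → c :* d :+ w :* con 0ℚ := c :* d) refl c d w) (h 0ℚ small-0)
        , subst P (solve 3 (λ c d w → c :* d :+ w :* c := c :* (d :+ w)) refl c d w) (h c small-c)
        , subst P (solve 3 (λ c d w → c :* d :+ w :* d := (c :+ w) :* d) refl c d w) (h d small-d)
        , subst P (solve 3 (λ c d w → c :* d :+ w :* (c :+ d :+ w) := (c :+ w) :* (d :+ w)) refl c d w) (h (c + d + w) small-c+d+w)

      decide : (p < c * d × p < c * (d + w) × p < (c + w) * d × p < (c + w) * (d + w))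
             ⊎ (c * d < q × c * (d + w) < q × (c + w) * d < q × (c + w) * (d + w) < q)
      decide = [ (λ m≤cd → inj₁ (all-small (p <_) (up m≤cd))) , (λ cd≤m → inj₂ (all-small (_< q) (down cd≤m))) ]′
                 (≤-total (p + δ) (c * d))
        where
        up : p + δ ≤ c * d → ∀ t → Small t → p < c * d + w * t
        up m≤cd t (-B≤t , _) = <-by {p} {c * d + w * t} {(δ - w * B) + ((c * d - (p + δ)) + (w * t - w * (- B)))}
          (solve 6 (λ p δ z w t B → z :+ w :* t :- p := (δ :- w :* B) :+ ((z :- (p :+ δ)) :+ (w :* t :- w :* (:- B)))) refl p δ (c * d) w t B)
          (+-pos-nonNeg (<⇒0< wB<δ) (+-nonNeg (≤⇒0≤ m≤cd) (≤⇒0≤ (*-monoʳ-≤ w (<⇒≤ 0<w) -B≤t))))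
        q≡p+δ+δ : q ≡ p + (δ + δ)
        q≡p+δ+δ = trans (solve 2 (λ q p → q := p :+ (q :- p)) refl q p) (cong (_+_ p) (sym δ+δ≡q-p))
        down : c * d ≤ p + δ → ∀ t → Small t → c * d + w * t < q
        down cd≤m t (_ , t≤B) = subst (c * d + w * t <_) (sym q≡p+δ+δ)
          (<-by {c * d + w * t} {p + (δ + δ)} {(δ - w * B) + (((p + δ) - c * d) + (w * B - w * t))}
            (solve 6 (λ p δ z w t B → p :+ (δ :+ δ) :- (z :+ w :* t) := (δ :- w :* B) :+ (((p :+ δ) :- z) :+ (w :* B :- w :* t))) refl p δ (c * d) w t B)
            (+-pos-nonNeg (<⇒0< wB<δ) (+-nonNeg (≤⇒0≤ cd≤m) (≤⇒0≤ (*-monoʳ-≤ w (<⇒≤ 0<w) t≤B)))))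

module _ (x y : ℝ) where
  open ℚ-Lemmas
  open *-Lemmas
  private
    module X = ℝ-Lemmas x
    module Y = ℝ-Lemmas y

    some-box : Box x y
    some-box = record { a-lower = proj₂ (lower-inhabited x) ; a′-upper = proj₂ (upper-inhabited x)
                      ; b-lower = proj₂ (lower-inhabited y) ; b′-upper = proj₂ (upper-inhabited y) }

    *-disjoint : ∀ {q} → ∃ (AllCorners {x} {y} (q <_)) → ¬ ∃ (AllCorners {x} {y} (_< q))
    *-disjoint {q} (β , q<) (γ , <q) = <-asym
      (box-below q B.a B.a′ B.b B.b′ c d (p≤p⊔q B.a C.a) (⊔-lub (X< B.a-lower B.a′-upper) (X< C.a-lower B.a′-upper))
                                         (p≤p⊔q B.b C.b) (⊔-lub (Y< B.b-lower B.b′-upper) (Y< C.b-lower B.b′-upper)) q<)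
      (box-above q C.a C.a′ C.b C.b′ c d (p≤q⊔p B.a C.a) (⊔-lub (X< B.a-lower C.a′-upper) (X< C.a-lower C.a′-upper))
                                         (p≤q⊔p B.b C.b) (⊔-lub (Y< B.b-lower C.b′-upper) (Y< C.b-lower C.b′-upper)) <q)
      where
      module B = Box β
      module C = Box γ
      c d : ℚ
      c = B.a ⊔ C.a
      d = B.b ⊔ C.b
      X< : ∀ {p q} → Lower x p → Upper x q → p ≤ q
      X< l u = <⇒≤ (X.lower<upper l u)
      Y< : ∀ {p q} → Lower y p → Upper y q → p ≤ q
      Y< l u = <⇒≤ (Y.lower<upper l u)

    *-located : ∀ {p q} → p < q → ∃ (AllCorners {x} {y} (p <_)) ⊎ ∃ (AllCorners {x} {y} (_< q))
    *-located {p} {q} p<q =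
      let a , La = lower-inhabited x
          a′ , Ua′ = upper-inhabited x
          b , Lb = lower-inhabited y
          b′ , Ub′ = upper-inhabited y
          A , 0≤A , -A≤a , a′≤A = magnitude a a′
          D , 0≤D , -D≤b , b′≤D = magnitude b b′
          w , 0<w , w<1 , wB<δ = Corners.width p q p<q A D 0≤A 0≤D
          c , a≤c , Lc , Uc = X.approximate a a′ w 0<w La Ua′
          d , b≤d , Ld , Ud = Y.approximate b b′ w 0<w Lb Ub′
          box = record { a-lower = Lc ; a′-upper = Uc ; b-lower = Ld ; b′-upper = Ud }
      in [ (λ p< → inj₁ (box , p<)) , (λ <q → inj₂ (box , <q)) ]′
           (Corners.decide p q p<q A D 0≤A 0≤D w 0<w w<1 wB<δ c d
             (≤-trans -A≤a a≤c) (≤-trans (<⇒≤ (X.lower<upper Lc Ua′)) a′≤A)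
             (≤-trans -D≤b b≤d) (≤-trans (<⇒≤ (Y.lower<upper Ld Ub′)) b′≤D))

  -- Interval multiplication: p < x y (resp. x y < q) when some rational box
  -- around (x , y) has all its corner products above p (resp. below q).
  infixl 7 _*ℝ_
  _*ℝ_ : ℝ
  _*ℝ_ = record
    { Lower           = λ q → ∃ (AllCorners {x} {y} (q <_))
    ; Upper           = λ q → ∃ (AllCorners {x} {y} (_< q))
    ; lower-inhabited = let open Box some-box ; q , q< = below (a * b) (a * b′) (a′ * b) (a′ * b′) in q , some-box , q<
    ; upper-inhabited = let open Box some-box ; q , <q = above (a * b) (a * b′) (a′ * b) (a′ * b′) in q , some-box , <q
    ; lower-closed    = λ p<q (β , s , t , u , v) → β , <-trans p<q s , <-trans p<q t , <-trans p<q u , <-trans p<q v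
    ; upper-closed    = λ p<q (β , s , t , u , v) → β , <-trans s p<q , <-trans t p<q , <-trans u p<q , <-trans v p<q
    ; lower-open      = λ {p} (β , p<) → let open Box β ; q , p<q , q< = between-below p (a * b) (a * b′) (a′ * b) (a′ * b′) p<
                                         in q , p<q , β , q<
    ; upper-open      = λ {q} (β , <q) → let open Box β ; p , p<q , <p = between-above q (a * b) (a * b′) (a′ * b) (a′ * b′) <q
                                         in p , p<q , β , <p
    ; disjoint        = *-disjoint
    ; located         = *-located
    }

Positive-ℝ : ℝ → Set
Positive-ℝ x = 0ℝ <ℝ x

module Positive-Lemmas (x : ℝ) (0<x : Positive-ℝ x) where
  open ℚ-Lemmas
  open ℝ-Lemmas x public

  positive-lower : ∃ λ r → 0ℚ < r × Lower x r
  positive-lower = 0<x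

  upper⇒pos : ∀ {r} → Upper x r → 0ℚ < r
  upper⇒pos Ur = let s , 0<s , Ls = 0<x in <-trans 0<s (lower<upper Ls Ur)

  inverse : ℝ
  inverse = record
    { Lower           = λ q → ∃ λ r → Upper x r × q * r < 1ℚ
    ; Upper           = λ q → ∃ λ r → 0ℚ < r × Lower x r × 1ℚ < q * r
    ; lower-inhabited = let r , Ur = upper-inhabited x in 0ℚ , r , Ur , subst (_< 1ℚ) (sym (*-zeroˡ r)) 0<1
    ; upper-inhabited = let r , 0<r , Lr = 0<x in upper-witness r 0<r Lr
    ; lower-closed    = λ {p} {q} p<q (r , Ur , qr<1) → r , Ur , <-trans (*-monoˡ-< r (upper⇒pos Ur) p<q) qr<1
    ; upper-closed    = λ {p} {q} p<q (r , 0<r , Lr , 1<pr) → r , 0<r , Lr , <-trans 1<pr (*-monoˡ-< r 0<r p<q)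
    ; lower-open      = λ {p} (r , Ur , pr<1) → let q , p<q , qr<1 = enlarge p r (upper⇒pos Ur) pr<1 in q , p<q , r , Ur , qr<1
    ; upper-open      = λ {q} (r , 0<r , Lr , 1<qr) → let p , p<q , 1<pr = shrink q r 0<r 1<qr in p , p<q , r , 0<r , Lr , 1<pr
    ; disjoint        = λ {q} → disj {q}
    ; located         = loc
    }
    where
    cancel : ∀ r p q → 0ℚ < r → p * r < q * r → p < q
    cancel r p q 0<r = *-cancelʳ-<-nonNeg r {{nonNegative (<⇒≤ 0<r)}} {p} {q}
    upper-witness : ∀ r → 0ℚ < r → Lower x r → ∃ λ q → ∃ λ r → 0ℚ < r × Lower x r × 1ℚ < q * r
    upper-witness r 0<r Lr =
      let ν , 0<ν , e = recip r 0<r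
      in ν + 1ℚ , r , 0<r , Lr , <-by {1ℚ} {(ν + 1ℚ) * r} {r}
           (trans (cong (λ z → (ν + 1ℚ) * r - z) (sym e)) (solve 2 (λ ν r → (ν :+ con 1ℚ) :* r :- r :* ν := r) refl ν r)) 0<r
    νr≡1 : ∀ r ν → r * ν ≡ 1ℚ → ν * r ≡ 1ℚ
    νr≡1 r ν e = trans (*-comm ν r) e
    enlarge : ∀ p r → 0ℚ < r → p * r < 1ℚ → ∃ λ q → p < q × q * r < 1ℚ
    enlarge p r 0<r pr<1 =
      let ν , 0<ν , e = recip r 0<r
          q , p<q , q<ν = <-dense (cancel r p ν 0<r (subst (p * r <_) (sym (νr≡1 r ν e)) pr<1))
      in q , p<q , subst (q * r <_) (νr≡1 r ν e) (*-monoˡ-< r 0<r q<ν)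
    shrink : ∀ q r → 0ℚ < r → 1ℚ < q * r → ∃ λ p → p < q × 1ℚ < p * r
    shrink q r 0<r 1<qr =
      let ν , 0<ν , e = recip r 0<r
          p , ν<p , p<q = <-dense (cancel r ν q 0<r (subst (_< q * r) (sym (νr≡1 r ν e)) 1<qr))
      in p , p<q , subst (_< p * r) (νr≡1 r ν e) (*-monoˡ-< r 0<r ν<p)
    disj : ∀ {q} → ∃ (λ r → Upper x r × q * r < 1ℚ) → ¬ ∃ (λ r → 0ℚ < r × Lower x r × 1ℚ < q * r)
    disj {q} (r , Ur , qr<1) (s , 0<s , Ls , 1<qs) = <-asym (*-monoʳ-< q 0<q (lower<upper Ls Ur)) (<-trans qr<1 1<qs)
      where
      0<q : 0ℚ < q
      0<q = cancel s 0ℚ q 0<s (subst (_< q * s) (sym (*-zeroˡ s)) (<-trans 0<1 1<qs))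
    loc : ∀ {p q} → p < q → ∃ (λ r → Upper x r × p * r < 1ℚ) ⊎ ∃ (λ r → 0ℚ < r × Lower x r × 1ℚ < q * r)
    loc {p} {q} p<q = [ loc-≤0 , loc-0< ]′ (split (p ≤? 0ℚ))
      where
      split : Dec (p ≤ 0ℚ) → p ≤ 0ℚ ⊎ 0ℚ < p
      split (yes p≤0) = inj₁ p≤0
      split (no p≰0)  = inj₂ (≰⇒> p≰0)
      loc-≤0 : p ≤ 0ℚ → ∃ (λ r → Upper x r × p * r < 1ℚ) ⊎ ∃ (λ r → 0ℚ < r × Lower x r × 1ℚ < q * r)
      loc-≤0 p≤0 = let r , Ur = upper-inhabited x
                   in inj₁ (r , Ur , ≤-<-trans (subst (p * r ≤_) (*-zeroˡ r) (*-monoˡ-≤ r (<⇒≤ (upper⇒pos Ur)) p≤0)) 0<1)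
      loc-0< : 0ℚ < p → ∃ (λ r → Upper x r × p * r < 1ℚ) ⊎ ∃ (λ r → 0ℚ < r × Lower x r × 1ℚ < q * r)
      loc-0< 0<p =
        let s , p<s , s<q = <-dense p<q
            t , s<t , t<q = <-dense s<q
            0<s = <-trans 0<p p<s
            0<t = <-trans 0<s s<t
            σ , 0<σ , sσ = recip s 0<s
            τ , 0<τ , tτ = recip t 0<t
            τ<σ = <-by {τ} {σ} {σ * τ * (t - s)}
              (trans (cong₂ (λ a b → a - b) (trans (sym (*-identityʳ σ)) (cong (_*_ σ) (sym tτ))) (trans (sym (*-identityʳ τ)) (cong (_*_ τ) (sym sσ))))
                (solve 4 (λ s t σ τ → σ :* (t :* τ) :- τ :* (s :* σ) := σ :* τ :* (t :- s)) refl s t σ τ))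
              (*-pos (*-pos 0<σ 0<τ) (<⇒0< s<t))
        in [ (λ Lτ → inj₂ (τ , 0<τ , Lτ , subst (_< q * τ) tτ (*-monoˡ-< τ 0<τ t<q)))
           , (λ Uσ → inj₁ (σ , Uσ , subst (p * σ <_) sσ (*-monoˡ-< σ 0<σ p<s))) ]′ (located x τ<σ)

infixl 7 _÷ℝ_[_]

_÷ℝ_[_] : ℝ → (y : ℝ) → Positive-ℝ y → ℝ
x ÷ℝ y [ 0<y ] = x *ℝ Positive-Lemmas.inverse y 0<y

-- base q m = 1 + q / n and compound q m = (1 + q / n) ^ n with n = suc m;
-- as n grows past - q, this increases to exp q.
base compound : ℚ → ℕ → ℚ
base     q m = 1ℚ + q * 1/ fromℕ (suc m)
compound q m = base q m ^ suc m

module Log-Lemmas where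
  open ℚ-Lemmas

  step : ℕ → ℚ
  step m = 1/ fromℕ (suc m)

  fromℕ*step : ∀ m → fromℕ (suc m) * step m ≡ 1ℚ
  fromℕ*step m = *-inverseʳ (fromℕ (suc m))

  0<step : ∀ m → 0ℚ < step m
  0<step m = positive⁻¹ (step m)

  step≤1 : ∀ m → step m ≤ 1ℚ
  step≤1 m = ≤-by {step m} {1ℚ} {fromℕ m * step m}
    (trans (cong (_- step m) (trans (sym (fromℕ*step m)) (cong (_* step m) (fromℕ-suc m))))
      (solve 2 (λ N h → (con 1ℚ :+ N) :* h :- h := N :* h) refl (fromℕ m) (step m)))
    (*-nonNeg (0≤fromℕ m) (<⇒≤ (0<step m)))

  base-mono : ∀ {p q} m → p < q → base p m < base q m
  base-mono {p} {q} m p<q = +-monoʳ-< 1ℚ (*-monoˡ-< (step m) (0<step m) p<q)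

  compound-mono : ∀ {p q} m → p < q → 0ℚ < base p m → compound p m ≤ compound q m
  compound-mono m p<q 0<b = ^-mono-≤ (suc m) 0<b (<⇒≤ (base-mono m p<q))

  -- u bⁿ ≤ v (b - δ / n)ⁿ with δ = b (1 - u / v)
  nudge : ∀ b m u v → 0ℚ < b → 0ℚ < u → u < v →
          ∃ λ δ → 0ℚ < δ × 0ℚ < b - δ * step m × u * b ^ suc m ≤ v * (b - δ * step m) ^ suc m
  nudge b m u v 0<b 0<u u<v = result (recip v (<-trans 0<u u<v))
    where
    h : ℚ
    h = step m
    n : ℕ
    n = suc m
    result : (∃ λ ν → 0ℚ < ν × v * ν ≡ 1ℚ) →
             ∃ λ δ → 0ℚ < δ × 0ℚ < b - δ * h × u * b ^ n ≤ v * (b - δ * h) ^ n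
    result (ν , 0<ν , vν) = b * t , *-pos 0<b 0<t , subst (0ℚ <_) bx≡ (*-pos 0<b 0<1+x)
      , subst₂ _≤_ lhs rhs (*-monoʳ-≤ (v * b ^ n) (<⇒≤ (*-pos (<-trans 0<u u<v) (^-pos n 0<b))) (bernoulli (- (t * h)) n 0<1+x))
      where
      t : ℚ
      t = (v - u) * ν
      0<t : 0ℚ < t
      0<t = *-pos (<⇒0< u<v) 0<ν
      1-t≡uν : 1ℚ - t ≡ u * ν
      1-t≡uν = trans (cong (_- t) (sym vν)) (solve 3 (λ u v ν → v :* ν :- (v :- u) :* ν := u :* ν) refl u v ν)
      0<1+x : 0ℚ < 1ℚ + - (t * h)
      0<1+x = subst (0ℚ <_) (trans (cong (_+ t * (1ℚ - h)) (sym 1-t≡uν))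
                (solve 2 (λ t h → con 1ℚ :- t :+ t :* (con 1ℚ :- h) := con 1ℚ :+ :- (t :* h)) refl t h))
                (+-pos-nonNeg (*-pos 0<u 0<ν) (*-nonNeg (<⇒≤ 0<t) (≤⇒0≤ (step≤1 m))))
      bx≡ : b * (1ℚ + - (t * h)) ≡ b - b * t * h
      bx≡ = solve 3 (λ b t h → b :* (con 1ℚ :+ :- (t :* h)) := b :- b :* t :* h) refl b t h
      lhs : v * b ^ n * (1ℚ + fromℕ n * - (t * h)) ≡ u * b ^ n
      lhs = begin
        v * b ^ n * (1ℚ + fromℕ n * - (t * h))  ≡⟨ solve 5 (λ v B N t h → v :* B :* (con 1ℚ :+ N :* (:- (t :* h))) := v :* B :* (con 1ℚ :- t :* (N :* h))) refl v (b ^ n) (fromℕ n) t h ⟩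
        v * b ^ n * (1ℚ - t * (fromℕ n * h))    ≡⟨ cong (λ z → v * b ^ n * (1ℚ - t * z)) (fromℕ*step m) ⟩
        v * b ^ n * (1ℚ - t * 1ℚ)               ≡⟨ cong (λ z → v * b ^ n * (1ℚ - z)) (*-identityʳ t) ⟩
        v * b ^ n * (1ℚ - t)                    ≡⟨ cong (v * b ^ n *_) 1-t≡uν ⟩
        v * b ^ n * (u * ν)                     ≡⟨ solve 4 (λ v B u ν → v :* B :* (u :* ν) := v :* ν :* (u :* B)) refl v (b ^ n) u ν ⟩
        v * ν * (u * b ^ n)                     ≡⟨ cong (_* (u * b ^ n)) vν ⟩
        1ℚ * (u * b ^ n)                        ≡⟨ *-identityˡ (u * b ^ n) ⟩
        u * b ^ n                               ∎
        where open ≡-Reasoning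
      rhs : v * b ^ n * (1ℚ + - (t * h)) ^ n ≡ v * (b - b * t * h) ^ n
      rhs = trans (*-assoc v (b ^ n) ((1ℚ + - (t * h)) ^ n))
              (cong (_*_ v) (trans (sym (^-distrib-* b (1ℚ + - (t * h)) n)) (cong (_^ n) bx≡)))

  base-suc : ∀ m z → 0ℚ < 1ℚ + fromℕ (suc m) * z → 0ℚ < 1ℚ + z
  base-suc m z 0<1+nz = *-cancelˡ-<-nonNeg (fromℕ (suc m)) {0ℚ} {1ℚ + z}
    (subst₂ _<_ (sym (*-zeroʳ (fromℕ (suc m)))) e (+-pos-nonNeg 0<1+nz (0≤fromℕ m)))
    where
    e : 1ℚ + fromℕ (suc m) * z + fromℕ m ≡ fromℕ (suc m) * (1ℚ + z)
    e = trans (solve 3 (λ N M z → con 1ℚ :+ N :* z :+ M := (con 1ℚ :+ M) :+ N :* z) refl (fromℕ (suc m)) (fromℕ m) z)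
      (trans (cong (_+ fromℕ (suc m) * z) (sym (fromℕ-suc m)))
        (solve 2 (λ N z → N :+ N :* z := N :* (con 1ℚ :+ z)) refl (fromℕ (suc m)) z))

  refine : ∀ q m k → 0ℚ < base q k → compound q k ≤ (1ℚ + q * step m * step k) ^ (suc m ℕ.* suc k)
         × 0ℚ < 1ℚ + q * step m * step k
  refine q m k 0<b = subst (compound q k ≤_) (^-assocʳ (1ℚ + z) (suc m) (suc k))
                       (^-mono-≤ (suc k) 0<b (subst (_≤ (1ℚ + z) ^ suc m) (cong (_+_ 1ℚ) nz) (bernoulli z (suc m) 0<1+z)))
                   , 0<1+z
    where
    z : ℚ
    z = q * step m * step k
    nz : fromℕ (suc m) * z ≡ q * step k
    nz = trans (solve 4 (λ N q h k → N :* (q :* h :* k) := N :* h :* (q :* k)) refl (fromℕ (suc m)) q (step m) (step k))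
           (trans (cong (_* (q * step k)) (fromℕ*step m)) (*-identityˡ (q * step k)))
    0<1+z : 0ℚ < 1ℚ + z
    0<1+z = base-suc m z (subst (0ℚ <_) (cong (_+_ 1ℚ) (sym nz)) 0<b)

  compound-inverse : ∀ q k m → 0ℚ < base q k → 0ℚ < base (- q) m → compound q k * compound (- q) m ≤ 1ℚ
  compound-inverse q k m 0<b 0<b′ =
    let le₁ , 0<u = refine q m k 0<b
        le₂ , 0<v = refine (- q) k m 0<b′
    in ≤-trans (*-monoˡ-≤ (compound (- q) m) (<⇒≤ (^-pos (suc m) 0<b′)) le₁)
       (≤-trans (*-monoʳ-≤ ((1ℚ + q * step m * step k) ^ N) (<⇒≤ (^-pos N 0<u)) le₂) (final 0<u 0<v))
    where
    N : ℕ
    N = suc m ℕ.* suc k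
    z : ℚ
    z = q * step m * step k
    final : 0ℚ < 1ℚ + z → 0ℚ < 1ℚ + (- q) * step k * step m →
            (1ℚ + z) ^ N * (1ℚ + (- q) * step k * step m) ^ (suc k ℕ.* suc m) ≤ 1ℚ
    final 0<u 0<v = subst₂ _≤_ e (1^n≡1 N) (^-mono-≤ N (*-pos 0<u 0<v) le)
      where
      w : ℚ
      w = 1ℚ + (- q) * step k * step m
      e : ((1ℚ + z) * w) ^ N ≡ (1ℚ + z) ^ N * w ^ (suc k ℕ.* suc m)
      e = trans (^-distrib-* (1ℚ + z) w N) (cong (λ j → (1ℚ + z) ^ N * w ^ j) (ℕₚ.*-comm (suc m) (suc k)))
      le : (1ℚ + z) * w ≤ 1ℚ
      le = ≤-by {(1ℚ + z) * w} {1ℚ} {z * z}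
        (solve 3 (λ q h k → con 1ℚ :- (con 1ℚ :+ q :* h :* k) :* (con 1ℚ :+ (:- q) :* k :* h) := (q :* h :* k) :* (q :* h :* k)) refl q (step m) (step k))
        (square-nonNeg z)

  separate : ∀ p q → p < q → ∃ λ m → 0ℚ < base (- p) m × 0ℚ < base q m × 1ℚ < compound q m * compound (- p) m
  separate p q p<q = result (recip (q - p) (<⇒0< p<q))
    where
    result : (∃ λ κ → 0ℚ < κ × (q - p) * κ ≡ 1ℚ) →
             ∃ λ m → 0ℚ < base (- p) m × 0ℚ < base q m × 1ℚ < compound q m * compound (- p) m
    result (κ , 0<κ , e) =
      let n₁ , l₁ = archimedean p
          n₂ , l₂ = archimedean (- q)
          n₃ , l₃ = archimedean (p * q * κ)
          m = n₁ ℕ.+ (n₂ ℕ.+ n₃)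
      in m , proof m (bound n₁ m l₁ (ℕₚ.m≤m+n n₁ _))
                     (bound n₂ m l₂ (ℕₚ.≤-trans (ℕₚ.m≤m+n n₂ n₃) (ℕₚ.m≤n+m _ n₁)))
                     (bound n₃ m l₃ (ℕₚ.≤-trans (ℕₚ.m≤n+m n₃ n₂) (ℕₚ.m≤n+m _ n₁)))
      where
      bound : ∀ {x} n m → x < fromℕ n → n ℕ.≤ m → x < fromℕ (suc m)
      bound n m x<n n≤m = <-≤-trans x<n (fromℕ-mono (ℕₚ.m≤n⇒m≤1+n n≤m))
      base-pos : ∀ m x → - x < fromℕ (suc m) → 0ℚ < base x m
      base-pos m x -x<n = subst (0ℚ <_) eq (*-pos (<⇒0< -x<n) (0<step m))
        where
        eq : (fromℕ (suc m) - (- x)) * step m ≡ base x m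
        eq = trans (solve 3 (λ N x h → (N :- (:- x)) :* h := N :* h :+ x :* h) refl (fromℕ (suc m)) x (step m))
               (cong (_+ x * step m) (fromℕ*step m))
      proof : ∀ m → p < fromℕ (suc m) → - q < fromℕ (suc m) → p * q * κ < fromℕ (suc m) →
              0ℚ < base (- p) m × 0ℚ < base q m × 1ℚ < compound q m * compound (- p) m
      proof m p<n -q<n pqκ<n = 0<b , base-pos m q -q<n
        , <-≤-trans 1<1+ny (subst (1ℚ + fromℕ (suc m) * y ≤_) pow (bernoulli y (suc m) (+-pos 0<1 0<y)))
        where
        h y : ℚ
        h = step m
        y = h * h * ((q - p) * (fromℕ (suc m) - p * q * κ))
        0<b : 0ℚ < base (- p) m
        0<b = base-pos m (- p) (subst (_< fromℕ (suc m)) (solve 1 (λ a → a := :- (:- a)) refl p) p<n)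
        0<y : 0ℚ < y
        0<y = *-pos (*-pos (0<step m) (0<step m)) (*-pos (<⇒0< p<q) (<⇒0< pqκ<n))
        1<1+ny : 1ℚ < 1ℚ + fromℕ (suc m) * y
        1<1+ny = <-by {1ℚ} {1ℚ + fromℕ (suc m) * y} {fromℕ (suc m) * y}
          (solve 1 (λ z → con 1ℚ :+ z :- con 1ℚ := z) refl (fromℕ (suc m) * y))
          (*-pos (positive⁻¹ (fromℕ (suc m))) 0<y)
        1+y≡ : 1ℚ + y ≡ base q m * base (- p) m
        1+y≡ = begin
          1ℚ + h * h * ((q - p) * (fromℕ (suc m) - p * q * κ))
            ≡⟨ solve 5 (λ h p q N κ → con 1ℚ :+ h :* h :* ((q :- p) :* (N :- p :* q :* κ))
                 := con 1ℚ :+ h :* (q :- p) :* (N :* h) :- h :* h :* p :* q :* ((q :- p) :* κ)) refl h p q (fromℕ (suc m)) κ ⟩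
          1ℚ + h * (q - p) * (fromℕ (suc m) * h) - h * h * p * q * ((q - p) * κ)
            ≡⟨ cong₂ (λ s t → 1ℚ + h * (q - p) * s - h * h * p * q * t) (fromℕ*step m) e ⟩
          1ℚ + h * (q - p) * 1ℚ - h * h * p * q * 1ℚ
            ≡⟨ solve 3 (λ h p q → con 1ℚ :+ h :* (q :- p) :* con 1ℚ :- h :* h :* p :* q :* con 1ℚ
                 := (con 1ℚ :+ q :* h) :* (con 1ℚ :+ (:- p) :* h)) refl h p q ⟩
          (1ℚ + q * h) * (1ℚ + (- p) * h) ∎
          where open ≡-Reasoning
        pow : (1ℚ + y) ^ suc m ≡ compound q m * compound (- p) m
        pow = trans (cong (_^ suc m) 1+y≡) (^-distrib-* (base q m) (base (- p) m) (suc m))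

  step0 : step 0 ≡ 1ℚ
  step0 = trans (sym (*-identityˡ (step 0))) (fromℕ*step 0)

  base0 : ∀ q → base q 0 ≡ 1ℚ + q
  base0 q = trans (cong (λ h → 1ℚ + q * h) step0) (cong (_+_ 1ℚ) (*-identityʳ q))

  compound0 : ∀ q → compound q 0 ≡ 1ℚ + q
  compound0 q = trans (*-identityʳ (base q 0)) (base0 q)

module _ (x : ℝ) (0<x : Positive-ℝ x) where
  open ℚ-Lemmas
  open Log-Lemmas
  open Positive-Lemmas x 0<x

  private
    Log-Lower Log-Upper : ℚ → Set
    Log-Lower q = ∃₂ λ r m → 0ℚ < r × Lower x r × 0ℚ < base (- q) m × 1ℚ < r * compound (- q) m
    Log-Upper q = ∃₂ λ r m → Upper x r × 0ℚ < base q m × r < compound q m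

    cancel : ∀ r p q → 0ℚ < r → r * p < r * q → p < q
    cancel r p q 0<r = *-cancelˡ-<-nonNeg r {{nonNegative (<⇒≤ 0<r)}} {p} {q}

    log-lower-inhabited : ∃ Log-Lower
    log-lower-inhabited = result positive-lower
      where
      result : (∃ λ r → 0ℚ < r × Lower x r) → ∃ Log-Lower
      result (r , 0<r , Lr) =
        let ν , 0<ν , e = recip r 0<r
            ν≡ = solve 1 (λ a → a := :- (:- a)) refl ν
        in - ν , r , 0 , 0<r , Lr
         , subst (0ℚ <_) (trans (cong (_+_ 1ℚ) ν≡) (sym (base0 (- (- ν))))) (+-pos 0<1 0<ν)
         , subst (λ z → 1ℚ < r * z) (trans (cong (_+_ 1ℚ) ν≡) (sym (compound0 (- (- ν)))))
             (<-by {1ℚ} {r * (1ℚ + ν)} {r} (trans (cong (λ z → r * (1ℚ + ν) - z) (sym e))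
               (solve 2 (λ r ν → r :* (con 1ℚ :+ ν) :- r :* ν := r) refl r ν)) 0<r)

    log-upper-inhabited : ∃ Log-Upper
    log-upper-inhabited =
      let r , Ur = upper-inhabited x
      in r , r , 0 , Ur , subst (0ℚ <_) (sym (base0 r)) (+-pos 0<1 (upper⇒pos Ur))
       , subst (r <_) (sym (compound0 r)) (<-by {r} {1ℚ + r} {1ℚ} (solve 1 (λ r → con 1ℚ :+ r :- r := con 1ℚ) refl r) 0<1)

    log-lower-open : ∀ {p} → Log-Lower p → ∃ λ q → p < q × Log-Lower q
    log-lower-open {p} (r , m , 0<r , Lr , 0<b , 1<rc) =
      let r′ , r<r′ , Lr′ = lower-open x Lr
          δ , 0<δ , 0<b′ , le = nudge (base (- p) m) m r r′ 0<b 0<r r<r′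
          e = solve 3 (λ p δ h → con 1ℚ :+ (:- p) :* h :- δ :* h := con 1ℚ :+ (:- (p :+ δ)) :* h) refl p δ (step m)
      in p + δ , <-by {p} {p + δ} {δ} (solve 2 (λ p δ → p :+ δ :- p := δ) refl p δ) 0<δ
       , r′ , m , <-trans 0<r r<r′ , Lr′ , subst (0ℚ <_) e 0<b′
       , <-≤-trans 1<rc (subst (λ b → r * compound (- p) m ≤ r′ * b ^ suc m) e le)

    log-upper-open : ∀ {q} → Log-Upper q → ∃ λ p → p < q × Log-Upper p
    log-upper-open {q} (r , m , Ur , 0<b , r<c) =
      let r′ , r′<r , Ur′ = upper-open x Ur
          0<r′ = upper⇒pos Ur′
          δ , 0<δ , 0<b′ , le = nudge (base q m) m r′ r 0<b 0<r′ r′<r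
          e = solve 3 (λ q δ h → con 1ℚ :+ q :* h :- δ :* h := con 1ℚ :+ (q :- δ) :* h) refl q δ (step m)
      in q - δ , <-by {q - δ} {q} {δ} (solve 2 (λ q δ → q :- (q :- δ) := δ) refl q δ) 0<δ
       , r′ , m , Ur′ , subst (0ℚ <_) e 0<b′
       , cancel r r′ (compound (q - δ) m) (<-trans 0<r′ r′<r)
           (<-≤-trans (subst (_< r′ * compound q m) (*-comm r′ r) (*-monoʳ-< r′ 0<r′ r<c))
             (subst (λ b → r′ * compound q m ≤ r * b ^ suc m) e le))

    log-disjoint : ∀ {q} → Log-Lower q → ¬ Log-Upper q
    log-disjoint {q} (r , m , 0<r , Lr , 0<b , 1<rc) (s , k , Us , 0<b′ , s<c) =
      <-irrefl refl (<-trans 1<rc (<-≤-trans (*-monoˡ-< (compound (- q) m) (^-pos (suc m) 0<b)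
        (<-trans (lower<upper Lr Us) s<c)) (compound-inverse q k m 0<b′ 0<b)))

    log-located : ∀ {p q} → p < q → Log-Lower p ⊎ Log-Upper q
    log-located {p} {q} p<q = result (separate p q p<q)
      where
      result : (∃ λ m → 0ℚ < base (- p) m × 0ℚ < base q m × 1ℚ < compound q m * compound (- p) m) →
               Log-Lower p ⊎ Log-Upper q
      result (m , 0<b , 0<b′ , 1<VW) = choose (recip W 0<W)
        where
        V W : ℚ
        V = compound q m
        W = compound (- p) m
        0<W : 0ℚ < W
        0<W = ^-pos (suc m) 0<b
        choose : (∃ λ ω → 0ℚ < ω × W * ω ≡ 1ℚ) → Log-Lower p ⊎ Log-Upper q
        choose (ω , 0<ω , Wω) =
          let s , ω<s , s<V = <-dense ω<V
              r , ω<r , r<s = <-dense ω<s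
          in [ (λ Lr → inj₁ (r , m , <-trans 0<ω ω<r , Lr , 0<b , 1<rW r ω<r))
             , (λ Us → inj₂ (s , m , Us , 0<b′ , s<V)) ]′ (located x r<s)
          where
          ω<V : ω < V
          ω<V = cancel W ω V 0<W (subst₂ _<_ (sym Wω) (*-comm V W) 1<VW)
          1<rW : ∀ r → ω < r → 1ℚ < r * W
          1<rW r ω<r = subst₂ _<_ Wω (*-comm W r) (*-monoʳ-< W 0<W ω<r)

  -- q < log x when 1 < r exp (- q) for some rational 0 < r < x, and log x < q
  -- when r < exp q for some rational r > x, each exponential being replaced by
  -- one of its lower approximations.
  log : ℝ
  log = record
    { Lower           = Log-Lower
    ; Upper           = Log-Upper
    ; lower-inhabited = log-lower-inhabited
    ; upper-inhabited = log-upper-inhabited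
    ; lower-closed    = λ {p} {q} p<q (r , m , 0<r , Lr , 0<b , 1<rc) →
        r , m , 0<r , Lr , <-trans 0<b (base-mono { - q} { - p} m (neg-antimono-< p<q))
        , <-≤-trans 1<rc (*-monoʳ-≤ r (<⇒≤ 0<r) (compound-mono { - q} { - p} m (neg-antimono-< p<q) 0<b))
    ; upper-closed    = λ {p} {q} p<q (r , m , Ur , 0<b , r<c) →
        r , m , Ur , <-trans 0<b (base-mono m p<q) , <-≤-trans r<c (compound-mono m p<q 0<b)
    ; lower-open      = log-lower-open
    ; upper-open      = log-upper-open
    ; disjoint        = λ {q} → log-disjoint {q}
    ; located         = log-located
    }

fromℕ-positive : ∀ n → Positive-ℝ (fromℚ (fromℕ (suc n)))
fromℕ-positive n = <-dense (positive⁻¹ (fromℕ (suc n)))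

-- log 0 is the junk value 0.
logℕ : ℕ → ℝ
logℕ zero    = 0ℝ
logℕ (suc n) = log (fromℚ (fromℕ (suc n))) (fromℕ-positive n)

logℕ-positive : ∀ n → Positive-ℝ (logℕ (suc (suc n)))
logℕ-positive n =
  let r , 1<r , r<N = <-dense 1<N
      q , 0<q , Lq = lower-open (logℕ (suc (suc n)))
        (r , 0 , <-trans 0<1 1<r , r<N , 0<1 , subst (1ℚ <_) (sym (*-identityʳ r)) 1<r)
  in q , 0<q , Lq
  where
  open ℚ-Lemmas
  1<N : 1ℚ < fromℕ (suc (suc n))
  1<N = <-by {1ℚ} {fromℕ (suc (suc n))} {fromℕ (suc n)}
    (trans (cong (_- 1ℚ) (fromℕ-suc (suc n))) (solve 1 (λ N → con 1ℚ :+ N :- con 1ℚ := N) refl (fromℕ (suc n))))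
    (positive⁻¹ (fromℕ (suc n)))

-- log t · log log N / log N, with junk value 0 when N ≤ 1, where log log N is undefined.
logRatio : ℕ → ℕ → ℝ
logRatio t zero            = 0ℝ
logRatio t (suc zero)      = 0ℝ
logRatio t N@(suc (suc n)) = (logℕ t *ℝ log (logℕ N) (logℕ-positive n)) ÷ℝ logℕ N [ logℕ-positive n ]

-- The limit superior of F i along size i → ∞ is the finite real L, in the order form that needs no suprema.
record IsLimSup {I : Set} (size : I → ℕ) (F : I → ℝ) (L : ℝ) : Set₁ where
  field
    eventually-below : ∀ y → L <ℝ y → ∃ λ N → ∀ i → N ℕ.≤ size i → F i <ℝ y
    frequently-above : ∀ y → y <ℝ L → ∀ N → ∃ λ i → N ℕ.≤ size i × y <ℝ F i

infix 5 _+_i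

record ℤ[i] : Set where
  constructor _+_i
  field
    re im : ℤ

infixl 6 _+ᴳ_
infixl 7 _*ᴳ_

_+ᴳ_ _*ᴳ_ : ℤ[i] → ℤ[i] → ℤ[i]
(a + b i) +ᴳ (c + d i) = (a ℤ.+ c) + (b ℤ.+ d) i
(a + b i) *ᴳ (c + d i) = (a ℤ.* c ℤ.- b ℤ.* d) + (a ℤ.* d ℤ.+ b ℤ.* c) i

_≟ᴳ_ : (α β : ℤ[i]) → Dec (α ≡ β)
(a + b i) ≟ᴳ (c + d i) with a ℤ.≟ c | b ℤ.≟ d
... | yes refl | yes refl = yes refl
... | no a≢c   | _        = no λ { refl → a≢c refl }
... | _        | no b≢d   = no λ { refl → b≢d refl }

ℕ→ℤ[i] : ℕ → ℤ[i]
ℕ→ℤ[i] n = (ℤ.+ n) + ℤ.0ℤ i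

ℤ[i]-rawSemiring : RawSemiring 0ℓ 0ℓ
ℤ[i]-rawSemiring = record
  { Carrier = ℤ[i] ; _≈_ = _≡_ ; _+_ = _+ᴳ_ ; _*_ = _*ᴳ_ ; 0# = ℕ→ℤ[i] 0 ; 1# = ℕ→ℤ[i] 1 }

open SemiringDefinitions ℤ[i]-rawSemiring public using () renaming (Prime to GaussianPrime; _^_ to _^ᴳ_)

norm : ℤ[i] → ℕ
norm (a + b i) = ℤ.∣ a ∣ ℕ.^ 2 ℕ.+ ℤ.∣ b ∣ ℕ.^ 2

∏ᴳ : List ℤ[i] → ℤ[i]
∏ᴳ = foldr _*ᴳ_ (ℕ→ℤ[i] 1)

units : List ℤ[i]
units = (ℤ.1ℤ + ℤ.0ℤ i) ∷ (ℤ.-1ℤ + ℤ.0ℤ i) ∷ (ℤ.0ℤ + ℤ.1ℤ i) ∷ (ℤ.0ℤ + ℤ.-1ℤ i) ∷ []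

Associated : ℤ[i] → ℤ[i] → Set
Associated α β = Any (λ ε → α ≡ ε *ᴳ β) units

associated? : (α β : ℤ[i]) → Dec (Associated α β)
associated? α β = any? (λ ε → α ≟ᴳ (ε *ᴳ β)) units

tuples : {A : Set} → ℕ → List A → List (List A)
tuples zero    xs = [] ∷ []
tuples (suc k) xs = cartesianProductWith _∷_ xs (tuples k xs)

-- For a ≥ 1, every factor d of a satisfies 1 ≤ d ≤ a.
τ : ℕ → ℕ → ℕ
τ k a = length (filter (λ ds → product ds ℕ.≟ a) (tuples k (map suc (upTo a))))

-- Each nonzero Gaussian integer has exactly one associate x + y i with x > 0
-- and y ≥ 0, so these represent the classes; for a divisor of a ≥ 1 the
-- representative has x, y ≤ a, because its norm divides a².
representatives : ℕ → List ℤ[i]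
representatives a = cartesianProductWith (λ x y → (ℤ.+ x) + (ℤ.+ y) i) (map suc (upTo a)) (upTo (suc a))

𝔱 : ℕ → ℕ → ℕ
𝔱 k a = length (filter (λ 𝔡s → associated? (∏ᴳ 𝔡s) (ℕ→ℤ[i] a)) (tuples k (representatives a)))

-- f is the multiplicative function with f (p ^ a) = g a; its value at 0 is unconstrained.
record IsExponential (g : ℕ → ℕ) (f : ℕ → ℕ) : Set where
  field
    at-1           : f 1 ≡ 1
    multiplicative : ∀ m n .{{_ : ℕ.NonZero m}} .{{_ : ℕ.NonZero n}} → Coprime m n → f (m ℕ.* n) ≡ f m ℕ.* f n
    at-prime-power : ∀ p a .{{_ : ℕ.NonZero a}} → Prime p → f (p ℕ.^ a) ≡ g a

-- f (ε 𝔭₁^a₁ ⋯ 𝔭ᵣ^aᵣ) = g a₁ ⋯ g aᵣ; its value at 0 is unconstrained.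
IsExponentialᴳ : (g : ℕ → ℕ) (f : ℤ[i] → ℕ) → Set
IsExponentialᴳ g f = ∀ ε (𝔭as : List (ℤ[i] × ℕ)) → ε ∈ units →
  All (λ (𝔭 , a) → GaussianPrime 𝔭 × ℕ.NonZero a) 𝔭as →
  AllPairs (λ (𝔭 , _) (𝔮 , _) → ¬ Associated 𝔭 𝔮) 𝔭as →
  f (ε *ᴳ ∏ᴳ (map (λ (𝔭 , a) → 𝔭 ^ᴳ a) 𝔭as)) ≡ product (map (λ (_ , a) → g a) 𝔭as)

{-# OPTIONS --safe #-}
module Submission where

-- Let g be τ k or 𝔱 k, and let K = g 2, that is k or C(k + 1, 2). Pulling prime factors
-- out of a ≥ 1 gives g a ≤ K ^ (a / 2) and g a ≤ K ^ O(log a).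
--
-- Upper bound: for n = ∏ pᵢ ^ aᵢ with log f n = Σ log g aᵢ, the primes pᵢ < (log n) ^ (1 - δ)
-- contribute o(log n / log log n) by the second inequality, and for the others the first
-- one gives at most (log K / 2) Σ aᵢ with (1 - δ) log log n · Σ aᵢ ≤ log n.
--
-- Lower bound: the square n of a product of r primes of size at most X has f n = K ^ r and
-- log n ≤ 2 r log X, so it suffices that, for arbitrarily large X, there are at least
-- X ^ (1 - ε) primes up to X. For Gaussian primes this follows from a form of Euclid's
-- argument: the 4 ^ b numbers 1 + z ! β, with β in a square of side 2 ^ b, have only prime
-- factors of norm N > z, and each such prime divides O(4 ^ b / N + 1) of them. Each rational
-- prime lies below at most two Gaussian primes, which gives the rational case.

-- The constant `K = g 2` appears because the exponent 2 is extremal: log (g a) / a is at most log K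
-- / 2, with equality at a = 2. For `𝔱` this rests on 2 being ramified. As 2 is associated to the
-- square of 1 + i, its two divisions are by the same prime, they commute, and together cost C(k +
-- 1, 2). The two primes above an odd p can cost k², but k² ≤ K ^ (3/2) and 3 ≤ p keep this within K
-- ^ (p/2).
--
-- The ratio sees the number of primes only through its logarithm, and a limit superior only asks
-- for arbitrarily large X; this is why X ^ (1 - ε) is enough. Gaussian primes come first because an
-- inert p has norm p²: many rational primes up to X need not give as many Gaussian primes of norm
-- up to X, whereas each Gaussian prime divides a rational prime not exceeding its norm.
--
-- The asymptotics are carried out in ℕ, with base-2 logarithms rounded to integers. The constructed
-- reals enter only where `UpperCore` and `LowerCore` are turned into a limit superior.

open import Algebra.Bundles using (CommutativeRing; RawSemiring)
import Algebra.Definitions.RawMagma as RawMagmaDefinitions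
import Algebra.Definitions.RawSemiring as SemiringDefinitions
import Algebra.Properties.CommutativeSemiring.Exp as Exp
open import Data.Empty using (⊥; ⊥-elim)
import Data.Integer as ℤ
open ℤ using (ℤ)
import Data.Integer.DivMod as ℤ/
import Data.Integer.Properties as ℤₚ
import Data.Integer.Tactic.RingSolver as ℤ-Solver
open import Data.List using (List; []; _∷_; _++_; map; filter; length; upTo; cartesianProductWith; cartesianProduct)
open import Data.List.Membership.Propositional using (_∈_; find; lose)
open import Data.List.Membership.Propositional.Properties
open import Data.List.Properties using (length-++; length-map; length-upTo; length-filter; length-removeAt′; filter-accept; filter-reject; filter-all; filter-none; filter-++; map-∘; ∷-injective)
open import Data.List.Relation.Unary.All as All using (All; []; _∷_)
import Data.List.Relation.Unary.All.Properties as All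
open import Data.List.Relation.Unary.AllPairs as AllPairs using (AllPairs; []; _∷_)
import Data.List.Relation.Unary.AllPairs.Properties as AllPairs
open import Data.List.Relation.Unary.Any as Any using (Any; here; there; any?; _─_)
open import Data.List.Relation.Unary.Unique.Propositional using (Unique)
import Data.List.Relation.Unary.Unique.Propositional.Properties as Unique
open import Data.Nat as ℕ using (ℕ; zero; suc; z≤n; s≤s)
open import Data.Nat.Combinatorics using (_C_; nC1≡n; nCk+nC[k+1]≡[n+1]C[k+1])
open import Data.Nat.Coprimality using (Coprime)
open import Data.Nat.Induction using (<-wellFounded)
open import Data.Nat.ListAction using (product)
open import Data.Nat.ListAction.Properties using (∈⇒∣product)
open import Data.Nat.Primality using (Prime; euclidsLemma; prime⇒irreducible; prime⇒nonTrivial; prime⇒nonZero; prime[2])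
open import Data.Nat.Primality.Factorisation using (factorise; module PrimeFactorisation)
import Data.Nat.Properties as ℕₚ
import Data.Nat.Tactic.RingSolver as ℕ-Solver
open import Data.Product using (∃; ∃₂; _×_; _,_; proj₁; proj₂)
open import Data.Rational using (½)
open import Data.Rational.Solver using (module +-*-Solver)
open import Data.Sum using (_⊎_; inj₁; inj₂; [_,_]′)
open import Induction.WellFounded using (Acc; acc)
open import Level using (0ℓ)
open import Relation.Binary.PropositionalEquality using (_≡_; _≢_; refl; sym; trans; cong; cong₂; subst; subst₂; isEquivalence; module ≡-Reasoning)
open import Relation.Nullary using (¬_; Dec; yes; no; _×-dec_)
open import Relation.Nullary.Decidable using (dec⇒maybe)
open import Relation.Unary using (Decidable)
import Tactic.RingSolver as RingSolver
open import Tactic.RingSolver.Core.AlmostCommutativeRing using (AlmostCommutativeRing; fromCommutativeRing)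
open import Defs

open RawMagmaDefinitions (RawSemiring.*-rawMagma ℤ[i]-rawSemiring) using () renaming (_∣_ to _∣ᴳ_; _,_ to infix 5 _by_)
open SemiringDefinitions ℤ[i]-rawSemiring using (mkPrime)
open GaussianPrime

-- Rational bounds for logarithms

module LogarithmBounds where

  open import Data.Rational
  open import Data.Rational.Properties
  open +-*-Solver using (solve; _:=_; _:+_; _:*_; :-_; _:-_; con)
  open Exp (CommutativeRing.commutativeSemiring +-*-commutativeRing) using (_^_; ^-assocʳ; ^-distrib-*)
  open ℝ
  open ℚ-Lemmas
  open Log-Lemmas

  fromℕ-+ : ∀ m n → fromℕ (m ℕ.+ n) ≡ fromℕ m + fromℕ n
  fromℕ-+ zero    n = sym (+-identityˡ (fromℕ n))
  fromℕ-+ (suc m) n = begin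
    fromℕ (suc (m ℕ.+ n))     ≡⟨ fromℕ-suc (m ℕ.+ n) ⟩
    1ℚ + fromℕ (m ℕ.+ n)      ≡⟨ cong (_+_ 1ℚ) (fromℕ-+ m n) ⟩
    1ℚ + (fromℕ m + fromℕ n)  ≡⟨ sym (+-assoc 1ℚ (fromℕ m) (fromℕ n)) ⟩
    1ℚ + fromℕ m + fromℕ n    ≡⟨ cong (_+ fromℕ n) (sym (fromℕ-suc m)) ⟩
    fromℕ (suc m) + fromℕ n ∎
    where open ≡-Reasoning

  fromℕ-* : ∀ m n → fromℕ (m ℕ.* n) ≡ fromℕ m * fromℕ n
  fromℕ-* zero    n = sym (*-zeroˡ (fromℕ n))
  fromℕ-* (suc m) n = begin
    fromℕ (n ℕ.+ m ℕ.* n)           ≡⟨ fromℕ-+ n (m ℕ.* n) ⟩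
    fromℕ n + fromℕ (m ℕ.* n)       ≡⟨ cong (_+_ (fromℕ n)) (fromℕ-* m n) ⟩
    fromℕ n + fromℕ m * fromℕ n     ≡⟨ solve 2 (λ m n → n :+ m :* n := (con 1ℚ :+ m) :* n) refl (fromℕ m) (fromℕ n) ⟩
    (1ℚ + fromℕ m) * fromℕ n        ≡⟨ cong (_* fromℕ n) (sym (fromℕ-suc m)) ⟩
    fromℕ (suc m) * fromℕ n ∎
    where open ≡-Reasoning

  fromℕ-^ : ∀ m n → fromℕ (m ℕ.^ n) ≡ fromℕ m ^ n
  fromℕ-^ m zero    = refl
  fromℕ-^ m (suc n) = trans (fromℕ-* m (m ℕ.^ n)) (cong (fromℕ m *_) (fromℕ-^ m n))

  fromℕ-mono-< : ∀ {m n} → m ℕ.< n → fromℕ m < fromℕ n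
  fromℕ-mono-< {m} {n} m<n = <-≤-trans
    (<-by {fromℕ m} {fromℕ (suc m)} {1ℚ} (trans (cong (_- fromℕ m) (fromℕ-suc m)) (solve 1 (λ a → con 1ℚ :+ a :- a := con 1ℚ) refl (fromℕ m))) 0<1)
    (fromℕ-mono m<n)

  0<fromℕ : ∀ {n} → 1 ℕ.≤ n → 0ℚ < fromℕ n
  0<fromℕ = fromℕ-mono-< {0}

  ^-mono-< : ∀ {p q} n → 1 ℕ.≤ n → 0ℚ < p → p < q → p ^ n < q ^ n
  ^-mono-< {p} {q} (suc n) _ 0<p p<q = ≤-<-trans
    (*-monoʳ-≤ p (<⇒≤ 0<p) (^-mono-≤ n 0<p (<⇒≤ p<q)))
    (*-monoˡ-< (q ^ n) (^-pos n (<-trans 0<p p<q)) p<q)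

  step-* : ∀ n M M′ → suc M′ ≡ suc M ℕ.* n → fromℕ n * step M′ ≡ step M
  step-* n M M′ e = begin
    fromℕ n * step M′
      ≡⟨ sym (*-identityˡ (fromℕ n * step M′)) ⟩
    1ℚ * (fromℕ n * step M′)
      ≡⟨ cong (_* (fromℕ n * step M′)) (sym (fromℕ*step M)) ⟩
    fromℕ (suc M) * step M * (fromℕ n * step M′)
      ≡⟨ solve 4 (λ a b c d → a :* b :* (c :* d) := b :* (a :* c :* d)) refl (fromℕ (suc M)) (step M) (fromℕ n) (step M′) ⟩
    step M * (fromℕ (suc M) * fromℕ n * step M′)
      ≡⟨ cong (λ z → step M * (z * step M′)) (trans (sym (fromℕ-* (suc M) n)) (cong fromℕ (sym e))) ⟩
    step M * (fromℕ (suc M′) * step M′)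
      ≡⟨ cong (step M *_) (fromℕ*step M′) ⟩
    step M * 1ℚ
      ≡⟨ *-identityʳ (step M) ⟩
    step M ∎
    where open ≡-Reasoning

  base-* : ∀ q n M M′ → suc M′ ≡ suc M ℕ.* n → base (fromℕ n * q) M′ ≡ base q M
  base-* q n M M′ e = cong (_+_ 1ℚ) (trans
    (solve 3 (λ a q s → a :* q :* s := q :* (a :* s)) refl (fromℕ n) q (step M′))
    (cong (q *_) (step-* n M M′ e)))

  compound-* : ∀ q n M M′ → suc M′ ≡ suc M ℕ.* n → compound (fromℕ n * q) M′ ≡ compound q M ^ n
  compound-* q n M M′ e = trans (cong₂ _^_ (base-* q n M M′ e) e) (sym (^-assocʳ (base q M) (suc M) n))

  -- These are the cuts of `log` at a rational, written out. The cuts of `logℕ n` reduce to them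
  -- only once `n` is visibly a successor, because of the junk value at 0; the conversions below
  -- hide that case split behind `1 ≤ n`.
  LogUpper LogLower : ℚ → ℚ → Set
  LogUpper x q = ∃₂ λ r m → x < r × 0ℚ < base q m × r < compound q m
  LogLower x q = ∃₂ λ r m → 0ℚ < r × r < x × 0ℚ < base (- q) m × 1ℚ < r * compound (- q) m

  upper-logℕ : ∀ {n q} → 1 ℕ.≤ n → LogUpper (fromℕ n) q → Upper (logℕ n) q
  upper-logℕ (s≤s _) u = u

  lower-logℕ : ∀ {n q} → 1 ℕ.≤ n → LogLower (fromℕ n) q → Lower (logℕ n) q
  lower-logℕ (s≤s _) l = l

  upper-logℕ⁻ : ∀ {n q} → 1 ℕ.≤ n → Upper (logℕ n) q → LogUpper (fromℕ n) q
  upper-logℕ⁻ (s≤s _) u = u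

  lower-logℕ⁻ : ∀ {n q} → 1 ℕ.≤ n → Lower (logℕ n) q → LogLower (fromℕ n) q
  lower-logℕ⁻ (s≤s _) l = l

  upper-logℕ-mono : ∀ {m n q} → 1 ℕ.≤ m → m ℕ.≤ n → Upper (logℕ n) q → Upper (logℕ m) q
  upper-logℕ-mono {m} {n} {q} 1≤m m≤n u =
    let r , k , n<r , b , c = upper-logℕ⁻ {n} {q} (ℕₚ.≤-trans 1≤m m≤n) u
    in upper-logℕ {m} {q} 1≤m (r , k , ≤-<-trans (fromℕ-mono m≤n) n<r , b , c)

  lower-logℕ-mono : ∀ {m n q} → 1 ℕ.≤ m → m ℕ.≤ n → Lower (logℕ m) q → Lower (logℕ n) q
  lower-logℕ-mono {m} {n} {q} 1≤m m≤n l =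
    let r , k , 0<r , r<m , b , c = lower-logℕ⁻ {m} {q} 1≤m l
    in lower-logℕ {n} {q} (ℕₚ.≤-trans 1≤m m≤n) (r , k , 0<r , <-≤-trans r<m (fromℕ-mono m≤n) , b , c)

  1≤m^n : ∀ {m} n → 1 ℕ.≤ m → 1 ℕ.≤ m ℕ.^ n
  1≤m^n zero    1≤m = s≤s z≤n
  1≤m^n (suc n) 1≤m = ℕₚ.*-mono-≤ 1≤m (1≤m^n n 1≤m)

  -- Both bounds are exact because (1 + n q / (n m)) ^ (n m) = ((1 + q / m) ^ m) ^ n.
  upper-logℕ-^ : ∀ {m n q} → 1 ℕ.≤ m → 1 ℕ.≤ n → Upper (logℕ m) q → Upper (logℕ (m ℕ.^ n)) (fromℕ n * q)
  upper-logℕ-^ {m} {n@(suc n-1)} {q} 1≤m 1≤n u =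
    let r , k , m<r , b , c = upper-logℕ⁻ {m} {q} 1≤m u
        k′ = n-1 ℕ.+ k ℕ.* n
    in upper-logℕ {m ℕ.^ n} {fromℕ n * q} (1≤m^n n 1≤m)
         ( r ^ n , k′
         , subst (_< r ^ n) (sym (fromℕ-^ m n)) (^-mono-< n 1≤n (0<fromℕ 1≤m) m<r)
         , subst (0ℚ <_) (sym (base-* q n k k′ refl)) b
         , subst (r ^ n <_) (sym (compound-* q n k k′ refl)) (^-mono-< n 1≤n (<-trans (0<fromℕ 1≤m) m<r) c))

  lower-logℕ-^ : ∀ {m n q} → 1 ℕ.≤ m → 1 ℕ.≤ n → Lower (logℕ m) q → Lower (logℕ (m ℕ.^ n)) (fromℕ n * q)
  lower-logℕ-^ {m} {n@(suc n-1)} {q} 1≤m 1≤n l =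
    let r , k , 0<r , r<m , b , c = lower-logℕ⁻ {m} {q} 1≤m l
        k′ = n-1 ℕ.+ k ℕ.* n
        neg = solve 2 (λ a q → a :* (:- q) := :- (a :* q)) refl (fromℕ n) q
    in lower-logℕ {m ℕ.^ n} {fromℕ n * q} (1≤m^n n 1≤m)
         ( r ^ n , k′ , ^-pos n 0<r
         , subst (r ^ n <_) (sym (fromℕ-^ m n)) (^-mono-< n 1≤n 0<r r<m)
         , subst (0ℚ <_) (trans (sym (base-* (- q) n k k′ refl)) (cong (λ z → base z k′) neg)) b
         , subst₂ _<_ (1^n≡1 n)
             (trans (^-distrib-* r (compound (- q) k) n)
               (cong (r ^ n *_) (trans (sym (compound-* (- q) n k k′ refl)) (cong (λ z → compound z k′) neg))))
             (^-mono-< n 1≤n 0<1 c))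

  -- The iterated logarithm log log N is reached through an integer lying between log N and its
  -- bound, so that only logarithms of integers have to be estimated.
  upper-log : ∀ {x 0<x n q} → 1 ℕ.≤ n → Upper x (fromℕ n) → Upper (logℕ n) q → Upper (log x 0<x) q
  upper-log {x} {0<x} {n} {q} 1≤n x<n u =
    let r , k , n<r , b , c = upper-logℕ⁻ {n} {q} 1≤n u in r , k , upper-closed x n<r x<n , b , c

  lower-log : ∀ {x 0<x n q} → 1 ℕ.≤ n → Lower x (fromℕ n) → Lower (logℕ n) q → Lower (log x 0<x) q
  lower-log {x} {0<x} {n} {q} 1≤n n<x l =
    let r , k , 0<r , r<n , b , c = lower-logℕ⁻ {n} {q} 1≤n l in r , k , 0<r , lower-closed x r<n n<x , b , c

  -- 2 < 17/8 < 9/4 = (1 + 1/2)².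
  log2<1 : Upper (logℕ 2) 1ℚ
  log2<1 = (fromℕ 17 * 1/ fromℕ 8) , 1 , *<* (ℤ.+<+ (ℕₚ.≤ᵇ⇒≤ 17 17 _)) , *<* (ℤ.+<+ (s≤s z≤n)) , *<* (ℤ.+<+ (ℕₚ.≤ᵇ⇒≤ 69 72 _))

  -- 7/2 < 4, and 7/2 · (1 - 1/3)³ = 28/27 > 1.
  1<log4 : Lower (logℕ 4) 1ℚ
  1<log4 = (fromℕ 7 * 1/ fromℕ 2) , 2 , *<* (ℤ.+<+ (s≤s z≤n)) , *<* (ℤ.+<+ (ℕₚ.≤ᵇ⇒≤ 8 8 _)) , *<* (ℤ.+<+ (s≤s z≤n)) , *<* (ℤ.+<+ (ℕₚ.≤ᵇ⇒≤ 28 28 _))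

  -- The left factor will be log f, which need not be positive, so its lower end is arbitrary. Since
  -- `w` is bounded below by `b ≥ 0`, every corner product is still at most `a * b′`.
  upper-* : ∀ {x w a b b′ q} → 0ℚ < a → Upper x a → 0ℚ ≤ b → Lower w b → Upper w b′ → a * b′ < q → Upper (x *ℝ w) q
  upper-* {x} {w} {a} {b} {b′} {q} 0<a x<a 0≤b b<w w<b′ ab′<q =
    let a₀ , a₀<x = lower-inhabited x
        a₀<a = ℝ-Lemmas.lower<upper x a₀<x x<a
        b<b′ = ℝ-Lemmas.lower<upper w b<w w<b′
        ab<q = <-trans (*-monoʳ-< a 0<a b<b′) ab′<q
    in record { a-lower = a₀<x ; a′-upper = x<a ; b-lower = b<w ; b′-upper = w<b′ }
     , ≤-<-trans (*-monoˡ-≤ b 0≤b (<⇒≤ a₀<a)) ab<q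
     , ≤-<-trans (*-monoˡ-≤ b′ (≤-trans 0≤b (<⇒≤ b<b′)) (<⇒≤ a₀<a)) ab′<q
     , ab<q , ab′<q

  lower-* : ∀ {x w a b q} → 0ℚ < a → Lower x a → 0ℚ < b → Lower w b → q < a * b → Lower (x *ℝ w) q
  lower-* {x} {w} {a} {b} {q} 0<a a<x 0<b b<w q<ab =
    let a′ , x<a′ = upper-inhabited x
        b′ , w<b′ = upper-inhabited w
        a<a′ = ℝ-Lemmas.lower<upper x a<x x<a′
        b<b′ = ℝ-Lemmas.lower<upper w b<w w<b′
        ab<ab′ = *-monoʳ-< a 0<a b<b′
    in record { a-lower = a<x ; a′-upper = x<a′ ; b-lower = b<w ; b′-upper = w<b′ }
     , q<ab , <-trans q<ab ab<ab′ , <-trans q<ab (*-monoˡ-< b 0<b a<a′)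
     , <-trans q<ab (<-trans ab<ab′ (*-monoˡ-< b′ (<-trans 0<b b<b′) a<a′))

  upper-inverse : ∀ {z 0<z ℓ c} → 0ℚ < ℓ → Lower z ℓ → 0ℚ < c → ℓ * c ≡ 1ℚ → Upper (Positive-Lemmas.inverse z 0<z) c
  upper-inverse {z} {0<z} {ℓ} {c} 0<ℓ ℓ<z 0<c e =
    let r , ℓ<r , r<z = lower-open z ℓ<z
    in r , <-trans 0<ℓ ℓ<r , r<z , subst₂ _<_ e (*-comm r c) (*-monoˡ-< c 0<c ℓ<r)

  lower-inverse : ∀ {z 0<z u c} → Upper z u → 0ℚ < c → u * c ≡ 1ℚ → Lower (Positive-Lemmas.inverse z 0<z) c
  lower-inverse {z} {0<z} {u} {c} z<u 0<c e =
    let r , r<u , z<r = upper-open z z<u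
    in r , z<r , subst₂ _<_ (*-comm r c) e (*-monoˡ-< c 0<c r<u)

  upper-÷ : ∀ {x w z 0<z a b b′ ℓ q} → 0ℚ < a → Upper x a → 0ℚ ≤ b → Lower w b → Upper w b′ → 0ℚ < ℓ → Lower z ℓ →
            a * b′ < q * ℓ → Upper ((x *ℝ w) ÷ℝ z [ 0<z ]) q
  upper-÷ {x} {w} {z} {0<z} {a} {b} {b′} {ℓ} {q} 0<a x<a 0≤b b<w w<b′ 0<ℓ ℓ<z ab′<qℓ =
    let c , 0<c , e = recip ℓ 0<ℓ
        d , ab′<d , d<qℓ = <-dense ab′<qℓ
        0<d = <-trans (*-pos 0<a (≤-<-trans 0≤b (ℝ-Lemmas.lower<upper w b<w w<b′))) ab′<d
        qℓc = trans (*-assoc q ℓ c) (trans (cong (q *_) e) (*-identityʳ q))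
        r , z<r = upper-inhabited z
    in upper-* {x *ℝ w} {Positive-Lemmas.inverse z 0<z} {d} {0ℚ} {c} 0<d (upper-* {x} {w} {a} {b} {b′} 0<a x<a 0≤b b<w w<b′ ab′<d)
         ≤-refl (r , z<r , subst (_< 1ℚ) (sym (*-zeroˡ r)) 0<1)
         (upper-inverse {z} {0<z} {ℓ} 0<ℓ ℓ<z 0<c e) (subst (d * c <_) qℓc (*-monoˡ-< c 0<c d<qℓ))

  lower-÷ : ∀ {x w z 0<z a b u q} → 0ℚ ≤ q → 0ℚ < a → Lower x a → 0ℚ < b → Lower w b → 0ℚ < u → Upper z u →
            q * u < a * b → Lower ((x *ℝ w) ÷ℝ z [ 0<z ]) q
  lower-÷ {x} {w} {z} {0<z} {a} {b} {u} {q} 0≤q 0<a a<x 0<b b<w 0<u z<u qu<ab =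
    let c , 0<c , e = recip u 0<u
        d , qu<d , d<ab = <-dense qu<ab
        0<d = ≤-<-trans (*-nonNeg 0≤q (<⇒≤ 0<u)) qu<d
        quc = trans (*-assoc q u c) (trans (cong (q *_) e) (*-identityʳ q))
    in lower-* {x *ℝ w} {Positive-Lemmas.inverse z 0<z} {d} {c} 0<d (lower-* {x} {w} {a} {b} 0<a a<x 0<b b<w d<ab)
         0<c (lower-inverse {z} {0<z} {u} z<u 0<c e) (subst (_< d * c) quc (*-monoˡ-< c 0<c qu<d))

  -- ½ lies between the ends `a` and `a′` of the box, so `½ * b′` lies between two corner products.
  upper-½* : ∀ {x q} → Upper (fromℚ ½ *ℝ x) q → ∃ λ u → Upper x u × ½ * u < q
  upper-½* {x} {q} (β , _ , ab′<q , _ , a′b′<q) =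
    let open Box β in b′ , b′-upper , *-Lemmas.segment-above q a a′ ½ b′ (<⇒≤ a-lower) (<⇒≤ a′-upper) ab′<q a′b′<q

  lower-½* : ∀ {x q} → Lower (fromℚ ½ *ℝ x) q → ∃ λ u → Lower x u × q < ½ * u
  lower-½* {x} {q} (β , q<ab , _ , q<a′b , _) =
    let open Box β in b , b-lower , *-Lemmas.segment-below q a a′ ½ b (<⇒≤ a-lower) (<⇒≤ a′-upper) q<ab q<a′b

  -- Since ℓ ≤ log₂ N and log₂ log₂ N ≤ h, the last two bounds give
  -- log f ≤ (1 + 1 / s) (log K / 2) ℓ / h.
  UpperCore : ℕ → {I : Set} → (I → ℕ) → (I → ℕ) → Set
  UpperCore K size f = ∀ s → ∃ λ N₀ → ∀ x → N₀ ℕ.≤ size x → ∃ λ M → ∃ λ ℓ → ∃ λ h →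
    1 ℕ.≤ M × 1 ℕ.≤ ℓ × 1 ℕ.≤ h × 16 ℕ.≤ size x × 2 ℕ.^ ℓ ℕ.≤ size x × size x ℕ.≤ 2 ℕ.^ (2 ℕ.^ h) ×
    f x ℕ.≤ K ℕ.^ M × s ℕ.* (2 ℕ.* (M ℕ.* h)) ℕ.≤ suc s ℕ.* ℓ

  -- N is the square of a product of r ≥ 2 ^ ρ primes of size at most 2 ^ ξ, where ξ ≤ (1 + 1 / s) ρ.
  LowerCore : ℕ → {I : Set} → (I → ℕ) → (I → ℕ) → Set
  LowerCore K size f = ∀ s N₀ → ∃ λ x → ∃ λ r → ∃ λ ρ → ∃ λ ξ →
    N₀ ℕ.≤ size x × 1 ℕ.≤ ρ × 1 ℕ.≤ ξ × 2 ℕ.^ ρ ℕ.≤ r × 4 ℕ.^ r ℕ.≤ size x × size x ℕ.≤ 2 ℕ.^ (ξ ℕ.* (2 ℕ.* r)) ×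
    K ℕ.^ r ℕ.≤ f x × ξ ℕ.* s ℕ.≤ suc s ℕ.* ρ

  -- A strict inequality leaves room for the factor 1 + 1 / s of the integer estimates, once s
  -- exceeds about p / (q - p).
  absorb-suc : ∀ {p q} → p < q → ∃ λ s → 1 ℕ.≤ s × p * fromℕ (suc s) < q * fromℕ s
  absorb-suc {p} {q} p<q =
    let ν , 0<ν , e = recip (q - p) (<⇒0< p<q)
        s , pν<s = archimedean (p * ν)
        pν<1+s = <-≤-trans pν<s (fromℕ-mono {s} {suc s} (ℕₚ.n≤1+n s))
        e′ = trans (solve 3 (λ p q ν → p :* ν :* (q :- p) := p :* ((q :- p) :* ν)) refl p q ν) (trans (cong (p *_) e) (*-identityʳ p))
        p< = subst (_< fromℕ (suc s) * (q - p)) e′ (*-monoˡ-< (q - p) (<⇒0< p<q) pν<1+s)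
    in suc s , s≤s z≤n , <-by {p * fromℕ (suc (suc s))} {q * fromℕ (suc s)} {fromℕ (suc s) * (q - p) - p}
         (trans (cong (λ z → q * fromℕ (suc s) - p * z) (fromℕ-suc (suc s)))
           (solve 3 (λ p q n → q :* n :- p :* (con 1ℚ :+ n) := n :* (q :- p) :- p) refl p q (fromℕ (suc s))))
         (<⇒0< p<)

  -- Used for x = log 2. The integer estimates are in base 2, so log 2 occurs on both sides of the
  -- final comparison, bounded above by `w` on one and below by `v` on the other; the two cancel up
  -- to the factor w / v < q / p. The width η < (q - p) a / p is small enough for that.
  approximate-ratio : ∀ x {a b p q} → 0ℚ < a → Lower x a → Upper x b → 0ℚ < p → p < q →
                      ∃₂ λ v w → 0ℚ < v × Lower x v × Upper x w × p * w < q * v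
  approximate-ratio x {a} {b} {p} {q} 0<a a<x x<b 0<p p<q =
    let ν , 0<ν , e = recip p 0<p
        y = (q - p) * a * ν
        η , 0<η , η<y = <-dense {0ℚ} {y} (*-pos (*-pos (<⇒0< p<q) 0<a) 0<ν)
        pη< = subst (p * η <_)
          (trans (solve 4 (λ p d v ν → p :* (d :* v :* ν) := d :* v :* (p :* ν)) refl p (q - p) a ν)
            (trans (cong ((q - p) * a *_) e) (*-identityʳ ((q - p) * a))))
          (*-monoʳ-< p 0<p η<y)
        v , a≤v , v<x , x<v+η = ℝ-Lemmas.approximate x a b η 0<η a<x x<b
    in v , v + η , <-≤-trans 0<a a≤v , v<x , x<v+η
     , <-by {p * (v + η)} {q * v} {(q - p) * a - p * η + (q - p) * (v - a)}
         (solve 5 (λ p q a v η → q :* v :- p :* (v :+ η) := (q :- p) :* a :- p :* η :+ (q :- p) :* (v :- a)) refl p q a v η)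
         (+-pos-nonNeg (<⇒0< pη<) (*-nonNeg (<⇒≤ (<⇒0< p<q)) (≤⇒0≤ a≤v)))

  approximate-log2 : ∀ {p q} → 0ℚ < p → p < q →
                     ∃₂ λ v w → 0ℚ < v × Lower (logℕ 2) v × Upper (logℕ 2) w × p * w < q * v
  approximate-log2 0<p p<q =
    approximate-ratio (logℕ 2) {proj₁ (logℕ-positive 0)} {1ℚ} (proj₁ (proj₂ (logℕ-positive 0))) (proj₂ (proj₂ (logℕ-positive 0))) log2<1 0<p p<q

  -- At `m = 0` the junk logarithm 0 is still below a positive `q`.
  upper-logℕ-≤ : ∀ {m n q} → 0ℚ < q → m ℕ.≤ n → Upper (logℕ n) q → Upper (logℕ m) q
  upper-logℕ-≤ {zero}  0<q m≤n u = 0<q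
  upper-logℕ-≤ {suc m} {n} {q} 0<q m≤n u = upper-logℕ-mono {suc m} {n} {q} (s≤s z≤n) m≤n u

  upper-logRatio : ∀ {t N a b b′ ℓ q} → 2 ℕ.≤ N → 0ℚ < a → Upper (logℕ t) a → 0ℚ ≤ b →
                   (∀ 0<z → Lower (log (logℕ N) 0<z) b) → (∀ 0<z → Upper (log (logℕ N) 0<z) b′) →
                   0ℚ < ℓ → Lower (logℕ N) ℓ → a * b′ < q * ℓ → Upper (logRatio t N) q
  upper-logRatio {t} {suc (suc n)} {a} {b} {b′} {ℓ} {q} (s≤s (s≤s _)) 0<a u 0≤b l u′ 0<ℓ l′ =
    upper-÷ {logℕ t} {log (logℕ (suc (suc n))) (logℕ-positive n)} {logℕ (suc (suc n))} {logℕ-positive n} {a} {b} {b′} {ℓ} {q}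
      0<a u 0≤b (l (logℕ-positive n)) (u′ (logℕ-positive n)) 0<ℓ l′

  lower-logRatio : ∀ {t N a b u q} → 2 ℕ.≤ N → 0ℚ ≤ q → 0ℚ < a → Lower (logℕ t) a → 0ℚ < b →
                   (∀ 0<z → Lower (log (logℕ N) 0<z) b) →
                   0ℚ < u → Upper (logℕ N) u → q * u < a * b → Lower (logRatio t N) q
  lower-logRatio {t} {suc (suc n)} {a} {b} {u} {q} (s≤s (s≤s _)) 0≤q 0<a l 0<b l′ 0<u u′ =
    lower-÷ {logℕ t} {log (logℕ (suc (suc n))) (logℕ-positive n)} {logℕ (suc (suc n))} {logℕ-positive n} {a} {b} {u} {q}
      0≤q 0<a l 0<b (l′ (logℕ-positive n)) 0<u u′

  2*½ : ∀ p → fromℕ 2 * (½ * p) ≡ p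
  2*½ p = trans (sym (*-assoc (fromℕ 2) ½ p)) (*-identityˡ p)

  positive-logℕ : ∀ {K} → 2 ℕ.≤ K → ∃ λ r → 0ℚ < r × Lower (logℕ K) r
  positive-logℕ {suc (suc n)} (s≤s (s≤s _)) = logℕ-positive n

  -- With log K < u and u / 2 < q′ < q, the estimate is log f · log log N ≤ M u · h w ≤ (1 + 1 / s)
  -- (u / 2) ℓ w < q′ ℓ w < q ℓ v ≤ q log N. The last two strict steps use the slack from
  -- `absorb-suc` and from the approximation of log 2.
  eventually-below : ∀ {K I} {size f : I → ℕ} → 2 ℕ.≤ K → UpperCore K size f →
                     ∀ y → fromℚ ½ *ℝ logℕ K <ℝ y → ∃ λ N → ∀ x → N ℕ.≤ size x → logRatio (f x) (size x) <ℝ y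
  eventually-below {K} {I} {size} {f} 2≤K core y (q , L<q , q<y) =
    let u , logK<u , ½u<q = upper-½* {logℕ K} {q} L<q
        r , 0<r , r<logK = positive-logℕ 2≤K
        0<u = <-trans 0<r (ℝ-Lemmas.lower<upper (logℕ K) r<logK logK<u)
        q′ , ½u<q′ , q′<q = <-dense ½u<q
        0<q′ = <-trans (*-pos (positive⁻¹ ½) 0<u) ½u<q′
        s , 1≤s , slack = absorb-suc ½u<q′
        v , w , 0<v , v<log2 , log2<w , q′w<qv = approximate-log2 0<q′ q′<q
        N₀ , bound = core s
    in N₀ , λ x N₀≤N → q , below u 0<u logK<u q′ 0<q′ s 1≤s slack v w 0<v v<log2 log2<w q′w<qv x (bound x N₀≤N) , q<y
    where
    below : ∀ u → 0ℚ < u → Upper (logℕ K) u → ∀ q′ → 0ℚ < q′ → ∀ s → 1 ℕ.≤ s → ½ * u * fromℕ (suc s) < q′ * fromℕ s →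
            ∀ v w → 0ℚ < v → Lower (logℕ 2) v → Upper (logℕ 2) w → q′ * w < q * v →
            ∀ x → (∃ λ M → ∃ λ ℓ → ∃ λ h →
              1 ℕ.≤ M × 1 ℕ.≤ ℓ × 1 ℕ.≤ h × 16 ℕ.≤ size x × 2 ℕ.^ ℓ ℕ.≤ size x × size x ℕ.≤ 2 ℕ.^ (2 ℕ.^ h) ×
              f x ℕ.≤ K ℕ.^ M × s ℕ.* (2 ℕ.* (M ℕ.* h)) ℕ.≤ suc s ℕ.* ℓ) →
            Upper (logRatio (f x) (size x)) q
    below u 0<u logK<u q′ 0<q′ s 1≤s slack v w 0<v v<log2 log2<w q′w<qv x
          (M , ℓ , h , 1≤M , 1≤ℓ , 1≤h , 16≤N , 2^ℓ≤N , N≤2^2^h , t≤K^M , core) =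
      upper-logRatio {f x} {N} {fromℕ M * u} {v} {fromℕ h * w} {fromℕ ℓ * v} {q}
        (ℕₚ.≤-trans (ℕₚ.≤ᵇ⇒≤ 2 16 _) 16≤N) 0<Mu
        (upper-logℕ-≤ {f x} {K ℕ.^ M} {fromℕ M * u} 0<Mu t≤K^M (upper-logℕ-^ {K} {M} {u} (ℕₚ.≤-trans (s≤s z≤n) 2≤K) 1≤M logK<u))
        (<⇒≤ 0<v)
        -- The product needs a nonnegative lower bound for log log N. As 16 = 4² and 1 < log 4, log
        -- N exceeds 2, hence log log N exceeds `v`.
        (λ 0<z → lower-log {logℕ N} {0<z} {2} {v} (s≤s z≤n)
          (lower-logℕ-mono {16} {N} {fromℕ 2} (s≤s z≤n) 16≤N (lower-logℕ-^ {4} {2} {1ℚ} (s≤s z≤n) (s≤s z≤n) 1<log4)) v<log2)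
        -- Since log 2 < 1, the bound N ≤ 2 ^ (2 ^ h) gives log N < 2 ^ h. Dropping this log 2
        -- changes log log N only by a constant.
        (λ 0<z → upper-log {logℕ N} {0<z} {2 ℕ.^ h} {fromℕ h * w} (ℕₚ.m^n>0 2 h)
          (subst (Upper (logℕ N)) (*-identityʳ (fromℕ (2 ℕ.^ h)))
            (upper-logℕ-mono {N} {2 ℕ.^ (2 ℕ.^ h)} {fromℕ (2 ℕ.^ h) * 1ℚ} (ℕₚ.≤-trans (s≤s z≤n) 16≤N) N≤2^2^h
              (upper-logℕ-^ {2} {2 ℕ.^ h} {1ℚ} (s≤s z≤n) (ℕₚ.m^n>0 2 h) log2<1)))
          (upper-logℕ-^ {2} {h} {w} (s≤s z≤n) 1≤h log2<w))
        (*-pos (0<fromℕ 1≤ℓ) 0<v)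
        (lower-logℕ-mono {2 ℕ.^ ℓ} {N} {fromℕ ℓ * v} (ℕₚ.m^n>0 2 ℓ) 2^ℓ≤N (lower-logℕ-^ {2} {ℓ} {v} (s≤s z≤n) 1≤ℓ v<log2))
        ineq
      where
      N : ℕ
      N = size x
      0<Mu : 0ℚ < fromℕ M * u
      0<Mu = *-pos (0<fromℕ 1≤M) 0<u
      0<w : 0ℚ < w
      0<w = <-trans 0<v (ℝ-Lemmas.lower<upper (logℕ 2) v<log2 log2<w)
      S H ℓ′ M′ : ℚ
      S = fromℕ s
      H = fromℕ h
      ℓ′ = fromℕ ℓ
      M′ = fromℕ M
      core′ : S * (fromℕ 2 * (M′ * H)) ≤ fromℕ (suc s) * ℓ′
      core′ = subst₂ _≤_
        (trans (fromℕ-* s (2 ℕ.* (M ℕ.* h))) (cong (S *_) (trans (fromℕ-* 2 (M ℕ.* h)) (cong (fromℕ 2 *_) (fromℕ-* M h)))))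
        (fromℕ-* (suc s) ℓ) (fromℕ-mono core)
      ineq : M′ * u * (H * w) < q * (ℓ′ * v)
      ineq = *-cancelˡ-<-nonNeg (S * fromℕ 2) {{nonNegative (*-nonNeg (0≤fromℕ s) (0≤fromℕ 2))}} (begin-strict
        S * fromℕ 2 * (M′ * u * (H * w))
          ≡⟨ solve 6 (λ S t M u H w → S :* t :* (M :* u :* (H :* w)) := S :* (t :* (M :* H)) :* (u :* w)) refl S (fromℕ 2) M′ u H w ⟩
        S * (fromℕ 2 * (M′ * H)) * (u * w)
          ≤⟨ *-monoˡ-≤ (u * w) (<⇒≤ (*-pos 0<u 0<w)) core′ ⟩
        fromℕ (suc s) * ℓ′ * (u * w)
          ≡⟨ cong (λ z → fromℕ (suc s) * ℓ′ * (z * w)) (sym (2*½ u)) ⟩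
        fromℕ (suc s) * ℓ′ * (fromℕ 2 * (½ * u) * w)
          ≡⟨ solve 5 (λ S ℓ t u w → S :* ℓ :* (t :* u :* w) := t :* (ℓ :* w) :* (u :* S)) refl (fromℕ (suc s)) ℓ′ (fromℕ 2) (½ * u) w ⟩
        fromℕ 2 * (ℓ′ * w) * (½ * u * fromℕ (suc s))
          <⟨ *-monoʳ-< (fromℕ 2 * (ℓ′ * w)) (*-pos (positive⁻¹ (fromℕ 2)) (*-pos (0<fromℕ 1≤ℓ) 0<w)) slack ⟩
        fromℕ 2 * (ℓ′ * w) * (q′ * S)
          ≡⟨ solve 5 (λ t ℓ w q S → t :* (ℓ :* w) :* (q :* S) := t :* ℓ :* S :* (q :* w)) refl (fromℕ 2) ℓ′ w q′ S ⟩
        fromℕ 2 * ℓ′ * S * (q′ * w)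
          <⟨ *-monoʳ-< (fromℕ 2 * ℓ′ * S) (*-pos (*-pos (positive⁻¹ (fromℕ 2)) (0<fromℕ 1≤ℓ)) (0<fromℕ 1≤s)) q′w<qv ⟩
        fromℕ 2 * ℓ′ * S * (q * v)
          ≡⟨ solve 5 (λ t ℓ S q v → t :* ℓ :* S :* (q :* v) := S :* t :* (q :* (ℓ :* v))) refl (fromℕ 2) ℓ′ S q v ⟩
        S * fromℕ 2 * (q * (ℓ′ * v)) ∎)
        where open ≤-Reasoning

  lower-larger : ∀ x {p q} → Lower x p → Lower x q → ∃ λ r → p ≤ r × q ≤ r × Lower x r
  lower-larger x {p} {q} p<x q<x =
    [ (λ p≤q → q , p≤q , ≤-refl , q<x) , (λ q≤p → p , ≤-refl , q≤p , p<x) ]′ (≤-total p q)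

  upper-positive : ∀ y {q r} → Upper y q → q < r → 0ℚ < r → ∃ λ p → 0ℚ < p × p < r × Upper y p
  upper-positive y {q} {r} y<q q<r 0<r =
    [ (λ q≤0 → let p , 0<p , p<r = <-dense 0<r in p , 0<p , p<r , upper-closed y (≤-<-trans q≤0 0<p) y<q)
    , (λ 0≤q → let p , q<p , p<r = <-dense q<r in p , ≤-<-trans 0≤q q<p , p<r , upper-closed y q<p y<q) ]′ (≤-total q 0ℚ)

  -- Lower bounds can be multiplied only if they are positive, so the bounds for log K and for `y`
  -- are first moved into the positive range. The rest mirrors `eventually-below`: q log N < r b · ρ
  -- v, where r b and ρ v bound log f and log log N from below.
  frequently-above : ∀ {K I} {size f : I → ℕ} → 2 ℕ.≤ K → LowerCore K size f →
                     ∀ y → y <ℝ fromℚ ½ *ℝ logℕ K → ∀ N → ∃ λ x → N ℕ.≤ size x × y <ℝ logRatio (f x) (size x)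
  frequently-above {K} {I} {size} {f} 2≤K core y (q₀ , y<q₀ , q₀<L) N₀ =
    let b₀ , b₀<logK , q₀<½b₀ = lower-½* {logℕ K} {q₀} q₀<L
        r₀ , 0<r₀ , r₀<logK = positive-logℕ 2≤K
        b , b₀≤b , r₀≤b , b<logK = lower-larger (logℕ K) b₀<logK r₀<logK
        0<b = <-≤-trans 0<r₀ r₀≤b
        q , 0<q , q<½b , y<q = upper-positive y {q₀} {½ * b} y<q₀ (<-≤-trans q₀<½b₀ (*-monoʳ-≤ ½ (<⇒≤ (positive⁻¹ ½)) b₀≤b)) (*-pos (positive⁻¹ ½) 0<b)
        q′ , q<q′ , q′<½b = <-dense q<½b
        s , 1≤s , slack = absorb-suc q′<½b
        v , w , 0<v , v<log2 , log2<w , qw<q′v = approximate-log2 0<q q<q′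
        x , rest = core s N₀
    in x , proj₁ (proj₂ (proj₂ (proj₂ rest))) , q , y<q , above b 0<b b<logK q 0<q q′ s 1≤s slack v w 0<v v<log2 log2<w qw<q′v x rest
    where
    above : ∀ b → 0ℚ < b → Lower (logℕ K) b → ∀ q → 0ℚ < q → ∀ q′ s → 1 ℕ.≤ s → q′ * fromℕ (suc s) < ½ * b * fromℕ s →
            ∀ v w → 0ℚ < v → Lower (logℕ 2) v → Upper (logℕ 2) w → q * w < q′ * v →
            ∀ x → (∃ λ r → ∃ λ ρ → ∃ λ ξ →
              N₀ ℕ.≤ size x × 1 ℕ.≤ ρ × 1 ℕ.≤ ξ × 2 ℕ.^ ρ ℕ.≤ r × 4 ℕ.^ r ℕ.≤ size x × size x ℕ.≤ 2 ℕ.^ (ξ ℕ.* (2 ℕ.* r)) ×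
              K ℕ.^ r ℕ.≤ f x × ξ ℕ.* s ℕ.≤ suc s ℕ.* ρ) →
            Lower (logRatio (f x) (size x)) q
    above b 0<b b<logK q 0<q q′ s 1≤s slack v w 0<v v<log2 log2<w qw<q′v x
          (r , ρ , ξ , _ , 1≤ρ , 1≤ξ , 2^ρ≤r , 4^r≤N , N≤2^ξ2r , K^r≤t , core) =
      lower-logRatio {f x} {N} {fromℕ r * b} {fromℕ ρ * v} {fromℕ E * w} {q}
        (ℕₚ.≤-trans (ℕₚ.≤-trans (ℕₚ.≤ᵇ⇒≤ 2 4 _) (ℕₚ.≤-trans (ℕₚ.≤-reflexive (sym (ℕₚ.^-identityʳ 4))) (ℕₚ.^-monoʳ-≤ 4 1≤r))) 4^r≤N)
        (<⇒≤ 0<q) (*-pos (0<fromℕ 1≤r) 0<b)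
        (lower-logℕ-mono {K ℕ.^ r} {f x} {fromℕ r * b} (1≤m^n r 1≤K) K^r≤t (lower-logℕ-^ {K} {r} {b} 1≤K 1≤r b<logK))
        (*-pos (0<fromℕ 1≤ρ) 0<v)
        -- N ≥ 4 ^ r and 1 < log 4 give log N > r, and r ≥ 2 ^ ρ.
        (λ 0<z → lower-log {logℕ N} {0<z} {r} {fromℕ ρ * v} 1≤r
          (lower-logℕ-mono {4 ℕ.^ r} {N} {fromℕ r} (ℕₚ.m^n>0 4 r) 4^r≤N
            (subst (Lower (logℕ (4 ℕ.^ r))) (*-identityʳ (fromℕ r)) (lower-logℕ-^ {4} {r} {1ℚ} (s≤s z≤n) 1≤r 1<log4)))
          (lower-logℕ-mono {2 ℕ.^ ρ} {r} {fromℕ ρ * v} (ℕₚ.m^n>0 2 ρ) 2^ρ≤r (lower-logℕ-^ {2} {ρ} {v} (s≤s z≤n) 1≤ρ v<log2)))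
        (*-pos (0<fromℕ 1≤E) 0<w)
        (upper-logℕ-mono {N} {2 ℕ.^ E} {fromℕ E * w} (ℕₚ.≤-trans (ℕₚ.m^n>0 4 r) 4^r≤N) N≤2^ξ2r
          (upper-logℕ-^ {2} {E} {w} (s≤s z≤n) 1≤E log2<w))
        ineq
      where
      N E : ℕ
      N = size x
      E = ξ ℕ.* (2 ℕ.* r)
      1≤K : 1 ℕ.≤ K
      1≤K = ℕₚ.≤-trans (s≤s z≤n) 2≤K
      1≤r : 1 ℕ.≤ r
      1≤r = ℕₚ.≤-trans (ℕₚ.m^n>0 2 ρ) 2^ρ≤r
      1≤E : 1 ℕ.≤ E
      1≤E = ℕₚ.*-mono-≤ 1≤ξ (ℕₚ.*-mono-≤ {1} {2} (s≤s z≤n) 1≤r)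
      0<w : 0ℚ < w
      0<w = <-trans 0<v (ℝ-Lemmas.lower<upper (logℕ 2) v<log2 log2<w)
      S P X : ℚ
      S = fromℕ s
      P = fromℕ ρ
      X = fromℕ ξ
      core′ : X * S ≤ fromℕ (suc s) * P
      core′ = subst₂ _≤_ (fromℕ-* ξ s) (fromℕ-* (suc s) ρ) (fromℕ-mono core)
      ineq : q * (fromℕ E * w) < fromℕ r * b * (P * v)
      ineq = *-cancelˡ-<-nonNeg S {{nonNegative (0≤fromℕ s)}} (begin-strict
        S * (q * (fromℕ E * w))
          ≡⟨ cong (λ z → S * (q * (z * w))) (trans (fromℕ-* ξ (2 ℕ.* r)) (cong (X *_) (fromℕ-* 2 r))) ⟩
        S * (q * (X * (fromℕ 2 * fromℕ r) * w))
          ≡⟨ solve 6 (λ S q X t r w → S :* (q :* (X :* (t :* r) :* w)) := t :* r :* (X :* S) :* (q :* w)) refl S q X (fromℕ 2) (fromℕ r) w ⟩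
        fromℕ 2 * fromℕ r * (X * S) * (q * w)
          ≤⟨ *-monoˡ-≤ (q * w) (<⇒≤ (*-pos 0<q 0<w)) (*-monoʳ-≤ (fromℕ 2 * fromℕ r) (*-nonNeg (0≤fromℕ 2) (0≤fromℕ r)) core′) ⟩
        fromℕ 2 * fromℕ r * (fromℕ (suc s) * P) * (q * w)
          <⟨ *-monoʳ-< (fromℕ 2 * fromℕ r * (fromℕ (suc s) * P)) (*-pos (*-pos (positive⁻¹ (fromℕ 2)) (0<fromℕ 1≤r)) (*-pos (positive⁻¹ (fromℕ (suc s))) (0<fromℕ 1≤ρ))) qw<q′v ⟩
        fromℕ 2 * fromℕ r * (fromℕ (suc s) * P) * (q′ * v)
          ≡⟨ solve 6 (λ t r S P q v → t :* r :* (S :* P) :* (q :* v) := t :* r :* P :* v :* (q :* S)) refl (fromℕ 2) (fromℕ r) (fromℕ (suc s)) P q′ v ⟩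
        fromℕ 2 * fromℕ r * P * v * (q′ * fromℕ (suc s))
          <⟨ *-monoʳ-< (fromℕ 2 * fromℕ r * P * v) (*-pos (*-pos (*-pos (positive⁻¹ (fromℕ 2)) (0<fromℕ 1≤r)) (0<fromℕ 1≤ρ)) 0<v) slack ⟩
        fromℕ 2 * fromℕ r * P * v * (½ * b * S)
          ≡⟨ solve 6 (λ t r P v b S → t :* r :* P :* v :* (b :* S) := S :* (r :* (t :* b) :* (P :* v))) refl (fromℕ 2) (fromℕ r) P v (½ * b) S ⟩
        S * (fromℕ r * (fromℕ 2 * (½ * b)) * (P * v))
          ≡⟨ cong (λ z → S * (fromℕ r * z * (P * v))) (2*½ b) ⟩
        S * (fromℕ r * b * (P * v)) ∎)
        where open ≤-Reasoning

  isLimSup : ∀ {K I} {size f : I → ℕ} → 2 ℕ.≤ K → UpperCore K size f → LowerCore K size f →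
             IsLimSup size (λ x → logRatio (f x) (size x)) (fromℚ ½ *ℝ logℕ K)
  isLimSup 2≤K upper lower = record
    { eventually-below = eventually-below 2≤K upper
    ; frequently-above = frequently-above 2≤K lower
    }

-- The upper bound for products of prime powers

open LogarithmBounds using (1≤m^n; UpperCore; LowerCore; isLimSup)
open import Data.Nat hiding (zero; suc)
open import Data.Nat.Divisibility using (_∣_; _∣?_; divides; ∣-refl; ∣-trans; ∣⇒≤; ∣m⇒∣m*n; 0∣⇒≡0; m≤n⇒m!∣n!)
open import Data.Nat.DivMod using (m≡m%n+[m/n]*n; m%n<n; m/n*n≤m; m/n≤m; m<n*o⇒m/o<n; m*n/n≡m; /-monoˡ-≤)
open import Data.Nat.Properties

log₂-bounds : ∀ n → 1 ≤ n → ∃ λ ℓ → 2 ^ ℓ ≤ n × n < 2 ^ suc ℓ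
log₂-bounds (suc zero)    _ = 0 , ≤-refl , ≤-refl
log₂-bounds (suc (suc n)) _ with log₂-bounds (suc n) (s≤s z≤n)
... | ℓ , lower , upper with suc (suc n) ≟ 2 ^ suc ℓ
...   | yes e = suc ℓ , ≤-reflexive (sym e) , subst (_< 2 ^ suc (suc ℓ)) (sym e) (^-monoʳ-< 2 (s≤s (s≤s z≤n)) (n<1+n (suc ℓ)))
...   | no ne = ℓ , m≤n⇒m≤1+n lower , ≤∧≢⇒< upper ne

2^-cancel-≤ : ∀ {m n} → 2 ^ m < 2 ^ suc n → m ≤ n
2^-cancel-≤ {m} {n} lt = ≮⇒≥ λ n<m → <⇒≱ lt (^-monoʳ-≤ 2 n<m)

square-cancel-≤ : ∀ {m n} → m * m ≤ n * n → m ≤ n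
square-cancel-≤ {m} {n} le = ≮⇒≥ λ n<m → <⇒≱ (*-mono-< n<m n<m) le

n<2^n : ∀ n → n < 2 ^ n
n<2^n zero    = s≤s z≤n
n<2^n (suc n) = begin
  suc (suc n)    ≤⟨ +-mono-≤ (m^n>0 2 n) (n<2^n n) ⟩
  2 ^ n + 2 ^ n  ≡⟨ cong (2 ^ n +_) (sym (+-identityʳ (2 ^ n))) ⟩
  2 ^ suc n ∎
  where open ≤-Reasoning

m<suc[m/n]*n : ∀ m n .{{_ : NonZero n}} → m < suc (m / n) * n
m<suc[m/n]*n m n = subst (_< suc (m / n) * n) (sym (m≡m%n+[m/n]*n m n)) (+-monoˡ-< (m / n * n) (m%n<n m n))

-- With e = κ / 4 rounded down, κ + 1 ≤ 4 · 2 ^ e and D ≤ 2 ^ D, so the left side is at most 2 ^ (D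
-- + 4 + 2 e). Once D + 4 ≤ e this exponent is at most 3 e ≤ κ, whence the threshold 4 (D + 4).
exponential-dominates-square : ∀ D → ∃ λ κ₀ → ∀ κ → κ₀ ≤ κ → D * (suc κ * suc κ) ≤ 2 ^ κ
exponential-dominates-square D = (D + 4) * 4 , λ κ κ₀≤κ → bound κ (κ / 4) (m<suc[m/n]*n κ 4) (m/n*n≤m κ 4)
    (subst (_≤ κ / 4) (m*n/n≡m (D + 4) 4) (/-monoˡ-≤ 4 κ₀≤κ))
  where
  open ≤-Reasoning
  bound : ∀ κ e → suc κ ≤ suc e * 4 → e * 4 ≤ κ → D + 4 ≤ e → D * (suc κ * suc κ) ≤ 2 ^ κ
  bound κ e lt le D+4≤e = begin
    D * (suc κ * suc κ)                   ≤⟨ *-mono-≤ (<⇒≤ (n<2^n D)) (*-mono-≤ lt′ lt′) ⟩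
    2 ^ D * (2 ^ e * 4 * (2 ^ e * 4))     ≡⟨ regroup (2 ^ D) (2 ^ e) ⟩
    2 ^ D * 2 ^ 4 * (2 ^ e * 2 ^ e)       ≡⟨ cong₂ _*_ (sym (^-distribˡ-+-* 2 D 4)) (sym (^-distribˡ-+-* 2 e e)) ⟩
    2 ^ (D + 4) * 2 ^ (e + e)             ≡⟨ sym (^-distribˡ-+-* 2 (D + 4) (e + e)) ⟩
    2 ^ (D + 4 + (e + e))                 ≤⟨ ^-monoʳ-≤ 2 exponent ⟩
    2 ^ κ ∎
    where
    regroup : ∀ a b → a * (b * 4 * (b * 4)) ≡ a * 16 * (b * b)
    regroup = ℕ-Solver.solve-∀
    lt′ : suc κ ≤ 2 ^ e * 4
    lt′ = ≤-trans lt (*-monoˡ-≤ 4 (n<2^n e))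
    exponent : D + 4 + (e + e) ≤ κ
    exponent = begin
      D + 4 + (e + e)  ≤⟨ +-monoˡ-≤ (e + e) D+4≤e ⟩
      e + (e + e)      ≤⟨ m≤m+n (e + (e + e)) e ⟩
      e + (e + e) + e  ≡⟨ fourfold e ⟩
      e * 4            ≤⟨ le ⟩
      κ ∎
      where
      fourfold : ∀ e → e + (e + e) + e ≡ e * 4
      fourfold = ℕ-Solver.solve-∀

-- ω stands for the number of prime factors of a.
Tame : ℕ → (ℕ → ℕ) → Set
Tame K g = ∀ a → 1 ≤ a → g a * g a ≤ K ^ a × ∃ λ ω → 2 ^ ω ≤ a × g a * g a ≤ K ^ (3 * ω)

prodOfPowers : List (ℕ × ℕ) → ℕ
prodOfPowers fs = product (map (λ (q , a) → q ^ a) fs)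

countBelow : ℕ → List (ℕ × ℕ) → ℕ
countBelow μ fs = length (filter (λ (q , _) → q <? 2 ^ μ) fs)

-- The bases are primes or norms of Gaussian primes. Conjugate primes have equal norms, so
-- distinctness cannot be demanded; a count of the small bases takes its place, with the constant 8
-- coming from the Gaussian case.
Factored : {I : Set} → (I → ℕ) → (I → ℕ) → (ℕ → ℕ) → Set
Factored size f g = ∀ x → 1 ≤ size x → ∃ λ fs →
  All (λ (q , a) → 2 ≤ q × 1 ≤ a) fs × size x ≡ prodOfPowers fs × f x ≡ product (map (λ (_ , a) → g a) fs) ×
  ∀ μ → countBelow μ fs ≤ 8 * 2 ^ μ

module _ {K g} (2≤K : 2 ≤ K) (tame : Tame K g) where
  open ≤-Reasoning

  1≤prodOfPowers : ∀ {fs} → All (λ (q , a) → 2 ≤ q × 1 ≤ a) fs → 1 ≤ prodOfPowers fs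
  1≤prodOfPowers []                              = s≤s z≤n
  1≤prodOfPowers (_∷_ {q , a} (2≤q , _) fs) = *-mono-≤ (1≤m^n a (≤-trans (s≤s z≤n) 2≤q)) (1≤prodOfPowers fs)

  -- Primes q ≥ 2 ^ μ are charged a, using g a ≤ K ^ (a / 2); the others are charged
  -- 3 h, since the exponent a is at most 2 ^ h.
  split-at-threshold : ∀ h μ fs → All (λ (q , a) → 2 ≤ q × 1 ≤ a) fs → prodOfPowers fs ≤ 2 ^ (2 ^ h) →
    ∃ λ A → product (map (λ (_ , a) → g a) fs) * product (map (λ (_ , a) → g a) fs)
              ≤ K ^ (A + 3 * h * countBelow μ fs) ×
            2 ^ (μ * A) ≤ prodOfPowers fs
  split-at-threshold h μ [] [] _ = 0 , 1≤m^n (0 + 3 * h * 0) (≤-trans (s≤s z≤n) 2≤K) , ≤-reflexive (cong (2 ^_) (*-zeroʳ μ))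
  split-at-threshold h μ ((q , a) ∷ fs) ((2≤q , 1≤a) ∷ ok) bounded
    with split-at-threshold h μ fs ok (≤-trans (≤-trans (≤-reflexive (sym (*-identityˡ _))) (*-monoˡ-≤ (prodOfPowers fs) (1≤m^n a (≤-trans (s≤s z≤n) 2≤q)))) bounded)
       | tame a 1≤a
  ... | A , t²≤ , large | g²≤K^a , ω , 2^ω≤a , g²≤K^3ω with q <? 2 ^ μ
  ...   | yes q<2^μ = A , subst (λ n → g a * t * (g a * t) ≤ K ^ (A + 3 * h * n)) (sym (cong length (filter-accept (λ (q , _) → q <? 2 ^ μ) {q , a} {fs} q<2^μ))) bound , ≤-trans large (≤-trans (≤-reflexive (sym (*-identityˡ _))) (*-monoˡ-≤ (prodOfPowers fs) (1≤m^n a (≤-trans (s≤s z≤n) 2≤q))))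
    where
    n t : ℕ
    n = countBelow μ fs
    t = product (map (λ (_ , a) → g a) fs)
    a≤2^h : 2 ^ a ≤ 2 ^ (2 ^ h)
    a≤2^h = begin
      2 ^ a                  ≤⟨ ^-monoˡ-≤ a 2≤q ⟩
      q ^ a                  ≡⟨ sym (*-identityʳ (q ^ a)) ⟩
      q ^ a * 1              ≤⟨ *-monoʳ-≤ (q ^ a) (1≤prodOfPowers ok) ⟩
      q ^ a * prodOfPowers fs ≤⟨ bounded ⟩
      2 ^ (2 ^ h) ∎
    ω≤h : ω ≤ h
    ω≤h = 2^-cancel-≤ (≤-<-trans 2^ω≤a (≤-<-trans (2^-cancel-≤ (≤-<-trans a≤2^h (^-monoʳ-< 2 (s≤s (s≤s z≤n)) (n<1+n (2 ^ h))))) (^-monoʳ-< 2 (s≤s (s≤s z≤n)) (n<1+n h))))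
    bound : g a * t * (g a * t) ≤ K ^ (A + 3 * h * suc n)
    bound = begin
      g a * t * (g a * t)                ≡⟨ regroup (g a) t ⟩
      g a * g a * (t * t)                ≤⟨ *-mono-≤ (≤-trans g²≤K^3ω (^-monoʳ-≤ K {{>-nonZero (≤-trans (s≤s z≤n) 2≤K)}} (*-monoʳ-≤ 3 ω≤h))) t²≤ ⟩
      K ^ (3 * h) * K ^ (A + 3 * h * n)  ≡⟨ sym (^-distribˡ-+-* K (3 * h) (A + 3 * h * n)) ⟩
      K ^ (3 * h + (A + 3 * h * n))      ≡⟨ cong (K ^_) (exponent h A n) ⟩
      K ^ (A + 3 * h * suc n) ∎
      where
      regroup : ∀ x t → x * t * (x * t) ≡ x * x * (t * t)
      regroup = ℕ-Solver.solve-∀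
      exponent : ∀ h A n → 3 * h + (A + 3 * h * n) ≡ A + 3 * h * suc n
      exponent = ℕ-Solver.solve-∀
  ...   | no q≮2^μ = a + A , subst (λ n → g a * t * (g a * t) ≤ K ^ (a + A + 3 * h * n)) (sym (cong length (filter-reject (λ (q , _) → q <? 2 ^ μ) {q , a} {fs} q≮2^μ))) bound , large′
    where
    n t : ℕ
    n = countBelow μ fs
    t = product (map (λ (_ , a) → g a) fs)
    bound : g a * t * (g a * t) ≤ K ^ (a + A + 3 * h * n)
    bound = begin
      g a * t * (g a * t)            ≡⟨ regroup (g a) t ⟩
      g a * g a * (t * t)            ≤⟨ *-mono-≤ g²≤K^a t²≤ ⟩
      K ^ a * K ^ (A + 3 * h * n)    ≡⟨ sym (^-distribˡ-+-* K a (A + 3 * h * n)) ⟩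
      K ^ (a + (A + 3 * h * n))      ≡⟨ cong (K ^_) (sym (+-assoc a A (3 * h * n))) ⟩
      K ^ (a + A + 3 * h * n) ∎
      where
      regroup : ∀ x t → x * t * (x * t) ≡ x * x * (t * t)
      regroup = ℕ-Solver.solve-∀
    large′ : 2 ^ (μ * (a + A)) ≤ q ^ a * prodOfPowers fs
    large′ = begin
      2 ^ (μ * (a + A))        ≡⟨ cong (2 ^_) (*-distribˡ-+ μ a A) ⟩
      2 ^ (μ * a + μ * A)      ≡⟨ ^-distribˡ-+-* 2 (μ * a) (μ * A) ⟩
      2 ^ (μ * a) * 2 ^ (μ * A) ≡⟨ cong (_* 2 ^ (μ * A)) (sym (^-*-assoc 2 μ a)) ⟩
      (2 ^ μ) ^ a * 2 ^ (μ * A) ≤⟨ *-mono-≤ (^-monoˡ-≤ a (≮⇒≥ q≮2^μ)) large ⟩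
      q ^ a * prodOfPowers fs ∎

  -- `Tame` bounds squares so that half-integral exponents stay in ℕ. The square root taken here
  -- rounds the exponent up, at a cost of at most 2 in `2 * M`.
  halve : ∀ {t M} → t * t ≤ K ^ M → t ≤ K ^ suc (M / 2) × 2 * suc (M / 2) ≤ M + 2
  halve {t} {M} t²≤K^M = square-cancel-≤ (begin
      t * t                              ≤⟨ t²≤K^M ⟩
      K ^ M                              ≤⟨ ^-monoʳ-≤ K {{>-nonZero (≤-trans (s≤s z≤n) 2≤K)}} (<⇒≤ (m<suc[m/n]*n M 2)) ⟩
      K ^ (suc (M / 2) * 2)              ≡⟨ cong (K ^_) (twice (suc (M / 2))) ⟩
      K ^ (suc (M / 2) + suc (M / 2))    ≡⟨ ^-distribˡ-+-* K (suc (M / 2)) (suc (M / 2)) ⟩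
      K ^ suc (M / 2) * K ^ suc (M / 2) ∎)
    , ≤-trans (≤-reflexive (rearrange (M / 2))) (+-monoˡ-≤ 2 (m/n*n≤m M 2))
    where
    twice : ∀ m → m * 2 ≡ m + m
    twice = ℕ-Solver.solve-∀
    rearrange : ∀ m → 2 * suc m ≡ m * 2 + 2
    rearrange = ℕ-Solver.solve-∀

  -- With κ = h / (2 s + 1) and threshold 2 ^ (h - κ): the large primes contribute
  -- A ≤ ℓ / (h - κ), and the small ones O(h 2 ^ (h - κ)), which 2 ^ κ ≫ h² makes negligible.
  exponent-bound : ∀ s h κ μ ℓ A n M → h ≡ μ + κ → κ * suc (2 * s) ≤ h → h < suc κ * suc (2 * s) → 1 ≤ h →
    104 * s * (suc (2 * s) * suc (2 * s)) * (suc κ * suc κ) ≤ 2 ^ κ →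
    2 ^ h ≤ 2 * ℓ → μ * A ≤ ℓ → n ≤ 8 * 2 ^ μ → 2 * M ≤ A + 3 * h * n + 2 →
    s * (2 * (M * h)) ≤ suc s * ℓ
  exponent-bound s h κ μ ℓ A n M h≡ κ≤ h< 1≤h small 2^h≤ A≤ n≤ M≤ = *-cancelˡ-≤ 2 (begin
    2 * (s * (2 * (M * h)))                         ≡⟨ e₁ s M h ⟩
    2 * s * h * (2 * M)                             ≤⟨ *-monoʳ-≤ (2 * s * h) M≤ ⟩
    2 * s * h * (A + 3 * h * n + 2)                 ≡⟨ e₂ s h A n ⟩
    -- The budget 2 (s + 1) ℓ is shared: (2 s + 1) ℓ for the large primes, where h / μ ≤ 1 + 1 / (2
    -- s), and ℓ for the small primes together with the rounding.
    2 * s * h * A + 2 * s * h * (3 * h * n + 2)     ≤⟨ +-mono-≤ main rest ⟩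
    suc (2 * s) * ℓ + ℓ                             ≡⟨ e₃ s ℓ ⟩
    2 * (suc s * ℓ) ∎)
    where
    e₁ : ∀ s M h → 2 * (s * (2 * (M * h))) ≡ 2 * s * h * (2 * M)
    e₁ = ℕ-Solver.solve-∀
    e₂ : ∀ s h A n → 2 * s * h * (A + 3 * h * n + 2) ≡ 2 * s * h * A + 2 * s * h * (3 * h * n + 2)
    e₂ = ℕ-Solver.solve-∀
    e₃ : ∀ s ℓ → suc (2 * s) * ℓ + ℓ ≡ 2 * (suc s * ℓ)
    e₃ = ℕ-Solver.solve-∀
    main : 2 * s * h * A ≤ suc (2 * s) * ℓ
    main = begin
      2 * s * h * A              ≤⟨ *-monoˡ-≤ A 2sh≤ ⟩
      suc (2 * s) * μ * A        ≡⟨ *-assoc (suc (2 * s)) μ A ⟩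
      suc (2 * s) * (μ * A)      ≤⟨ *-monoʳ-≤ (suc (2 * s)) A≤ ⟩
      suc (2 * s) * ℓ ∎
      where
      2sh≤ : 2 * s * h ≤ suc (2 * s) * μ
      2sh≤ = +-cancelʳ-≤ h (2 * s * h) (suc (2 * s) * μ) (begin
        2 * s * h + h                              ≡⟨ +-comm (2 * s * h) h ⟩
        suc (2 * s) * h                            ≡⟨ cong (suc (2 * s) *_) h≡ ⟩
        suc (2 * s) * (μ + κ)                      ≡⟨ *-distribˡ-+ (suc (2 * s)) μ κ ⟩
        suc (2 * s) * μ + suc (2 * s) * κ          ≤⟨ +-monoʳ-≤ (suc (2 * s) * μ) (≤-trans (≤-reflexive (*-comm (suc (2 * s)) κ)) κ≤) ⟩
        suc (2 * s) * μ + h ∎)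
    -- The constant is 104 = 2 · 2 · (3 · 8 + 2): 8 from the count of small primes, and the final 2
    -- from rounding.
    rest : 2 * s * h * (3 * h * n + 2) ≤ ℓ
    rest = *-cancelˡ-≤ 2 (begin
      2 * (2 * s * h * (3 * h * n + 2))
        ≤⟨ *-monoʳ-≤ 2 (*-monoʳ-≤ (2 * s * h) (+-mono-≤ (*-monoʳ-≤ (3 * h) n≤) (*-monoʳ-≤ 2 (*-mono-≤ 1≤h (m^n>0 2 μ))))) ⟩
      2 * (2 * s * h * (3 * h * (8 * 2 ^ μ) + 2 * (h * 2 ^ μ)))
        ≡⟨ e₄ s h (2 ^ μ) ⟩
      104 * s * (h * h) * 2 ^ μ
        ≤⟨ *-monoˡ-≤ (2 ^ μ) (*-monoʳ-≤ (104 * s) (*-mono-≤ (<⇒≤ h<) (<⇒≤ h<))) ⟩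
      104 * s * (suc κ * suc (2 * s) * (suc κ * suc (2 * s))) * 2 ^ μ
        ≡⟨ e₅ (104 * s) (suc κ) (suc (2 * s)) (2 ^ μ) ⟩
      2 ^ μ * (104 * s * (suc (2 * s) * suc (2 * s)) * (suc κ * suc κ))
        ≤⟨ *-monoʳ-≤ (2 ^ μ) small ⟩
      2 ^ μ * 2 ^ κ
        ≡⟨ trans (sym (^-distribˡ-+-* 2 μ κ)) (cong (2 ^_) (sym h≡)) ⟩
      2 ^ h
        ≤⟨ 2^h≤ ⟩
      2 * ℓ ∎)
      where
      e₄ : ∀ s h p → 2 * (2 * s * h * (3 * h * (8 * p) + 2 * (h * p))) ≡ 104 * s * (h * h) * p
      e₄ = ℕ-Solver.solve-∀
      e₅ : ∀ t k m p → t * (k * m * (k * m)) * p ≡ p * (t * (m * m) * (k * k))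
      e₅ = ℕ-Solver.solve-∀

  upperCore : ∀ {I} {size f : I → ℕ} → Factored size f g → UpperCore K size f
  upperCore {I} {size} {f} factored s =
    let κ₀ , dominates = exponential-dominates-square (104 * s * (suc (2 * s) * suc (2 * s)))
        -- The first term makes h / (2 s + 1) at least κ₀; the summand 2 gives ℓ ≥ 4 and hence N ≥
        -- 16.
        H = κ₀ * suc (2 * s) + 2
    in 2 ^ (2 ^ H) , λ x large →
         let 1≤N = ≤-trans (m^n>0 2 (2 ^ H)) large
             ℓ , 2^ℓ≤N , N<2^1+ℓ = log₂-bounds (size x) 1≤N
             2^H≤ℓ = 2^-cancel-≤ {2 ^ H} {ℓ} (≤-<-trans large N<2^1+ℓ)
             1≤ℓ = ≤-trans (m^n>0 2 H) 2^H≤ℓ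
         in core κ₀ dominates x ℓ 2^ℓ≤N N<2^1+ℓ 2^H≤ℓ 1≤ℓ (log₂-bounds ℓ 1≤ℓ) (factored x 1≤N)
    where
    d : ℕ
    d = suc (2 * s)
    core : ∀ κ₀ → (∀ κ → κ₀ ≤ κ → 104 * s * (d * d) * (suc κ * suc κ) ≤ 2 ^ κ) →
           ∀ x ℓ → 2 ^ ℓ ≤ size x → size x < 2 ^ suc ℓ → 2 ^ (κ₀ * d + 2) ≤ ℓ → 1 ≤ ℓ →
           (∃ λ h → 2 ^ h ≤ ℓ × ℓ < 2 ^ suc h) →
           (∃ λ fs → All (λ (q , a) → 2 ≤ q × 1 ≤ a) fs × size x ≡ prodOfPowers fs ×
             f x ≡ product (map (λ (_ , a) → g a) fs) × ∀ μ → countBelow μ fs ≤ 8 * 2 ^ μ) →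
           ∃ λ M → ∃ λ ℓ → ∃ λ h →
           1 ≤ M × 1 ≤ ℓ × 1 ≤ h × 16 ≤ size x × 2 ^ ℓ ≤ size x × size x ≤ 2 ^ (2 ^ h) ×
           f x ≤ K ^ M × s * (2 * (M * h)) ≤ suc s * ℓ
    core κ₀ dominates x ℓ 2^ℓ≤N N<2^1+ℓ 2^H≤ℓ 1≤ℓ (h-1 , 2^h-1≤ℓ , ℓ<2^h) (fs , ok , N≡ , t≡ , count) =
        M , ℓ , h , s≤s z≤n , 1≤ℓ , s≤s z≤n
        , ≤-trans (^-monoʳ-≤ 2 {4} {ℓ} (≤-trans (^-monoʳ-≤ 2 {2} {κ₀ * d + 2} (m≤n+m 2 (κ₀ * d))) 2^H≤ℓ)) 2^ℓ≤N
        , 2^ℓ≤N , N≤2^2^h , subst (_≤ K ^ M) (sym t≡) (proj₁ halved)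
        , exponent-bound s h κ μ ℓ A n M (sym (m∸n+n≡m (m/n≤m h d))) (m/n*n≤m h d) (m<suc[m/n]*n h d) (s≤s z≤n)
            (dominates κ κ₀≤κ) (*-monoʳ-≤ 2 2^h-1≤ℓ)
            (2^-cancel-≤ (≤-<-trans (proj₂ (proj₂ split)) (subst (_< 2 ^ suc ℓ) N≡ N<2^1+ℓ)))
            (count μ) (proj₂ halved)
      where
      h κ μ n A M : ℕ
      -- One more than the integer part of log₂ ℓ: this gives N < 2 ^ (ℓ + 1) ≤ 2 ^ (2 ^ h), while 2
      -- ^ h ≤ 2 ℓ still holds.
      h = suc h-1
      κ = h / d
      μ = h ∸ κ
      n = countBelow μ fs
      N≤2^2^h : size x ≤ 2 ^ (2 ^ h)
      N≤2^2^h = ≤-trans (<⇒≤ N<2^1+ℓ) (^-monoʳ-≤ 2 ℓ<2^h)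
      split : ∃ λ A → product (map (λ (_ , a) → g a) fs) * product (map (λ (_ , a) → g a) fs) ≤ K ^ (A + 3 * h * n) ×
                      2 ^ (μ * A) ≤ prodOfPowers fs
      split = split-at-threshold h μ fs ok (subst (_≤ 2 ^ (2 ^ h)) N≡ N≤2^2^h)
      A = proj₁ split
      M = suc ((A + 3 * h * n) / 2)
      halved : product (map (λ (_ , a) → g a) fs) ≤ K ^ M × 2 * M ≤ A + 3 * h * n + 2
      halved = halve (proj₁ (proj₂ split))
      κ₀≤κ : κ₀ ≤ κ
      κ₀≤κ = subst (_≤ κ) (m*n/n≡m κ₀ d) (/-monoˡ-≤ d (≤-trans (m≤m+n (κ₀ * d) 2) (≤-trans H≤h-1 (n≤1+n h-1))))
        where
        H≤h-1 : κ₀ * d + 2 ≤ h-1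
        H≤h-1 = 2^-cancel-≤ (≤-<-trans 2^H≤ℓ ℓ<2^h)

-- Comparing cardinalities of lists

any-─ : ∀ {A : Set} {P Q : A → Set} {xs} → (∀ {x} → P x → Q x → ⊥) → (p : Any P xs) → Any Q xs → Any Q (xs ─ p)
any-─ disjoint (here px) (here qx) = ⊥-elim (disjoint px qx)
any-─ disjoint (here _)  (there q) = q
any-─ {xs = _ ∷ _ ∷ _} disjoint (there _) (here qx) = here qx
any-─ {xs = _ ∷ _ ∷ _} disjoint (there p) (there q) = there (any-─ disjoint p q)

module _ {A B : Set} (R : A → B → Set) where

  all-─ : ∀ {x xs ys} (p : Any (R x) ys) → All (λ x′ → ∀ {y} → R x y → R x′ y → ⊥) xs →
               All (λ x′ → Any (R x′) ys) xs → All (λ x′ → Any (R x′) (ys ─ p)) xs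
  all-─ p []                       []       = []
  all-─ p (_∷_ {x = x′} apart aparts) (q ∷ qs) = any-─ {Q = R x′} (λ r → apart r) p q ∷ all-─ p aparts qs

  -- A pigeonhole principle for relations. Each `x` uses up a related `y`, and since no `y` is
  -- related to two entries, removing it leaves the partners of the others in place. This allows
  -- counting up to association without choosing an image function.
  length-≤-by : ∀ {xs ys} → AllPairs (λ x x′ → ∀ {y} → R x y → R x′ y → ⊥) xs → All (λ x → Any (R x) ys) xs → length xs ≤ length ys
  length-≤-by []               _        = z≤n
  length-≤-by {x ∷ xs} {ys} (apart ∷ aparts) (p ∷ ps) = subst (suc (length xs) ≤_) (sym (length-removeAt′ ys (Any.index p))) (s≤s (length-≤-by aparts (all-─ p apart ps)))

  unique-length-≤-by : ∀ {xs ys} → Unique xs → (∀ {x x′ y} → R x y → R x′ y → x ≡ x′) →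
                       (∀ {x} → x ∈ xs → ∃ λ y → y ∈ ys × R x y) → length xs ≤ length ys
  unique-length-≤-by unique injective covered = length-≤-by
    (AllPairs.map (λ x≢x′ {_} Rx Rx′ → x≢x′ (injective Rx Rx′)) unique)
    (All.tabulate (λ x∈ → let y , y∈ , Rxy = covered x∈ in lose y∈ Rxy))

length-cartesianProductWith : ∀ {A B C : Set} (f : A → B → C) xs ys → length (cartesianProductWith f xs ys) ≡ length xs * length ys
length-cartesianProductWith f []       ys = refl
length-cartesianProductWith f (x ∷ xs) ys =
  trans (length-++ (map (f x) ys)) (cong₂ _+_ (length-map (f x) ys) (length-cartesianProductWith f xs ys))

module _ {A : Set} where

  ∈-tuples⁺ : ∀ {xs : List A} {ds} k → length ds ≡ k → All (_∈ xs) ds → ds ∈ tuples k xs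
  ∈-tuples⁺ zero            refl []         = here refl
  ∈-tuples⁺ {ds = d ∷ ds} (suc k) e (d∈ ∷ ds∈) = ∈-cartesianProductWith⁺ _∷_ d∈ (∈-tuples⁺ k (suc-injective e) ds∈)

  ∈-tuples⁻ : ∀ {xs : List A} {ds} k → ds ∈ tuples k xs → length ds ≡ k × All (_∈ xs) ds
  ∈-tuples⁻ zero (here refl) = refl , []
  ∈-tuples⁻ {xs} (suc k) ds∈ =
    let d , ds , d∈ , ds∈ , e = ∈-cartesianProductWith⁻ _∷_ xs (tuples k xs) ds∈
        l , all = ∈-tuples⁻ k ds∈
    in trans (cong length e) (cong suc l) , subst (All (_∈ xs)) (sym e) (d∈ ∷ all)

  tuples-unique : ∀ {xs : List A} k → Unique xs → Unique (tuples k xs)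
  tuples-unique zero    unique = [] ∷ []
  tuples-unique (suc k) unique = Unique.cartesianProductWith⁺ _∷_ ∷-injective unique (tuples-unique k unique)

  module _ {P Q : List A → Set} (P? : Decidable P) (Q? : Decidable Q) where

    length-filter-map : ∀ f → (∀ {x} → P x → Q (f x)) → ∀ xs → length (filter P? xs) ≤ length (filter Q? (map f xs))
    length-filter-map f P⇒Q []       = z≤n
    length-filter-map f P⇒Q (x ∷ xs) with P? x | Q? (f x)
    ... | yes _  | yes _  = s≤s (length-filter-map f P⇒Q xs)
    ... | yes px | no ¬qx = ⊥-elim (¬qx (P⇒Q px))
    ... | no _   | yes _  = m≤n⇒m≤1+n (length-filter-map f P⇒Q xs)
    ... | no _   | no _   = length-filter-map f P⇒Q xs

    length-filter-map-++ : ∀ f → (∀ {x} → P x → Q (f x)) → ∀ xs ys →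
                           length (filter P? xs) + length (filter Q? ys) ≤ length (filter Q? (map f xs ++ ys))
    length-filter-map-++ f P⇒Q xs ys = subst (length (filter P? xs) + length (filter Q? ys) ≤_)
      (sym (trans (cong length (filter-++ Q? (map f xs) ys)) (length-++ (filter Q? (map f xs)))))
      (+-monoˡ-≤ (length (filter Q? ys)) (length-filter-map f P⇒Q xs))

-- This models dividing a single entry of a tuple. The position is an index because position and
-- result together determine the original tuple when `E` is injective.
data Replace {A : Set} (E : A → A → Set) : ℕ → List A → List A → Set where
  here  : ∀ {x y zs} → E x y → Replace E 0 (x ∷ zs) (y ∷ zs)
  there : ∀ {n z xs ys} → Replace E n xs ys → Replace E (suc n) (z ∷ xs) (z ∷ ys)

module _ {A : Set} {E : A → A → Set} where

  replace-injective : (∀ {x x′ y} → E x y → E x′ y → x ≡ x′) → ∀ {n xs xs′ ys} → Replace E n xs ys → Replace E n xs′ ys → xs ≡ xs′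
  replace-injective inj (here e)  (here e′)  = cong (_∷ _) (inj e e′)
  replace-injective inj (there r) (there r′) = cong (_ ∷_) (replace-injective inj r r′)

  replace-length : ∀ {n xs ys} → Replace E n xs ys → length xs ≡ length ys
  replace-length (here _)  = refl
  replace-length (there r) = cong suc (replace-length r)

  replace-< : ∀ {n xs ys} → Replace E n xs ys → n < length xs
  replace-< (here _)  = s≤s z≤n
  replace-< (there r) = s≤s (replace-< r)

  -- Replacements at different positions commute, so a pair of them can be normalised to have the
  -- larger position first.
  replace-swap : ∀ {m n xs ys zs} → m < n → Replace E m xs ys → Replace E n ys zs → ∃ λ ys′ → Replace E n xs ys′ × Replace E m ys′ zs
  replace-swap _         (here e)  (there r) = _ , there r , here e
  replace-swap (s≤s m<n) (there r) (there s) = let _ , s′ , r′ = replace-swap m<n r s in _ , there s′ , there r′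

orderedPairs : ℕ → List (ℕ × ℕ)
orderedPairs zero    = []
orderedPairs (suc k) = map (k ,_) (upTo (suc k)) ++ orderedPairs k

length-orderedPairs : ∀ k → length (orderedPairs k) ≡ suc k C 2
length-orderedPairs zero    = refl
length-orderedPairs (suc k) = trans (length-++ (map (k ,_) (upTo (suc k))))
  (trans (cong₂ _+_ (trans (length-map (k ,_) (upTo (suc k))) (trans (length-upTo (suc k)) (sym (nC1≡n (suc k))))) (length-orderedPairs k))
    (nCk+nC[k+1]≡[n+1]C[k+1] (suc k) 1))

∈-orderedPairs : ∀ {k m n} → m < k → n ≤ m → (m , n) ∈ orderedPairs k
∈-orderedPairs {suc k} {m} {n} (s≤s m≤k) n≤m with m ≟ k
... | yes refl = ∈-++⁺ˡ (∈-map⁺ (k ,_) (∈-upTo⁺ (s≤s n≤m)))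
... | no m≢k   = ∈-++⁺ʳ (map (k ,_) (upTo (suc k))) (∈-orderedPairs (≤∧≢⇒< m≤k m≢k) n≤m)

module _ {A : Set} (E : A → A → Set) (injective : ∀ {x x′ y} → E x y → E x′ y → x ≡ x′) where

  length-≤-by-replacing : ∀ k {xss yss} → Unique xss →
    (∀ {xs} → xs ∈ xss → length xs ≡ k × ∃₂ λ n ys → Replace E n xs ys × ys ∈ yss) → length xss ≤ k * length yss
  length-≤-by-replacing k {xss} {yss} unique covered = subst (length xss ≤_)
    (trans (length-cartesianProductWith _,_ (upTo k) yss) (cong (_* length yss) (length-upTo k)))
    (unique-length-≤-by (λ xs (n , ys) → Replace E n xs ys) unique (λ {_} {_} {_} → replace-injective injective)
      (λ xs∈ → let l , n , ys , r , ys∈ = covered xs∈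
               in (n , ys) , ∈-cartesianProduct⁺ (∈-upTo⁺ (subst (n <_) l (replace-< r))) ys∈ , r))

  -- After normalising by `replace-swap`, the two positions matter only as an unordered pair,
  -- possibly equal. This is the source of C(k + 1, 2) in place of k².
  length-≤-by-replacing-two : ∀ k {xss yss} → Unique xss →
    (∀ {xs} → xs ∈ xss → length xs ≡ k × ∃₂ λ m n → ∃₂ λ ys zs → Replace E m xs ys × Replace E n ys zs × zs ∈ yss) →
    length xss ≤ (suc k C 2) * length yss
  length-≤-by-replacing-two k {xss} {yss} unique covered = subst (length xss ≤_)
    (trans (length-cartesianProductWith _,_ (orderedPairs k) yss) (cong (_* length yss) (length-orderedPairs k)))
    (unique-length-≤-by R unique R-injective R-covered)
    where
    R : List A → (ℕ × ℕ) × List A → Set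
    R xs ((m , n) , zs) = ∃ λ ys → Replace E m xs ys × Replace E n ys zs
    R-injective : ∀ {xs xs′ y} → R xs y → R xs′ y → xs ≡ xs′
    R-injective (ys , r , s) (ys′ , r′ , s′) with replace-injective injective s s′
    ... | refl = replace-injective injective r r′
    R-covered : ∀ {xs} → xs ∈ xss → ∃ λ y → y ∈ cartesianProduct (orderedPairs k) yss × R xs y
    R-covered xs∈ with covered xs∈
    ... | l , m , n , ys , zs , r , s , zs∈ with n ≤? m
    ...   | yes n≤m = ((m , n) , zs) , ∈-cartesianProduct⁺ (∈-orderedPairs (subst (m <_) l (replace-< r)) n≤m) zs∈ , ys , r , s
    ...   | no n≰m  = let ys′ , s′ , r′ = replace-swap (≰⇒> n≰m) r s
                      in ((n , m) , zs) , ∈-cartesianProduct⁺ (∈-orderedPairs (subst (n <_) l (replace-< s′)) (<⇒≤ (≰⇒> n≰m))) zs∈ , ys′ , s′ , r′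

-- Arithmetic of ℤ[i]

infix 8 -ᴳ_

-ᴳ_ : ℤ[i] → ℤ[i]
-ᴳ (a + b i) = (ℤ.- a) + (ℤ.- b) i

0ᴳ 1ᴳ : ℤ[i]
0ᴳ = ℕ→ℤ[i] 0
1ᴳ = ℕ→ℤ[i] 1

+ᴳ-assoc : ∀ α β γ → (α +ᴳ β) +ᴳ γ ≡ α +ᴳ (β +ᴳ γ)
+ᴳ-assoc (a + b i) (c + d i) (e + f i) = cong₂ _+_i (ℤₚ.+-assoc a c e) (ℤₚ.+-assoc b d f)

+ᴳ-comm : ∀ α β → α +ᴳ β ≡ β +ᴳ α
+ᴳ-comm (a + b i) (c + d i) = cong₂ _+_i (ℤₚ.+-comm a c) (ℤₚ.+-comm b d)

+ᴳ-identityˡ : ∀ α → 0ᴳ +ᴳ α ≡ α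
+ᴳ-identityˡ (a + b i) = cong₂ _+_i (ℤₚ.+-identityˡ a) (ℤₚ.+-identityˡ b)

-ᴳ-inverseˡ : ∀ α → -ᴳ α +ᴳ α ≡ 0ᴳ
-ᴳ-inverseˡ (a + b i) = cong₂ _+_i (ℤₚ.+-inverseˡ a) (ℤₚ.+-inverseˡ b)

*ᴳ-assoc : ∀ α β γ → (α *ᴳ β) *ᴳ γ ≡ α *ᴳ (β *ᴳ γ)
*ᴳ-assoc (a + b i) (c + d i) (e + f i) = cong₂ _+_i (real a b c d e f) (imaginary a b c d e f)
  where
  real : ∀ a b c d e f → (a ℤ.* c ℤ.- b ℤ.* d) ℤ.* e ℤ.- (a ℤ.* d ℤ.+ b ℤ.* c) ℤ.* f ≡ a ℤ.* (c ℤ.* e ℤ.- d ℤ.* f) ℤ.- b ℤ.* (c ℤ.* f ℤ.+ d ℤ.* e)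
  real = ℤ-Solver.solve-∀
  imaginary : ∀ a b c d e f → (a ℤ.* c ℤ.- b ℤ.* d) ℤ.* f ℤ.+ (a ℤ.* d ℤ.+ b ℤ.* c) ℤ.* e ≡ a ℤ.* (c ℤ.* f ℤ.+ d ℤ.* e) ℤ.+ b ℤ.* (c ℤ.* e ℤ.- d ℤ.* f)
  imaginary = ℤ-Solver.solve-∀

*ᴳ-comm : ∀ α β → α *ᴳ β ≡ β *ᴳ α
*ᴳ-comm (a + b i) (c + d i) = cong₂ _+_i (real a b c d) (imaginary a b c d)
  where
  real : ∀ a b c d → a ℤ.* c ℤ.- b ℤ.* d ≡ c ℤ.* a ℤ.- d ℤ.* b
  real = ℤ-Solver.solve-∀
  imaginary : ∀ a b c d → a ℤ.* d ℤ.+ b ℤ.* c ≡ c ℤ.* b ℤ.+ d ℤ.* a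
  imaginary = ℤ-Solver.solve-∀

*ᴳ-identityˡ : ∀ α → 1ᴳ *ᴳ α ≡ α
*ᴳ-identityˡ (a + b i) = cong₂ _+_i (real a b) (imaginary a b)
  where
  real : ∀ a b → ℤ.1ℤ ℤ.* a ℤ.- ℤ.0ℤ ℤ.* b ≡ a
  real = ℤ-Solver.solve-∀
  imaginary : ∀ a b → ℤ.1ℤ ℤ.* b ℤ.+ ℤ.0ℤ ℤ.* a ≡ b
  imaginary = ℤ-Solver.solve-∀

*ᴳ-distribˡ : ∀ α β γ → α *ᴳ (β +ᴳ γ) ≡ α *ᴳ β +ᴳ α *ᴳ γ
*ᴳ-distribˡ (a + b i) (c + d i) (e + f i) = cong₂ _+_i (real a b c d e f) (imaginary a b c d e f)
  where
  real : ∀ a b c d e f → a ℤ.* (c ℤ.+ e) ℤ.- b ℤ.* (d ℤ.+ f) ≡ (a ℤ.* c ℤ.- b ℤ.* d) ℤ.+ (a ℤ.* e ℤ.- b ℤ.* f)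
  real = ℤ-Solver.solve-∀
  imaginary : ∀ a b c d e f → a ℤ.* (d ℤ.+ f) ℤ.+ b ℤ.* (c ℤ.+ e) ≡ (a ℤ.* d ℤ.+ b ℤ.* c) ℤ.+ (a ℤ.* f ℤ.+ b ℤ.* e)
  imaginary = ℤ-Solver.solve-∀

ℤ[i]-commutativeRing : CommutativeRing 0ℓ 0ℓ
ℤ[i]-commutativeRing = record
  { Carrier = ℤ[i] ; _≈_ = _≡_ ; _+_ = _+ᴳ_ ; _*_ = _*ᴳ_ ; -_ = -ᴳ_ ; 0# = 0ᴳ ; 1# = 1ᴳ
  ; isCommutativeRing = record
    { isRing = record
      { +-isAbelianGroup = record
        { isGroup = record
          { isMonoid = record
            { isSemigroup = record
              { isMagma = record { isEquivalence = isEquivalence ; ∙-cong = cong₂ _+ᴳ_ }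
              ; assoc = +ᴳ-assoc }
            ; identity = +ᴳ-identityˡ , λ α → trans (+ᴳ-comm α 0ᴳ) (+ᴳ-identityˡ α) }
          ; inverse = -ᴳ-inverseˡ , λ α → trans (+ᴳ-comm α (-ᴳ α)) (-ᴳ-inverseˡ α)
          ; ⁻¹-cong = cong -ᴳ_ }
        ; comm = +ᴳ-comm }
      ; *-cong = cong₂ _*ᴳ_
      ; *-assoc = *ᴳ-assoc
      ; *-identity = *ᴳ-identityˡ , λ α → trans (*ᴳ-comm α 1ᴳ) (*ᴳ-identityˡ α)
      ; distrib = *ᴳ-distribˡ , λ α β γ → trans (*ᴳ-comm (β +ᴳ γ) α) (trans (*ᴳ-distribˡ α β γ) (cong₂ _+ᴳ_ (*ᴳ-comm α β) (*ᴳ-comm α γ)))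
      }
    ; *-comm = *ᴳ-comm }
  }

open CommutativeRing ℤ[i]-commutativeRing using () renaming (zeroˡ to *ᴳ-zeroˡ; -‿inverseʳ to -ᴳ-inverseʳ; +-identityʳ to +ᴳ-identityʳ)

ℤ[i]-solverRing : AlmostCommutativeRing 0ℓ 0ℓ
ℤ[i]-solverRing = fromCommutativeRing ℤ[i]-commutativeRing (λ α → dec⇒maybe (0ᴳ ≟ᴳ α))

square-abs : ∀ a → ℤ.+ (ℤ.∣ a ∣ ^ 2) ≡ a ℤ.* a
square-abs (ℤ.+ n)    = trans (cong (λ m → ℤ.+ (n * m)) (*-identityʳ n)) (ℤₚ.pos-* n n)
square-abs ℤ.-[1+ n ] = cong (λ m → ℤ.+ (suc n * m)) (*-identityʳ (suc n))

norm-ℤ : ∀ a b → ℤ.+ norm (a + b i) ≡ a ℤ.* a ℤ.+ b ℤ.* b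
norm-ℤ a b = trans (ℤₚ.pos-+ (ℤ.∣ a ∣ ^ 2) (ℤ.∣ b ∣ ^ 2)) (cong₂ ℤ._+_ (square-abs a) (square-abs b))

norm-* : ∀ α β → norm (α *ᴳ β) ≡ norm α * norm β
norm-* (a + b i) (c + d i) = ℤₚ.+-injective (begin
  ℤ.+ norm ((a + b i) *ᴳ (c + d i))                         ≡⟨ norm-ℤ (a ℤ.* c ℤ.- b ℤ.* d) (a ℤ.* d ℤ.+ b ℤ.* c) ⟩
  _                                                         ≡⟨ brahmagupta a b c d ⟩
  (a ℤ.* a ℤ.+ b ℤ.* b) ℤ.* (c ℤ.* c ℤ.+ d ℤ.* d)           ≡⟨ sym (cong₂ ℤ._*_ (norm-ℤ a b) (norm-ℤ c d)) ⟩
  ℤ.+ norm (a + b i) ℤ.* ℤ.+ norm (c + d i)                 ≡⟨ sym (ℤₚ.pos-* (norm (a + b i)) (norm (c + d i))) ⟩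
  ℤ.+ (norm (a + b i) * norm (c + d i)) ∎)
  where
  open ≡-Reasoning
  brahmagupta : ∀ a b c d → (a ℤ.* c ℤ.- b ℤ.* d) ℤ.* (a ℤ.* c ℤ.- b ℤ.* d) ℤ.+ (a ℤ.* d ℤ.+ b ℤ.* c) ℤ.* (a ℤ.* d ℤ.+ b ℤ.* c)
                ≡ (a ℤ.* a ℤ.+ b ℤ.* b) ℤ.* (c ℤ.* c ℤ.+ d ℤ.* d)
  brahmagupta = ℤ-Solver.solve-∀

conj : ℤ[i] → ℤ[i]
conj (a + b i) = a + (ℤ.- b) i

norm-conj : ∀ α → norm (conj α) ≡ norm α
norm-conj (a + b i) = cong (λ m → ℤ.∣ a ∣ ^ 2 + m ^ 2) (ℤₚ.∣-i∣≡∣i∣ b)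

conj-*ᴳ : ∀ α → conj α *ᴳ α ≡ ℕ→ℤ[i] (norm α)
conj-*ᴳ (a + b i) = cong₂ _+_i (trans (real a b) (sym (norm-ℤ a b))) (imaginary a b)
  where
  real : ∀ a b → a ℤ.* a ℤ.- (ℤ.- b) ℤ.* b ≡ a ℤ.* a ℤ.+ b ℤ.* b
  real = ℤ-Solver.solve-∀
  imaginary : ∀ a b → a ℤ.* b ℤ.+ (ℤ.- b) ℤ.* a ≡ ℤ.0ℤ
  imaginary = ℤ-Solver.solve-∀

norm-ℕ→ℤ[i] : ∀ n → norm (ℕ→ℤ[i] n) ≡ n * n
norm-ℕ→ℤ[i] n = trans (+-identityʳ (n ^ 2)) (cong (n *_) (*-identityʳ n))

m²≡0⇒m≡0 : ∀ m → m ^ 2 ≡ 0 → m ≡ 0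
m²≡0⇒m≡0 zero    _ = refl

norm≡0⇒≡0 : ∀ α → norm α ≡ 0 → α ≡ 0ᴳ
norm≡0⇒≡0 (a + b i) e = cong₂ _+_i
  (ℤₚ.∣i∣≡0⇒i≡0 (m²≡0⇒m≡0 ℤ.∣ a ∣ (m+n≡0⇒m≡0 (ℤ.∣ a ∣ ^ 2) e)))
  (ℤₚ.∣i∣≡0⇒i≡0 (m²≡0⇒m≡0 ℤ.∣ b ∣ (m+n≡0⇒n≡0 (ℤ.∣ a ∣ ^ 2) e)))

≢0⇒1≤norm : ∀ α → α ≢ 0ᴳ → 1 ≤ norm α
≢0⇒1≤norm α α≢0 = n≢0⇒n>0 (λ e → α≢0 (norm≡0⇒≡0 α e))

1≤norm⇒≢0 : ∀ α → 1 ≤ norm α → α ≢ 0ᴳ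
1≤norm⇒≢0 _ () refl

-ᴳ-zero : ∀ α β → α +ᴳ -ᴳ β ≡ 0ᴳ → α ≡ β
-ᴳ-zero α β e = trans (rearrange α β) (trans (cong (_+ᴳ β) e) (+ᴳ-identityˡ β))
  where
  rearrange : ∀ α β → α ≡ (α +ᴳ -ᴳ β) +ᴳ β
  rearrange = RingSolver.solve-∀ ℤ[i]-solverRing

*ᴳ-cancelˡ : ∀ γ α β → 1 ≤ norm γ → γ *ᴳ α ≡ γ *ᴳ β → α ≡ β
*ᴳ-cancelˡ γ α β 1≤ e = -ᴳ-zero α β (norm≡0⇒≡0 (α +ᴳ -ᴳ β) (m*n≡0⇒n≡0 (norm γ) 1≤ (trans (sym (norm-* γ (α +ᴳ -ᴳ β))) (cong norm zero′))))
  where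
  m*n≡0⇒n≡0 : ∀ m {n} → 1 ≤ m → m * n ≡ 0 → n ≡ 0
  m*n≡0⇒n≡0 (suc m) {zero}  _ _ = refl
  expand : ∀ γ α β → γ *ᴳ (α +ᴳ -ᴳ β) ≡ γ *ᴳ α +ᴳ -ᴳ (γ *ᴳ β)
  expand = RingSolver.solve-∀ ℤ[i]-solverRing
  zero′ : γ *ᴳ (α +ᴳ -ᴳ β) ≡ 0ᴳ
  zero′ = trans (expand γ α β) (trans (cong (_+ᴳ -ᴳ (γ *ᴳ β)) e) (-ᴳ-inverseʳ (γ *ᴳ β)))

-- Divisibility and the Euclidean algorithm in ℤ[i]

norm-∣ : ∀ {α β} → α ∣ᴳ β → ∃ λ n → norm β ≡ n * norm α
norm-∣ {α} (γ by e) = norm γ , trans (cong norm (sym e)) (norm-* γ α)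

m≡n*k⇒k≤m : ∀ {m k} → 1 ≤ m → (∃ λ n → m ≡ n * k) → k ≤ m
m≡n*k⇒k≤m         1≤m (zero  , e) = ⊥-elim (<⇒≢ 1≤m (sym e))
m≡n*k⇒k≤m {m} {k} 1≤m (suc n , e) = subst (k ≤_) (sym e) (m≤m+n k (n * k))

norm-∣-≤ : ∀ {α β} → 1 ≤ norm β → α ∣ᴳ β → norm α ≤ norm β
norm-∣-≤ {α} {β} 1≤ α∣β = m≡n*k⇒k≤m {norm β} {norm α} 1≤ (norm-∣ α∣β)

∣ᴳ-refl : ∀ {α} → α ∣ᴳ α
∣ᴳ-refl {α} = 1ᴳ by *ᴳ-identityˡ α

∣ᴳ-trans : ∀ {α β γ} → α ∣ᴳ β → β ∣ᴳ γ → α ∣ᴳ γ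
∣ᴳ-trans {α} (δ by e) (ε by e′) = (ε *ᴳ δ) by trans (*ᴳ-assoc ε δ α) (trans (cong (ε *ᴳ_) e) e′)

∣ᴳ-+ : ∀ {α β γ} → α ∣ᴳ β → α ∣ᴳ γ → α ∣ᴳ (β +ᴳ γ)
∣ᴳ-+ {α} (δ by e) (ε by e′) = (δ +ᴳ ε) by trans (distribʳ α δ ε) (cong₂ _+ᴳ_ e e′)
  where
  distribʳ : ∀ α δ ε → (δ +ᴳ ε) *ᴳ α ≡ δ *ᴳ α +ᴳ ε *ᴳ α
  distribʳ = RingSolver.solve-∀ ℤ[i]-solverRing

∣ᴳ-*ˡ : ∀ γ {α β} → α ∣ᴳ β → α ∣ᴳ (γ *ᴳ β)
∣ᴳ-*ˡ γ {α} (δ by e) = (γ *ᴳ δ) by trans (*ᴳ-assoc γ δ α) (cong (γ *ᴳ_) e)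

∣ᴳ-*ʳ : ∀ γ {α β} → α ∣ᴳ β → α ∣ᴳ (β *ᴳ γ)
∣ᴳ-*ʳ γ {α} {β} α∣β = subst (α ∣ᴳ_) (*ᴳ-comm γ β) (∣ᴳ-*ˡ γ α∣β)

∣ᴳ-minus : ∀ {α β γ} → α ∣ᴳ β → α ∣ᴳ γ → α ∣ᴳ (β +ᴳ -ᴳ γ)
∣ᴳ-minus {α} (δ by e) (ε by e′) = (δ +ᴳ -ᴳ ε) by trans (distribʳ α δ ε) (cong₂ (λ x y → x +ᴳ -ᴳ y) e e′)
  where
  distribʳ : ∀ α δ ε → (δ +ᴳ -ᴳ ε) *ᴳ α ≡ δ *ᴳ α +ᴳ -ᴳ (ε *ᴳ α)
  distribʳ = RingSolver.solve-∀ ℤ[i]-solverRing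

-- Take q as the floor of (2 u + n) / (2 n), which is u / n rounded. The remainder r satisfies 0 ≤ r
-- < 2 n, and 2 (u - q n) = r - n.
nearest-multiple : ∀ u n → 1 ≤ n → ∃ λ q → 2 * ℤ.∣ u ℤ.- q ℤ.* ℤ.+ n ∣ ≤ n
nearest-multiple u (suc n-1) _ = q , subst (_≤ n) (trans (cong ℤ.∣_∣ (sym doubled)) (ℤₚ.∣i*j∣≡∣i∣*∣j∣ (ℤ.+ 2) (u ℤ.- q ℤ.* ℤ.+ n))) (distance (≤-total r n))
  where
  n d r : ℕ
  n = suc n-1
  d = n + n
  x q : ℤ
  x = ℤ.+ 2 ℤ.* u ℤ.+ ℤ.+ n
  r = x ℤ/.%ℕ d
  q = x ℤ/./ℕ d
  r<d : r < d
  r<d = ℤ/.n%ℕd<d x d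
  doubled : ℤ.+ 2 ℤ.* (u ℤ.- q ℤ.* ℤ.+ n) ≡ r ℤ.⊖ n
  doubled = begin
    ℤ.+ 2 ℤ.* (u ℤ.- q ℤ.* ℤ.+ n)               ≡⟨ e₁ u q (ℤ.+ n) ⟩
    x ℤ.- q ℤ.* (ℤ.+ n ℤ.+ ℤ.+ n) ℤ.- ℤ.+ n     ≡⟨ cong (λ z → x ℤ.- q ℤ.* z ℤ.- ℤ.+ n) (sym (ℤₚ.pos-+ n n)) ⟩
    x ℤ.- q ℤ.* ℤ.+ d ℤ.- ℤ.+ n                 ≡⟨ cong (λ z → z ℤ.- q ℤ.* ℤ.+ d ℤ.- ℤ.+ n) (ℤ/.a≡a%ℕn+[a/ℕn]*n x d) ⟩
    ℤ.+ r ℤ.+ q ℤ.* ℤ.+ d ℤ.- q ℤ.* ℤ.+ d ℤ.- ℤ.+ n ≡⟨ e₂ (ℤ.+ r) (q ℤ.* ℤ.+ d) (ℤ.+ n) ⟩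
    ℤ.+ r ℤ.- ℤ.+ n                             ≡⟨ ℤₚ.m-n≡m⊖n r n ⟩
    r ℤ.⊖ n ∎
    where
    open ≡-Reasoning
    e₁ : ∀ u q n → ℤ.+ 2 ℤ.* (u ℤ.- q ℤ.* n) ≡ ℤ.+ 2 ℤ.* u ℤ.+ n ℤ.- q ℤ.* (n ℤ.+ n) ℤ.- n
    e₁ = ℤ-Solver.solve-∀
    e₂ : ∀ r t n → r ℤ.+ t ℤ.- t ℤ.- n ≡ r ℤ.- n
    e₂ = ℤ-Solver.solve-∀
  distance : r ≤ n ⊎ n ≤ r → ℤ.∣ r ℤ.⊖ n ∣ ≤ n
  distance (inj₁ r≤n) = subst (_≤ n) (sym (trans (cong ℤ.∣_∣ (ℤₚ.⊖-≤ r≤n)) (ℤₚ.∣-i∣≡∣i∣ (ℤ.+ (n ∸ r))))) (m∸n≤m n r)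
  distance (inj₂ n≤r) = subst (_≤ n) (sym (cong ℤ.∣_∣ (ℤₚ.⊖-≥ n≤r))) (m≤n+o⇒m∸n≤o r n (<⇒≤ r<d))

-- Rounding both coordinates of α / β leaves an error of norm at most 1/2.
division : ∀ α β → 1 ≤ norm β → ∃₂ λ q r → α ≡ q *ᴳ β +ᴳ r × norm r < norm β
division α β 1≤N = q , r , rearrange α (q *ᴳ β) , ≰⇒> small
  where
  w = α *ᴳ conj β
  N = norm β
  u v : ℤ
  u = ℤ[i].re w
  v = ℤ[i].im w
  q₁ = nearest-multiple u N 1≤N
  q₂ = nearest-multiple v N 1≤N
  q r : ℤ[i]
  q = proj₁ q₁ + proj₁ q₂ i
  r = α +ᴳ -ᴳ (q *ᴳ β)
  rearrange : ∀ α β → α ≡ β +ᴳ (α +ᴳ -ᴳ β)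
  rearrange = RingSolver.solve-∀ ℤ[i]-solverRing
  x y : ℤ
  x = u ℤ.- proj₁ q₁ ℤ.* ℤ.+ N
  y = v ℤ.- proj₁ q₂ ℤ.* ℤ.+ N
  rconj : r *ᴳ conj β ≡ x + y i
  rconj = begin
    r *ᴳ conj β                            ≡⟨ e₁ α q β (conj β) ⟩
    w +ᴳ -ᴳ (q *ᴳ (conj β *ᴳ β))           ≡⟨ cong (λ z → w +ᴳ -ᴳ (q *ᴳ z)) (conj-*ᴳ β) ⟩
    w +ᴳ -ᴳ (q *ᴳ ℕ→ℤ[i] N)                ≡⟨ cong₂ _+_i (cong (λ z → u ℤ.+ ℤ.- z) (e₂ (proj₁ q₁) (proj₁ q₂) (ℤ.+ N))) (cong (λ z → v ℤ.+ ℤ.- z) (e₃ (proj₁ q₁) (proj₁ q₂) (ℤ.+ N))) ⟩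
    x + y i ∎
    where
    open ≡-Reasoning
    e₁ : ∀ α q β γ → (α +ᴳ -ᴳ (q *ᴳ β)) *ᴳ γ ≡ α *ᴳ γ +ᴳ -ᴳ (q *ᴳ (γ *ᴳ β))
    e₁ = RingSolver.solve-∀ ℤ[i]-solverRing
    e₂ : ∀ a b n → a ℤ.* n ℤ.- b ℤ.* ℤ.0ℤ ≡ a ℤ.* n
    e₂ = ℤ-Solver.solve-∀
    e₃ : ∀ a b n → a ℤ.* ℤ.0ℤ ℤ.+ b ℤ.* n ≡ b ℤ.* n
    e₃ = ℤ-Solver.solve-∀
  small : ¬ N ≤ norm r
  small N≤ = <⇒≱ (*-monoʳ-< (N * N) {{>-nonZero (*-mono-≤ 1≤N 1≤N)}} {2} {4} (s≤s (s≤s (s≤s z≤n)))) (begin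
    N * N * 4                            ≤⟨ *-monoˡ-≤ 4 (*-monoˡ-≤ N N≤) ⟩
    norm r * N * 4                       ≡⟨ cong (λ z → norm r * z * 4) (sym (norm-conj β)) ⟩
    norm r * norm (conj β) * 4           ≡⟨ cong (_* 4) (sym (norm-* r (conj β))) ⟩
    norm (r *ᴳ conj β) * 4               ≡⟨ cong (λ z → norm z * 4) rconj ⟩
    (ℤ.∣ x ∣ ^ 2 + ℤ.∣ y ∣ ^ 2) * 4      ≡⟨ e₄ ℤ.∣ x ∣ ℤ.∣ y ∣ ⟩
    2 * ℤ.∣ x ∣ * (2 * ℤ.∣ x ∣) + 2 * ℤ.∣ y ∣ * (2 * ℤ.∣ y ∣)
      ≤⟨ +-mono-≤ (*-mono-≤ (proj₂ q₁) (proj₂ q₁)) (*-mono-≤ (proj₂ q₂) (proj₂ q₂)) ⟩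
    N * N + N * N                        ≡⟨ e₅ (N * N) ⟩
    N * N * 2 ∎)
    where
    open ≤-Reasoning
    e₄ : ∀ x y → (x * (x * 1) + y * (y * 1)) * 4 ≡ 2 * x * (2 * x) + 2 * y * (2 * y)
    e₄ = ℕ-Solver.solve-∀
    e₅ : ∀ n → n + n ≡ n * 2
    e₅ = ℕ-Solver.solve-∀

Bezout : ℤ[i] → ℤ[i] → Set
Bezout α β = ∃ λ δ → δ ∣ᴳ α × δ ∣ᴳ β × ∃₂ λ u v → δ ≡ u *ᴳ α +ᴳ v *ᴳ β

bezout-zero : ∀ α → Bezout α 0ᴳ
bezout-zero α = α , ∣ᴳ-refl , 0ᴳ by *ᴳ-zeroˡ α , 1ᴳ , 0ᴳ ,
  sym (trans (cong₂ _+ᴳ_ (*ᴳ-identityˡ α) (*ᴳ-zeroˡ 0ᴳ)) (+ᴳ-identityʳ α))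

bezout-step : ∀ α β q r → α ≡ q *ᴳ β +ᴳ r → Bezout β r → Bezout α β
bezout-step α β q r α≡ (δ , δ∣β , δ∣r , u , v , δ≡) = δ
  , subst (δ ∣ᴳ_) (sym α≡) (∣ᴳ-+ (∣ᴳ-*ˡ q δ∣β) δ∣r) , δ∣β
  , v , u +ᴳ -ᴳ (v *ᴳ q)
  , trans δ≡ (trans (regroup u v q β r) (cong (λ z → v *ᴳ z +ᴳ (u +ᴳ -ᴳ (v *ᴳ q)) *ᴳ β) (sym α≡)))
  where
  regroup : ∀ u v q β r → u *ᴳ β +ᴳ v *ᴳ r ≡ v *ᴳ (q *ᴳ β +ᴳ r) +ᴳ (u +ᴳ -ᴳ (v *ᴳ q)) *ᴳ β
  regroup = RingSolver.solve-∀ ℤ[i]-solverRing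

bezout : ∀ α β → Bezout α β
bezout α β = go α β (<-wellFounded (norm β))
  where
  go : ∀ α β → Acc _<_ (norm β) → Bezout α β
  go α β (acc rec) = choose (β ≟ᴳ 0ᴳ)
    where
    divide : (∃₂ λ q r → α ≡ q *ᴳ β +ᴳ r × norm r < norm β) → Bezout α β
    divide (q , r , α≡ , r<β) = bezout-step α β q r α≡ (go β r (rec r<β))
    choose : Dec (β ≡ 0ᴳ) → Bezout α β
    choose (yes β≡0) = subst (Bezout α) (sym β≡0) (bezout-zero α)
    choose (no β≢0)  = divide (division α β (≢0⇒1≤norm β β≢0))

-- Units, associates and quadrant representatives

unit⇒norm≡1 : ∀ {ε} → ε ∈ units → norm ε ≡ 1
unit⇒norm≡1 (here refl)                         = refl
unit⇒norm≡1 (there (here refl))                 = refl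
unit⇒norm≡1 (there (there (here refl)))         = refl
unit⇒norm≡1 (there (there (there (here refl)))) = refl

norm≡1⇒unit : ∀ ε → norm ε ≡ 1 → ε ∈ units
norm≡1⇒unit (ℤ.+ 0 + ℤ.+ 1 i)                  _ = there (there (here refl))
norm≡1⇒unit (ℤ.+ 0 + ℤ.-[1+ 0 ] i)             _ = there (there (there (here refl)))
norm≡1⇒unit (ℤ.+ 1 + ℤ.+ 0 i)                  _ = here refl
norm≡1⇒unit (ℤ.-[1+ 0 ] + ℤ.+ 0 i)             _ = there (here refl)
norm≡1⇒unit (ℤ.+ 0 + ℤ.+ 0 i)                  ()
norm≡1⇒unit (ℤ.+ 0 + ℤ.+ (suc (suc _)) i)      ()
norm≡1⇒unit (ℤ.+ 0 + ℤ.-[1+ suc _ ] i)         ()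
norm≡1⇒unit (ℤ.+ 1 + ℤ.+ (suc _) i)            ()
norm≡1⇒unit (ℤ.+ 1 + ℤ.-[1+ _ ] i)             ()
norm≡1⇒unit (ℤ.+ (suc (suc _)) + _ i)          ()
norm≡1⇒unit (ℤ.-[1+ 0 ] + ℤ.+ (suc _) i)       ()
norm≡1⇒unit (ℤ.-[1+ 0 ] + ℤ.-[1+ _ ] i)        ()
norm≡1⇒unit (ℤ.-[1+ suc _ ] + _ i)             ()

associated⁺ : ∀ {α β} ε → norm ε ≡ 1 → α ≡ ε *ᴳ β → Associated α β
associated⁺ {α} {β} ε N≡1 e = Any.map (λ ε≡ → trans e (cong (_*ᴳ β) ε≡)) (norm≡1⇒unit ε N≡1)

associated⁻ : ∀ {α β} → Associated α β → ∃ λ ε → norm ε ≡ 1 × α ≡ ε *ᴳ β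
associated⁻ a = let ε , ε∈ , e = find a in ε , unit⇒norm≡1 ε∈ , e

conj-inverse : ∀ ε → norm ε ≡ 1 → conj ε *ᴳ ε ≡ 1ᴳ
conj-inverse ε N≡1 = trans (conj-*ᴳ ε) (cong ℕ→ℤ[i] N≡1)

conj-cancel : ∀ ε α → norm ε ≡ 1 → conj ε *ᴳ (ε *ᴳ α) ≡ α
conj-cancel ε α N≡1 = trans (sym (*ᴳ-assoc (conj ε) ε α)) (trans (cong (_*ᴳ α) (conj-inverse ε N≡1)) (*ᴳ-identityˡ α))

associated-refl : ∀ {α} → Associated α α
associated-refl {α} = here (sym (*ᴳ-identityˡ α))

associated-sym : ∀ {α β} → Associated α β → Associated β α
associated-sym {α} {β} a = let ε , N≡1 , e = associated⁻ a in
  associated⁺ (conj ε) (trans (norm-conj ε) N≡1) (sym (trans (cong (conj ε *ᴳ_) e) (conj-cancel ε β N≡1)))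

associated-trans : ∀ {α β γ} → Associated α β → Associated β γ → Associated α γ
associated-trans {α} {β} {γ} a b =
  let ε , Nε , e = associated⁻ a
      η , Nη , f = associated⁻ b
  in associated⁺ (ε *ᴳ η) (trans (norm-* ε η) (cong₂ _*_ Nε Nη)) (trans e (trans (cong (ε *ᴳ_) f) (sym (*ᴳ-assoc ε η γ))))

associated-norm : ∀ {α β} → Associated α β → norm α ≡ norm β
associated-norm {α} {β} a = let ε , N≡1 , e = associated⁻ a in
  trans (cong norm e) (trans (norm-* ε β) (trans (cong (_* norm β) N≡1) (*-identityˡ (norm β))))

associated-∣ : ∀ {α β} → Associated α β → β ∣ᴳ α
associated-∣ a = let ε , _ , e = associated⁻ a in ε by sym e

∣ᴳ-associated : ∀ {α β} → 1 ≤ norm α → α ∣ᴳ β → norm β ≡ norm α → Associated β α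
∣ᴳ-associated {α} {β} 1≤ (γ by e) N≡ = associated⁺ γ
  (*-cancelʳ-≡ (norm γ) 1 (norm α) {{>-nonZero 1≤}} (trans (sym (norm-* γ α)) (trans (cong norm e) (trans N≡ (sym (*-identityˡ (norm α))))))) (sym e)

associated-*ˡ : ∀ γ {α β} → Associated α β → Associated (γ *ᴳ α) (γ *ᴳ β)
associated-*ˡ γ {α} {β} a = let ε , N≡1 , e = associated⁻ a in
  associated⁺ ε N≡1 (trans (cong (γ *ᴳ_) e) (swap γ ε β))
  where
  swap : ∀ γ ε β → γ *ᴳ (ε *ᴳ β) ≡ ε *ᴳ (γ *ᴳ β)
  swap = RingSolver.solve-∀ ℤ[i]-solverRing

associated-*ʳ : ∀ γ {α β} → Associated α β → Associated (α *ᴳ γ) (β *ᴳ γ)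
associated-*ʳ γ {α} {β} a = subst₂ Associated (*ᴳ-comm γ α) (*ᴳ-comm γ β) (associated-*ˡ γ a)

associated-cancelˡ : ∀ γ {α β} → 1 ≤ norm γ → Associated (γ *ᴳ α) (γ *ᴳ β) → Associated α β
associated-cancelˡ γ {α} {β} 1≤ a = let ε , N≡1 , e = associated⁻ a in
  associated⁺ ε N≡1 (*ᴳ-cancelˡ γ α (ε *ᴳ β) 1≤ (trans e (swap γ ε β)))
  where
  swap : ∀ γ ε β → ε *ᴳ (γ *ᴳ β) ≡ γ *ᴳ (ε *ᴳ β)
  swap = RingSolver.solve-∀ ℤ[i]-solverRing

Quadrant : ℤ[i] → Set
Quadrant α = ∃₂ λ x y → α ≡ (ℤ.+ suc x) + (ℤ.+ y) i

-1ᴳ iᴳ -iᴳ : ℤ[i]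
-1ᴳ = ℤ.-1ℤ + ℤ.0ℤ i
iᴳ  = ℤ.0ℤ + ℤ.1ℤ i
-iᴳ = ℤ.0ℤ + ℤ.-1ℤ i

-1ᴳ-*ᴳ : ∀ a b → -1ᴳ *ᴳ (a + b i) ≡ (ℤ.- a) + (ℤ.- b) i
-1ᴳ-*ᴳ a b = cong₂ _+_i (real a b) (imaginary a b)
  where
  real : ∀ a b → ℤ.-1ℤ ℤ.* a ℤ.- ℤ.0ℤ ℤ.* b ≡ ℤ.- a
  real = ℤ-Solver.solve-∀
  imaginary : ∀ a b → ℤ.-1ℤ ℤ.* b ℤ.+ ℤ.0ℤ ℤ.* a ≡ ℤ.- b
  imaginary = ℤ-Solver.solve-∀

iᴳ-*ᴳ : ∀ a b → iᴳ *ᴳ (a + b i) ≡ (ℤ.- b) + a i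
iᴳ-*ᴳ a b = cong₂ _+_i (real a b) (imaginary a b)
  where
  real : ∀ a b → ℤ.0ℤ ℤ.* a ℤ.- ℤ.1ℤ ℤ.* b ≡ ℤ.- b
  real = ℤ-Solver.solve-∀
  imaginary : ∀ a b → ℤ.0ℤ ℤ.* b ℤ.+ ℤ.1ℤ ℤ.* a ≡ a
  imaginary = ℤ-Solver.solve-∀

-iᴳ-*ᴳ : ∀ a b → -iᴳ *ᴳ (a + b i) ≡ b + (ℤ.- a) i
-iᴳ-*ᴳ a b = cong₂ _+_i (real a b) (imaginary a b)
  where
  real : ∀ a b → ℤ.0ℤ ℤ.* a ℤ.- ℤ.-1ℤ ℤ.* b ≡ b
  real = ℤ-Solver.solve-∀
  imaginary : ∀ a b → ℤ.0ℤ ℤ.* b ℤ.+ ℤ.-1ℤ ℤ.* a ≡ ℤ.- a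
  imaginary = ℤ-Solver.solve-∀

quadrant-representative : ∀ α → 1 ≤ norm α → ∃ λ ρ → Quadrant ρ × Associated ρ α
quadrant-representative (ℤ.+ suc x + ℤ.+ y i)           _ = _ , (x , y , refl) , associated-refl
quadrant-representative (ℤ.+ 0 + ℤ.+ suc y i)           _ = _ , (y , 0 , refl) , associated⁺ -iᴳ refl (sym (-iᴳ-*ᴳ (ℤ.+ 0) (ℤ.+ suc y)))
quadrant-representative (ℤ.-[1+ x ] + ℤ.+ suc y i)      _ = _ , (y , suc x , refl) , associated⁺ -iᴳ refl (sym (-iᴳ-*ᴳ ℤ.-[1+ x ] (ℤ.+ suc y)))
quadrant-representative (ℤ.-[1+ x ] + ℤ.+ 0 i)          _ = _ , (x , 0 , refl) , associated⁺ -1ᴳ refl (sym (-1ᴳ-*ᴳ ℤ.-[1+ x ] (ℤ.+ 0)))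
quadrant-representative (ℤ.-[1+ x ] + ℤ.-[1+ y ] i)     _ = _ , (x , suc y , refl) , associated⁺ -1ᴳ refl (sym (-1ᴳ-*ᴳ ℤ.-[1+ x ] ℤ.-[1+ y ]))
quadrant-representative (ℤ.+ x + ℤ.-[1+ y ] i)          _ = _ , (y , x , refl) , associated⁺ iᴳ refl (sym (iᴳ-*ᴳ (ℤ.+ x) ℤ.-[1+ y ]))
quadrant-representative (ℤ.+ 0 + ℤ.+ 0 i)               ()

re-im : ∀ {a b c d} → a + b i ≡ c + d i → a ≡ c × b ≡ d
re-im refl = refl , refl

-- Each unit other than 1 rotates the region x > 0, y ≥ 0 off itself: -1 and i make the real part
-- nonpositive, and -i makes the imaginary part negative.
quadrant-unique : ∀ {α β} → Quadrant α → Quadrant β → Associated α β → α ≡ β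
quadrant-unique {β = β} _ _ (here e) = trans e (*ᴳ-identityˡ β)
quadrant-unique (x , y , refl) (x′ , y′ , refl) (there (here e)) =
  ⊥-elim (negative (proj₁ (re-im (trans e (-1ᴳ-*ᴳ (ℤ.+ suc x′) (ℤ.+ y′))))))
  where
  negative : ℤ.+ suc x ≡ ℤ.- (ℤ.+ suc x′) → ⊥
  negative ()
quadrant-unique (x , y , refl) (x′ , y′ , refl) (there (there (here e))) =
  ⊥-elim (negative y′ (proj₁ (re-im (trans e (iᴳ-*ᴳ (ℤ.+ suc x′) (ℤ.+ y′))))))
  where
  negative : ∀ y′ → ℤ.+ suc x ≡ ℤ.- (ℤ.+ y′) → ⊥
  negative zero    ()
  negative (suc _) ()
quadrant-unique (x , y , refl) (x′ , y′ , refl) (there (there (there (here e)))) =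
  ⊥-elim (negative (proj₂ (re-im (trans e (-iᴳ-*ᴳ (ℤ.+ suc x′) (ℤ.+ y′))))))
  where
  negative : ℤ.+ y ≡ ℤ.- (ℤ.+ suc x′) → ⊥
  negative ()

∈-representatives⁻ : ∀ {n α} → α ∈ representatives n → Quadrant α
∈-representatives⁻ {n} α∈ =
  let x , y , x∈ , _ , e = ∈-cartesianProductWith⁻ (λ x y → (ℤ.+ x) + (ℤ.+ y) i) (map suc (upTo n)) (upTo (suc n)) α∈
      x′ , _ , x≡ = ∈-map⁻ suc x∈
  in x′ , y , trans e (cong (λ z → (ℤ.+ z) + (ℤ.+ y) i) x≡)

square-reflects-≤ : ∀ {m n} → m * (m * 1) ≤ n * n → m ≤ n
square-reflects-≤ {m} {n} le = ≮⇒≥ λ n<m → <⇒≱ (*-mono-< n<m (subst (n <_) (sym (*-identityʳ m)) n<m)) le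

∈-representatives⁺ : ∀ {n α} → Quadrant α → norm α ≤ n * n → α ∈ representatives n
∈-representatives⁺ {n} {α} (x , y , α≡) bounded = subst (_∈ representatives n) (sym α≡)
  (∈-cartesianProductWith⁺ (λ x y → (ℤ.+ x) + (ℤ.+ y) i) (∈-map⁺ suc (∈-upTo⁺ x<n)) (∈-upTo⁺ (s≤s y≤n)))
  where
  bounded′ : suc x ^ 2 + y ^ 2 ≤ n * n
  bounded′ = subst (λ z → norm z ≤ n * n) α≡ bounded
  x<n : x < n
  x<n = square-reflects-≤ (≤-trans (m≤m+n (suc x ^ 2) (y ^ 2)) bounded′)
  y≤n : y ≤ n
  y≤n = square-reflects-≤ (≤-trans (m≤n+m (y ^ 2) (suc x ^ 2)) bounded′)

representatives-unique : ∀ n → Unique (representatives n)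
representatives-unique n = Unique.cartesianProductWith⁺ (λ x y → (ℤ.+ x) + (ℤ.+ y) i)
  (λ e → ℤₚ.+-injective (proj₁ (re-im e)) , ℤₚ.+-injective (proj₂ (re-im e)))
  (Unique.map⁺ suc-injective (Unique.upTo⁺ n)) (Unique.upTo⁺ (suc n))

-- Gaussian primes and factorisation

ProperDivisor : ℤ[i] → ℤ[i] → Set
ProperDivisor α β = β ∣ᴳ α × 1 < norm β × norm β < norm α

_∣ᴳ?_ : ∀ {β} → 1 ≤ norm β → ∀ α → Dec (β ∣ᴳ α)
_∣ᴳ?_ {β} 1≤β α = decide (division α β 1≤β)
  where
  decide : (∃₂ λ q r → α ≡ q *ᴳ β +ᴳ r × norm r < norm β) → Dec (β ∣ᴳ α)
  decide (q , r , α≡ , r<β) = by-remainder (r ≟ᴳ 0ᴳ)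
    where
    isolate : ∀ q r → (q +ᴳ r) +ᴳ -ᴳ q ≡ r
    isolate = RingSolver.solve-∀ ℤ[i]-solverRing
    by-remainder : Dec (r ≡ 0ᴳ) → Dec (β ∣ᴳ α)
    by-remainder (yes r≡0) = yes (q by sym (trans α≡ (trans (cong (q *ᴳ β +ᴳ_) r≡0) (trans (+ᴳ-comm (q *ᴳ β) 0ᴳ) (+ᴳ-identityˡ (q *ᴳ β))))))
    by-remainder (no r≢0)  = no λ β∣α → <⇒≱ r<β (norm-∣-≤ (≢0⇒1≤norm r r≢0)
      (subst (β ∣ᴳ_) (trans (cong (_+ᴳ -ᴳ (q *ᴳ β)) α≡) (isolate (q *ᴳ β) r)) (∣ᴳ-minus β∣α (q by refl))))

properDivisor? : ∀ α β → Dec (ProperDivisor α β)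
properDivisor? α β = decide (1 <? norm β)
  where
  decide : Dec (1 < norm β) → Dec (ProperDivisor α β)
  decide (yes 1<) = ((<⇒≤ 1<) ∣ᴳ? α) ×-dec (yes 1<) ×-dec (norm β <? norm α)
  decide (no 1≮)  = no λ (_ , 1< , _) → 1≮ 1<

-- A proper divisor may be replaced by its quadrant representative, whose norm is below norm α ≤
-- (norm α)², so searching a finite box decides irreducibility.
search-divisor : ∀ α → (∃ λ β → ProperDivisor α β) ⊎ (∀ β → ¬ ProperDivisor α β)
search-divisor α = decide (any? (properDivisor? α) (representatives (norm α)))
  where
  decide : Dec (Any (ProperDivisor α) (representatives (norm α))) → (∃ λ β → ProperDivisor α β) ⊎ (∀ β → ¬ ProperDivisor α β)
  decide (yes found)  = let β , _ , proper = find found in inj₁ (β , proper)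
  decide (no missing) = inj₂ λ β (β∣α , 1< , <α) →
    let ρ , quadrant , ρ~β = quadrant-representative β (<⇒≤ 1<)
        N≡ = associated-norm ρ~β
        1<α = ≤-trans (s≤s z≤n) <α
    in missing (lose (∈-representatives⁺ {norm α} quadrant (≤-trans (≤-reflexive N≡) (≤-trans (<⇒≤ <α) (m≤m*n (norm α) (norm α) {{>-nonZero 1<α}}))))
         (∣ᴳ-trans (associated-∣ (associated-sym ρ~β)) β∣α , subst (1 <_) (sym N≡) 1< , subst (_< norm α) (sym N≡) <α))

-- `GaussianPrime` is primality in the sense of Euclid's lemma. For δ = gcd (π , x) as a combination
-- of π and x, either δ is a unit, and π divides δ y and so y, or δ is associated to π and divides
-- x. Any other norm would make δ a proper divisor.
no-proper-divisor⇒prime : ∀ π → 1 < norm π → (∀ β → ¬ ProperDivisor π β) → GaussianPrime π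
no-proper-divisor⇒prime π 1<π none = mkPrime
  (1≤norm⇒≢0 π (<⇒≤ 1<π)) (λ π∣1 → <⇒≱ 1<π (norm-∣-≤ {π} {1ᴳ} ≤-refl π∣1)) (λ {x} {y} → split x y (bezout π x))
  where
  1≤π = <⇒≤ 1<π
  split : ∀ x y → Bezout π x → π ∣ᴳ (x *ᴳ y) → π ∣ᴳ x ⊎ π ∣ᴳ y
  split x y (δ , δ∣π , δ∣x , u , v , δ≡) π∣xy = by-norm (m≤n⇒m<n∨m≡n (norm-∣-≤ 1≤π δ∣π)) (norm δ) refl
    where
    1≤δ : 1 ≤ norm δ
    1≤δ = ≢0⇒1≤norm δ λ δ≡0 → 1≤norm⇒≢0 π 1≤π (let (γ by e) = δ∣π in trans (sym e) (trans (cong (γ *ᴳ_) δ≡0) (zeroʳ γ)))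
      where
      zeroʳ : ∀ γ → γ *ᴳ 0ᴳ ≡ 0ᴳ
      zeroʳ γ = trans (*ᴳ-comm γ 0ᴳ) (norm≡0⇒≡0 (0ᴳ *ᴳ γ) (norm-* 0ᴳ γ))
    expand : ∀ u v π x y → (u *ᴳ π +ᴳ v *ᴳ x) *ᴳ y ≡ (u *ᴳ y) *ᴳ π +ᴳ v *ᴳ (x *ᴳ y)
    expand = RingSolver.solve-∀ ℤ[i]-solverRing
    π∣δy : π ∣ᴳ (δ *ᴳ y)
    π∣δy = subst (π ∣ᴳ_) (sym (trans (cong (_*ᴳ y) δ≡) (expand u v π x y))) (∣ᴳ-+ ((u *ᴳ y) by refl) (∣ᴳ-*ˡ v π∣xy))
    by-norm : norm δ < norm π ⊎ norm δ ≡ norm π → ∀ n → norm δ ≡ n → π ∣ᴳ x ⊎ π ∣ᴳ y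
    by-norm _ zero N≡0 = ⊥-elim (<⇒≢ 1≤δ (sym N≡0))
    by-norm _ 1    N≡1 = inj₂ (subst (π ∣ᴳ_) (conj-cancel δ y N≡1) (∣ᴳ-*ˡ (conj δ) π∣δy))
    by-norm (inj₁ <π) (suc (suc n)) N≡ = ⊥-elim (none δ (δ∣π , subst (1 <_) (sym N≡) (s≤s (s≤s z≤n)) , <π))
    by-norm (inj₂ ≡π) (suc (suc n)) N≡ = inj₁ (∣ᴳ-trans (associated-∣ (associated-sym (∣ᴳ-associated 1≤δ δ∣π (sym ≡π)))) δ∣x)

prime-divisor : ∀ α → 1 < norm α → ∃ λ π → GaussianPrime π × π ∣ᴳ α
prime-divisor α 1<α = go α 1<α (<-wellFounded (norm α))
  where
  go : ∀ α → 1 < norm α → Acc _<_ (norm α) → ∃ λ π → GaussianPrime π × π ∣ᴳ α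
  go α 1<α (acc rec) = choose (search-divisor α)
    where
    choose : (∃ λ β → ProperDivisor α β) ⊎ (∀ β → ¬ ProperDivisor α β) → ∃ λ π → GaussianPrime π × π ∣ᴳ α
    choose (inj₁ (β , β∣α , 1<β , β<α)) = let π , prime , π∣β = go β 1<β (rec β<α) in π , prime , ∣ᴳ-trans π∣β β∣α
    choose (inj₂ none)                  = α , no-proper-divisor⇒prime α 1<α none , ∣ᴳ-refl

prime⇒2≤norm : ∀ {π} → GaussianPrime π → 2 ≤ norm π
prime⇒2≤norm {π} prime = by-norm (norm π) refl
  where
  by-norm : ∀ n → norm π ≡ n → 2 ≤ norm π
  by-norm 0             e = ⊥-elim (p≉0 prime (norm≡0⇒≡0 π e))
  by-norm 1             e = ⊥-elim (p∤1 prime (conj π by conj-inverse π e))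
  by-norm (suc (suc n)) e = subst (2 ≤_) (sym e) (s≤s (s≤s z≤n))

prime⇒1≤norm : ∀ {π} → GaussianPrime π → 1 ≤ norm π
prime⇒1≤norm prime = <⇒≤ (prime⇒2≤norm prime)

1≤norm-*ʳ : ∀ α β → 1 ≤ norm (α *ᴳ β) → 1 ≤ norm β
1≤norm-*ʳ α β 1≤ = n≢0⇒n>0 λ e → <⇒≢ 1≤ (sym (trans (norm-* α β) (trans (cong (norm α *_) e) (*-zeroʳ (norm α)))))

norm-quotient-< : ∀ γ π → GaussianPrime π → 1 ≤ norm γ → norm γ < norm (γ *ᴳ π)
norm-quotient-< γ π prime 1≤γ = subst (norm γ <_) (sym (norm-* γ π)) (m<m*n (norm γ) (norm π) {{>-nonZero 1≤γ}} (prime⇒2≤norm prime))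

primes-∣⇒associated : ∀ {π ρ} → GaussianPrime π → GaussianPrime ρ → π ∣ᴳ ρ → Associated ρ π
primes-∣⇒associated {π} {ρ} primeπ primeρ π∣ρ@(γ by e) = choose (split-∣ primeρ {γ} {π} (subst (ρ ∣ᴳ_) (sym e) ∣ᴳ-refl))
  where
  1≤γ : 1 ≤ norm γ
  1≤γ = 1≤norm-*ʳ π γ (subst (λ z → 1 ≤ norm z) (trans (sym e) (*ᴳ-comm γ π)) (prime⇒1≤norm primeρ))
  choose : ρ ∣ᴳ γ ⊎ ρ ∣ᴳ π → Associated ρ π
  choose (inj₁ ρ∣γ) = ⊥-elim (<⇒≱ (subst (λ z → norm γ < norm z) e (norm-quotient-< γ π primeπ 1≤γ)) (norm-∣-≤ 1≤γ ρ∣γ))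
  choose (inj₂ ρ∣π) = ∣ᴳ-associated (prime⇒1≤norm primeπ) π∣ρ
    (≤-antisym (norm-∣-≤ (prime⇒1≤norm primeπ) ρ∣π) (norm-∣-≤ (prime⇒1≤norm primeρ) π∣ρ))

PrimePowers : List (ℤ[i] × ℕ) → Set
PrimePowers 𝔭as = All (λ (𝔭 , a) → GaussianPrime 𝔭 × NonZero a) 𝔭as × AllPairs (λ (𝔭 , _) (𝔮 , _) → ¬ Associated 𝔭 𝔮) 𝔭as

∏^ : List (ℤ[i] × ℕ) → ℤ[i]
∏^ 𝔭as = ∏ᴳ (map (λ (𝔭 , a) → 𝔭 ^ᴳ a) 𝔭as)

prime-power-part : ∀ {π α} → GaussianPrime π → 1 ≤ norm α → ∃₂ λ a β → α ≡ (π ^ᴳ a) *ᴳ β × ¬ (π ∣ᴳ β)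
prime-power-part {π} {α} prime 1≤α = go α 1≤α (<-wellFounded (norm α))
  where
  go : ∀ α → 1 ≤ norm α → Acc _<_ (norm α) → ∃₂ λ a β → α ≡ (π ^ᴳ a) *ᴳ β × ¬ (π ∣ᴳ β)
  go α 1≤α (acc rec) = choose (prime⇒1≤norm prime ∣ᴳ? α)
    where
    regroup : ∀ p β π → (p *ᴳ β) *ᴳ π ≡ (π *ᴳ p) *ᴳ β
    regroup = RingSolver.solve-∀ ℤ[i]-solverRing
    choose : Dec (π ∣ᴳ α) → ∃₂ λ a β → α ≡ (π ^ᴳ a) *ᴳ β × ¬ (π ∣ᴳ β)
    choose (no π∤α)         = 0 , α , sym (*ᴳ-identityˡ α) , π∤α
    choose (yes (γ by e)) =
      let 1≤γ = 1≤norm-*ʳ π γ (subst (λ z → 1 ≤ norm z) (trans (sym e) (*ᴳ-comm γ π)) 1≤α)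
          a , β , γ≡ , π∤β = go γ 1≤γ (rec (subst (λ z → norm γ < norm z) e (norm-quotient-< γ π prime 1≤γ)))
      in suc a , β , trans (sym e) (trans (cong (_*ᴳ π) γ≡) (regroup (π ^ᴳ a) β π)) , π∤β

∣ᴳ-∏^ : ∀ {𝔭as} → PrimePowers 𝔭as → All (λ (𝔭 , _) → 𝔭 ∣ᴳ ∏^ 𝔭as) 𝔭as
∣ᴳ-∏^ {[]}                  _ = []
∣ᴳ-∏^ {(𝔭 , suc a) ∷ 𝔭as} (_ ∷ primes , _ ∷ distinct) =
  (((𝔭 ^ᴳ a) *ᴳ ∏^ 𝔭as) by regroup (𝔭 ^ᴳ a) (∏^ 𝔭as) 𝔭) ∷ All.map (∣ᴳ-*ˡ (𝔭 ^ᴳ suc a)) (∣ᴳ-∏^ (primes , distinct))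
  where
  regroup : ∀ p β π → (p *ᴳ β) *ᴳ π ≡ (π *ᴳ p) *ᴳ β
  regroup = RingSolver.solve-∀ ℤ[i]-solverRing

-- Removing the full power of a prime π at once leaves a cofactor that π does not divide, so no
-- prime of the cofactor is associated to π.
factorisationᴳ : ∀ α → 1 ≤ norm α → ∃₂ λ ε 𝔭as → ε ∈ units × PrimePowers 𝔭as × α ≡ ε *ᴳ ∏^ 𝔭as
factorisationᴳ α 1≤α = go α 1≤α (<-wellFounded (norm α))
  where
  Factorisation : ℤ[i] → Set
  Factorisation α = ∃₂ λ ε 𝔭as → ε ∈ units × PrimePowers 𝔭as × α ≡ ε *ᴳ ∏^ 𝔭as
  go : ∀ α → 1 ≤ norm α → Acc _<_ (norm α) → Factorisation α
  go α 1≤α (acc rec) = choose (m≤n⇒m<n∨m≡n 1≤α)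
    where
    divide : ∀ {π} → GaussianPrime π → π ∣ᴳ α → (∃₂ λ a β → α ≡ (π ^ᴳ a) *ᴳ β × ¬ (π ∣ᴳ β)) → Factorisation α
    divide prime π∣α (zero  , β , α≡ , π∤β) = ⊥-elim (π∤β (subst (_ ∣ᴳ_) (trans α≡ (*ᴳ-identityˡ β)) π∣α))
    divide {π} prime π∣α (suc a , β , α≡ , π∤β) =
      let 1≤β = 1≤norm-*ʳ (π ^ᴳ suc a) β (subst (λ z → 1 ≤ norm z) α≡ 1≤α)
          γ = (π ^ᴳ a) *ᴳ β
          e = trans α≡ (regroup π (π ^ᴳ a) β)
          1≤γ = 1≤norm-*ʳ π γ (subst (λ z → 1 ≤ norm z) (trans e (*ᴳ-comm γ π)) 1≤α)
          β<α = subst (λ z → norm β < norm z) (sym e) (≤-<-trans (norm-∣-≤ {β} {γ} 1≤γ ((π ^ᴳ a) by refl)) (norm-quotient-< γ π prime 1≤γ))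
          ε , 𝔭as , ε∈ , pp , β≡ = go β 1≤β (rec β<α)
      in ε , (π , suc a) ∷ 𝔭as , ε∈
       , ( (prime , _) ∷ proj₁ pp
         , All.map (λ 𝔭∣ π~𝔭 → π∤β (∣ᴳ-trans (∣ᴳ-trans (associated-∣ (associated-sym π~𝔭)) 𝔭∣) (ε by sym β≡))) (∣ᴳ-∏^ pp) ∷ proj₂ pp)
       , trans α≡ (trans (cong ((π ^ᴳ suc a) *ᴳ_) β≡) (swap (π ^ᴳ suc a) ε (∏^ 𝔭as)))
      where
      regroup : ∀ π p β → (π *ᴳ p) *ᴳ β ≡ (p *ᴳ β) *ᴳ π
      regroup = RingSolver.solve-∀ ℤ[i]-solverRing
      swap : ∀ γ ε β → γ *ᴳ (ε *ᴳ β) ≡ ε *ᴳ (γ *ᴳ β)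
      swap = RingSolver.solve-∀ ℤ[i]-solverRing
    choose : 1 < norm α ⊎ 1 ≡ norm α → Factorisation α
    choose (inj₁ 1<α) = let π , prime , π∣α = prime-divisor α 1<α in divide prime π∣α (prime-power-part prime 1≤α)
    choose (inj₂ 1≡α) = α , [] , norm≡1⇒unit α (sym 1≡α) , ([] , []) , trans (sym (*ᴳ-identityˡ α)) (*ᴳ-comm 1ᴳ α)

norm-^ : ∀ α a → norm (α ^ᴳ a) ≡ norm α ^ a
norm-^ α zero    = refl
norm-^ α (suc a) = trans (norm-* α (α ^ᴳ a)) (cong (norm α *_) (norm-^ α a))

norm-∏^ : ∀ 𝔭as → norm (∏^ 𝔭as) ≡ prodOfPowers (map (λ (𝔭 , a) → norm 𝔭 , a) 𝔭as)
norm-∏^ []               = refl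
norm-∏^ ((𝔭 , a) ∷ 𝔭as) = trans (norm-* (𝔭 ^ᴳ a) (∏^ 𝔭as)) (cong₂ _*_ (norm-^ 𝔭 a) (norm-∏^ 𝔭as))

-- This is applied to norms: two Gaussian primes whose product divides p both have norm divisible by
-- p, which already exhausts norm p = p², so the remaining cofactor is a unit.
∣p²⇒p∣ : ∀ {p n} → Prime p → 1 < n → n ∣ p * p → p ∣ n
∣p²⇒p∣ {p} {n} isPrime 1<n (divides m p²≡) = choose (euclidsLemma m n isPrime (divides p (sym p²≡)))
  where
  instance _ = prime⇒nonTrivial isPrime
  instance _ = nonTrivial⇒nonZero p
  choose : p ∣ m ⊎ p ∣ n → p ∣ n
  choose (inj₂ p∣n) = p∣n
  choose (inj₁ (divides k m≡)) = irreducible (prime⇒irreducible isPrime (divides k (*-cancelʳ-≡ p (k * n) p (trans p²≡ (trans (cong (_* n) m≡) (regroup k p n))))))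
    where
    regroup : ∀ k p n → k * p * n ≡ k * n * p
    regroup = ℕ-Solver.solve-∀
    irreducible : n ≡ 1 ⊎ n ≡ p → p ∣ n
    irreducible (inj₁ n≡1) = ⊥-elim (<⇒≢ 1<n (sym n≡1))
    irreducible (inj₂ n≡p) = divides 1 (trans n≡p (sym (*-identityˡ p)))

-- The two cases are p inert and p a product of two Gaussian primes.
rational-prime : ∀ {p} → Prime p → ∃₂ λ 𝔮 γ → GaussianPrime 𝔮 × ℕ→ℤ[i] p ≡ γ *ᴳ 𝔮 ×
  (norm γ ≡ 1 ⊎ ∃ λ 𝔮′ → GaussianPrime 𝔮′ × Associated γ 𝔮′)
rational-prime {p} isPrime = first (prime-divisor (ℕ→ℤ[i] p) (subst (1 <_) (sym (norm-ℕ→ℤ[i] p)) (*-mono-≤ 2≤p 1≤p)))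
  where
  instance _ = prime⇒nonTrivial isPrime
  instance _ = nonTrivial⇒nonZero p
  2≤p : 2 ≤ p
  2≤p = nonTrivial⇒n>1 p
  1≤p : 1 ≤ p
  1≤p = <⇒≤ 2≤p
  Goal : Set
  Goal = ∃₂ λ 𝔮 γ → GaussianPrime 𝔮 × ℕ→ℤ[i] p ≡ γ *ᴳ 𝔮 × (norm γ ≡ 1 ⊎ ∃ λ 𝔮′ → GaussianPrime 𝔮′ × Associated γ 𝔮′)
  first : (∃ λ π → GaussianPrime π × π ∣ᴳ ℕ→ℤ[i] p) → Goal
  first (𝔮 , prime𝔮 , (γ by e)) = 𝔮 , γ , prime𝔮 , sym e , second (m≤n⇒m<n∨m≡n 1≤γ)
    where
    N≡ : p * p ≡ norm γ * norm 𝔮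
    N≡ = trans (sym (norm-ℕ→ℤ[i] p)) (trans (cong norm (sym e)) (norm-* γ 𝔮))
    1≤γ : 1 ≤ norm γ
    1≤γ = n≢0⇒n>0 λ e → <⇒≢ (*-mono-≤ 1≤p 1≤p) (sym (trans N≡ (cong (_* norm 𝔮) e)))
    second : 1 < norm γ ⊎ 1 ≡ norm γ → norm γ ≡ 1 ⊎ ∃ λ 𝔮′ → GaussianPrime 𝔮′ × Associated γ 𝔮′
    second (inj₂ 1≡γ) = inj₁ (sym 1≡γ)
    second (inj₁ 1<γ) = inj₂ (third (prime-divisor γ 1<γ))
      where
      third : (∃ λ π → GaussianPrime π × π ∣ᴳ γ) → ∃ λ 𝔮′ → GaussianPrime 𝔮′ × Associated γ 𝔮′
      third (𝔮′ , prime𝔮′ , (δ by e′)) = 𝔮′ , prime𝔮′ , associated⁺ δ Nδ≡1 (sym e′)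
        where
        γ≡ : norm γ ≡ norm δ * norm 𝔮′
        γ≡ = trans (cong norm (sym e′)) (norm-* δ 𝔮′)
        regroup : ∀ x y z → x * y * z ≡ x * z * y
        regroup = ℕ-Solver.solve-∀
        p∣𝔮 : p ∣ norm 𝔮
        p∣𝔮 = ∣p²⇒p∣ isPrime (prime⇒2≤norm prime𝔮) (divides (norm γ) N≡)
        p∣𝔮′ : p ∣ norm 𝔮′
        p∣𝔮′ = ∣p²⇒p∣ isPrime (prime⇒2≤norm prime𝔮′)
          (divides (norm δ * norm 𝔮) (trans N≡ (trans (cong (_* norm 𝔮) γ≡) (regroup (norm δ) (norm 𝔮′) (norm 𝔮)))))
        Nδ≡1 : norm δ ≡ 1
        Nδ≡1 = cofactor p∣𝔮 p∣𝔮′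
          where
          expand : ∀ d a b p → d * (a * p) * (b * p) ≡ d * (a * b) * (p * p)
          expand = ℕ-Solver.solve-∀
          cofactor : p ∣ norm 𝔮 → p ∣ norm 𝔮′ → norm δ ≡ 1
          cofactor (divides a 𝔮≡) (divides b 𝔮′≡) = m*n≡1⇒m≡1 (norm δ) (b * a)
            (*-cancelʳ-≡ (norm δ * (b * a)) 1 (p * p) {{m*n≢0 p p}} (sym (trans (*-identityˡ (p * p))
              (trans N≡ (trans (cong₂ _*_ (trans γ≡ (cong (norm δ *_) 𝔮′≡)) 𝔮≡) (expand (norm δ) b a p))))))

-- Growth of τ and 𝔱

prime-factor : ∀ n → 1 < n → ∃₂ λ p m → Prime p × n ≡ p * m
prime-factor n 1<n = choose (factors f) (isFactorisation f) (factorsPrime f)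
  where
  open PrimeFactorisation
  f = factorise n {{>-nonZero (<⇒≤ 1<n)}}
  choose : ∀ ps → n ≡ product ps → All Prime ps → ∃₂ λ p m → Prime p × n ≡ p * m
  choose []       n≡1 _               = ⊥-elim (<⇒≢ 1<n (sym n≡1))
  choose (p ∷ ps) n≡  (isPrime ∷ _) = p , product ps , isPrime , n≡

prime⇒2≤ : ∀ {p} → Prime p → 2 ≤ p
prime⇒2≤ {p} isPrime = nonTrivial⇒n>1 p {{prime⇒nonTrivial isPrime}}

-- Multiplying the argument by 2 may cost K, and by any prime K ^ (3/2); the latter is squared to
-- remain in ℕ. Both halves of `Tame` follow by induction over the prime factors of the argument.
module _ {K : ℕ} {g : ℕ → ℕ} (1≤K : 1 ≤ K) (g1 : g 1 ≤ 1) (g2 : ∀ b → 1 ≤ b → g (2 * b) ≤ K * g b)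
         (gp : ∀ p b → Prime p → 1 ≤ b → g (p * b) * g (p * b) ≤ K ^ 3 * (g b * g b)) where
  open ≤-Reasoning

  private
    K^-mono : ∀ {m n} → m ≤ n → K ^ m ≤ K ^ n
    K^-mono = ^-monoʳ-≤ K {{>-nonZero 1≤K}}

    TameAt : ℕ → Set
    TameAt a = g a * g a ≤ K ^ a × ∃ λ ω → 2 ^ ω ≤ a × g a * g a ≤ K ^ (3 * ω)

    -- For b ≥ 2, p b is at least b + 2 if p = 2 and at least b + 3 otherwise, which pays for K² and
    -- K³. For b = 1 there is no such room: K² against K ^ 2 and K³ against K ^ p hold only with the
    -- sharper input g 1 ≤ 1.
    half-exponent : ∀ p b → Prime p → 1 ≤ b → g b * g b ≤ K ^ b → g (p * b) * g (p * b) ≤ K ^ (p * b)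
    half-exponent p 1 isPrime _ _ with p ≟ 2
    ... | yes refl = begin
      g 2 * g 2                  ≤⟨ *-mono-≤ (g2 1 ≤-refl) (g2 1 ≤-refl) ⟩
      K * g 1 * (K * g 1)        ≤⟨ *-mono-≤ (*-monoʳ-≤ K g1) (*-monoʳ-≤ K g1) ⟩
      K * 1 * (K * 1)            ≡⟨ regroup K ⟩
      K * (K * 1) ∎
      where
      regroup : ∀ K → K * 1 * (K * 1) ≡ K * (K * 1)
      regroup = ℕ-Solver.solve-∀
    ... | no p≢2 = begin
      g (p * 1) * g (p * 1)      ≤⟨ gp p 1 isPrime ≤-refl ⟩
      K ^ 3 * (g 1 * g 1)        ≤⟨ *-monoʳ-≤ (K ^ 3) (*-mono-≤ g1 g1) ⟩
      K ^ 3 * 1                  ≡⟨ *-identityʳ (K ^ 3) ⟩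
      K ^ 3                      ≤⟨ K^-mono (≤-trans (≤∧≢⇒< (prime⇒2≤ isPrime) (λ e → p≢2 (sym e))) (≤-reflexive (sym (*-identityʳ p)))) ⟩
      K ^ (p * 1) ∎
    half-exponent p b@(suc (suc b′)) isPrime 1≤b g²≤ with p ≟ 2
    ... | yes refl = begin
      g (2 * b) * g (2 * b)      ≤⟨ *-mono-≤ (g2 b 1≤b) (g2 b 1≤b) ⟩
      K * g b * (K * g b)        ≡⟨ regroup K (g b) ⟩
      K ^ 2 * (g b * g b)        ≤⟨ *-monoʳ-≤ (K ^ 2) g²≤ ⟩
      K ^ 2 * K ^ b              ≡⟨ sym (^-distribˡ-+-* K 2 b) ⟩
      K ^ (2 + b)                ≤⟨ K^-mono (≤-trans (≤-reflexive (+-comm 2 b)) (+-monoʳ-≤ b (s≤s (s≤s z≤n)))) ⟩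
      K ^ (2 * b) ∎
      where
      regroup : ∀ K x → K * x * (K * x) ≡ K * (K * 1) * (x * x)
      regroup = ℕ-Solver.solve-∀
    ... | no p≢2 = begin
      g (p * b) * g (p * b)      ≤⟨ gp p b isPrime 1≤b ⟩
      K ^ 3 * (g b * g b)        ≤⟨ *-monoʳ-≤ (K ^ 3) g²≤ ⟩
      K ^ 3 * K ^ b              ≡⟨ sym (^-distribˡ-+-* K 3 b) ⟩
      K ^ (3 + b)                ≤⟨ K^-mono (begin
        3 + b        ≤⟨ +-monoˡ-≤ b (n≤1+n 3) ⟩
        4 + b        ≤⟨ +-monoˡ-≤ b (*-monoʳ-≤ 2 {2} {b} (s≤s (s≤s z≤n))) ⟩
        2 * b + b    ≡⟨ +-comm (2 * b) b ⟩
        3 * b        ≤⟨ *-monoˡ-≤ b (≤∧≢⇒< (prime⇒2≤ isPrime) (λ e → p≢2 (sym e))) ⟩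
        p * b ∎) ⟩
      K ^ (p * b) ∎

    tame-at-1 : TameAt 1
    tame-at-1 = ≤-trans (*-mono-≤ g1 g1) (≤-trans 1≤K (≤-reflexive (sym (*-identityʳ K)))) , 0 , ≤-refl , *-mono-≤ g1 g1

    tame-step : ∀ p b → Prime p → 1 ≤ b → TameAt b → TameAt (p * b)
    tame-step p b isPrime 1≤b (g²≤K^b , ω , 2^ω≤b , g²≤K^3ω) =
      half-exponent p b isPrime 1≤b g²≤K^b , suc ω , *-mono-≤ (prime⇒2≤ isPrime) 2^ω≤b , (begin
        g (p * b) * g (p * b)     ≤⟨ gp p b isPrime 1≤b ⟩
        K ^ 3 * (g b * g b)       ≤⟨ *-monoʳ-≤ (K ^ 3) g²≤K^3ω ⟩
        K ^ 3 * K ^ (3 * ω)       ≡⟨ sym (^-distribˡ-+-* K 3 (3 * ω)) ⟩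
        K ^ (3 + 3 * ω)           ≡⟨ cong (K ^_) (sym (*-suc 3 ω)) ⟩
        K ^ (3 * suc ω) ∎)

  tame : Tame K g
  tame a 1≤a = go a 1≤a (<-wellFounded a)
    where
    go : ∀ a → 1 ≤ a → Acc _<_ a → TameAt a
    go 1               _ _         = tame-at-1
    go a@(suc (suc _)) _ (acc rec) =
      let p , b , isPrime , a≡pb = prime-factor a (s≤s (s≤s z≤n))
          1≤b = n≢0⇒n>0 λ b≡0 → <⇒≢ (s≤s z≤n) (sym (trans a≡pb (trans (cong (p *_) b≡0) (*-zeroʳ p))))
          b<a = subst (b <_) (sym (trans a≡pb (*-comm p b))) (m<m*n b p {{>-nonZero 1≤b}} (prime⇒2≤ isPrime))
      in subst TameAt (sym a≡pb) (tame-step p b isPrime 1≤b (go b 1≤b (rec b<a)))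

-- Tuples of positive integers with given product

map-suc-upTo-unique : ∀ n → Unique (map suc (upTo n))
map-suc-upTo-unique n = Unique.map⁺ suc-injective (Unique.upTo⁺ n)

τ-tuples : ℕ → ℕ → List (List ℕ)
τ-tuples k a = filter (λ ds → product ds ≟ a) (tuples k (map suc (upTo a)))

τ-tuples-unique : ∀ k a → Unique (τ-tuples k a)
τ-tuples-unique k a = Unique.filter⁺ (λ ds → product ds ≟ a) (tuples-unique k (map-suc-upTo-unique a))

∈-τ-tuples⁻ : ∀ {k a ds} → ds ∈ τ-tuples k a → length ds ≡ k × product ds ≡ a
∈-τ-tuples⁻ {k} {a} ds∈ = let ds∈′ , e = ∈-filter⁻ (λ ds → product ds ≟ a) {xs = tuples k (map suc (upTo a))} ds∈ in proj₁ (∈-tuples⁻ k ds∈′) , e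

∈-τ-tuples⁺ : ∀ {k a ds} → 1 ≤ a → length ds ≡ k → product ds ≡ a → ds ∈ τ-tuples k a
∈-τ-tuples⁺ {k} {a} {ds} 1≤a l e = ∈-filter⁺ (λ ds → product ds ≟ a) (∈-tuples⁺ k l (All.tabulate in-range)) e
  where
  in-range′ : ∀ d → d ∣ a → d ∈ map suc (upTo a)
  in-range′ zero    (divides q a≡) = ⊥-elim (<⇒≢ 1≤a (sym (trans a≡ (*-zeroʳ q))))
  in-range′ (suc d) d∣a            = ∈-map⁺ suc (∈-upTo⁺ (∣⇒≤ {{>-nonZero 1≤a}} d∣a))
  in-range : ∀ {d} → d ∈ ds → d ∈ map suc (upTo a)
  in-range {d} d∈ = in-range′ d (subst (d ∣_) e (∈⇒∣product d∈))

divide-by-prime : ∀ {p} ds → Prime p → p ∣ product ds → ∃₂ λ n ds′ → Replace (λ x y → x ≡ p * y) n ds ds′ × product ds ≡ p * product ds′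
divide-by-prime []       isPrime p∣1  = ⊥-elim (<⇒≱ (prime⇒2≤ isPrime) (∣⇒≤ p∣1))
divide-by-prime {p} (d ∷ ds) isPrime p∣ = choose (euclidsLemma d (product ds) isPrime p∣)
  where
  Goal : Set
  Goal = ∃₂ λ n ds′ → Replace (λ x y → x ≡ p * y) n (d ∷ ds) ds′ × product (d ∷ ds) ≡ p * product ds′
  choose : p ∣ d ⊎ p ∣ product ds → Goal
  choose (inj₁ (divides q d≡)) = 0 , q ∷ ds , here (trans d≡ (*-comm q p)) , trans (cong (_* product ds) (trans d≡ (*-comm q p))) (*-assoc p q (product ds))
  choose (inj₂ p∣ds) =
    let n , ds′ , r , e = divide-by-prime ds isPrime p∣ds
    in suc n , d ∷ ds′ , there r , trans (cong (d *_) e) (swap d p (product ds′))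
    where
    swap : ∀ d p x → d * (p * x) ≡ p * (d * x)
    swap = ℕ-Solver.solve-∀

-- If p divides the product it divides an entry; dividing that entry gives a tuple for b, and the
-- original is recovered from it and one of k positions.
τ-prime : ∀ k p b → Prime p → 1 ≤ b → τ k (p * b) ≤ k * τ k b
τ-prime k p b isPrime 1≤b = length-≤-by-replacing (λ x y → x ≡ p * y) (λ e e′ → trans e (sym e′)) k (τ-tuples-unique k (p * b)) λ ds∈ →
  let l , e = ∈-τ-tuples⁻ {k} ds∈
      n , ds′ , r , e′ = divide-by-prime _ isPrime (subst (p ∣_) (sym e) (∣m⇒∣m*n b ∣-refl))
  in l , n , ds′ , r , ∈-τ-tuples⁺ 1≤b (trans (sym (replace-length r)) l) (*-cancelˡ-≡ (product ds′) b p {{prime⇒nonZero isPrime}} (trans (sym e′) e))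

τ[k,1]≤1 : ∀ k → τ k 1 ≤ 1
τ[k,1]≤1 k = ≤-trans (length-filter (λ ds → product ds ≟ 1) (tuples k (1 ∷ []))) (≤-reflexive (length-tuples-singleton k))
  where
  length-tuples-singleton : ∀ k → length (tuples k (1 ∷ [])) ≡ 1
  length-tuples-singleton zero    = refl
  length-tuples-singleton (suc k) = trans (length-cartesianProductWith _∷_ (1 ∷ []) (tuples k (1 ∷ []))) (trans (*-identityˡ _) (length-tuples-singleton k))

tame-τ : ∀ k → 1 ≤ k → Tame k (τ k)
tame-τ k 1≤k = tame 1≤k (τ[k,1]≤1 k) (λ b → τ-prime k 2 b prime[2]) λ p b isPrime 1≤b → begin
    τ k (p * b) * τ k (p * b)      ≤⟨ *-mono-≤ (τ-prime k p b isPrime 1≤b) (τ-prime k p b isPrime 1≤b) ⟩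
    k * τ k b * (k * τ k b)        ≡⟨ regroup k (τ k b) ⟩
    k ^ 2 * (τ k b * τ k b)        ≤⟨ *-monoˡ-≤ (τ k b * τ k b) (^-monoʳ-≤ k {{>-nonZero 1≤k}} (n≤1+n 2)) ⟩
    k ^ 3 * (τ k b * τ k b) ∎
  where
  open ≤-Reasoning
  regroup : ∀ k x → k * x * (k * x) ≡ k * (k * 1) * (x * x)
  regroup = ℕ-Solver.solve-∀

-- Split by the first entry: 1 leaves product 2, and 2 leaves product 1.
k≤τ[k,2] : ∀ k → k ≤ τ k 2
k≤τ[k,2] zero    = z≤n
k≤τ[k,2] (suc k) = begin
  suc k                                           ≡⟨ +-comm 1 k ⟩
  k + 1                                           ≤⟨ +-mono-≤ (k≤τ[k,2] k) (1≤ones k) ⟩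
  count 2 k + count 1 k                           ≤⟨ +-monoʳ-≤ (count 2 k) (≤-trans (m≤m+n (count 1 k) _) (length-filter-map-++ (λ ds → product ds ≟ 1) P₂ (2 ∷_) (cong (2 *_)) (tuples k xs) [])) ⟩
  count 2 k + length (filter P₂ (map (2 ∷_) (tuples k xs) ++ []))
    ≤⟨ length-filter-map-++ P₂ P₂ (1 ∷_) (λ e → trans (*-identityˡ _) e) (tuples k xs) _ ⟩
  τ (suc k) 2 ∎
  where
  open ≤-Reasoning
  xs : List ℕ
  xs = 1 ∷ 2 ∷ []
  P₂ : (ds : List ℕ) → Dec (product ds ≡ 2)
  P₂ ds = product ds ≟ 2
  count : ℕ → ℕ → ℕ
  count a k = length (filter (λ ds → product ds ≟ a) (tuples k xs))
  1≤ones : ∀ k → 1 ≤ count 1 k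
  1≤ones zero    = ≤-refl
  1≤ones (suc k) = ≤-trans (1≤ones k) (≤-trans (m≤m+n (count 1 k) _)
    (length-filter-map-++ (λ ds → product ds ≟ 1) (λ ds → product ds ≟ 1) (1 ∷_) (λ e → trans (*-identityˡ _) e) (tuples k xs) (map (2 ∷_) (tuples k xs) ++ [])))

-- Tuples of Gaussian integers with given product

𝔱-tuples : ℕ → ℕ → ℤ[i] → List (List ℤ[i])
𝔱-tuples k n α = filter (λ 𝔡s → associated? (∏ᴳ 𝔡s) α) (tuples k (representatives n))

𝔱-tuples-unique : ∀ k n α → Unique (𝔱-tuples k n α)
𝔱-tuples-unique k n α = Unique.filter⁺ (λ 𝔡s → associated? (∏ᴳ 𝔡s) α) (tuples-unique k (representatives-unique n))

∈-𝔱-tuples⁻ : ∀ {k n α 𝔡s} → 𝔡s ∈ 𝔱-tuples k n α → length 𝔡s ≡ k × All Quadrant 𝔡s × Associated (∏ᴳ 𝔡s) α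
∈-𝔱-tuples⁻ {k} {n} {α} 𝔡s∈ =
  let 𝔡s∈′ , a = ∈-filter⁻ (λ 𝔡s → associated? (∏ᴳ 𝔡s) α) {xs = tuples k (representatives n)} 𝔡s∈
      l , all = ∈-tuples⁻ k 𝔡s∈′
  in l , All.map (∈-representatives⁻ {n}) all , a

quadrant⇒1≤norm : ∀ {α} → Quadrant α → 1 ≤ norm α
quadrant⇒1≤norm (x , y , α≡) = subst (λ z → 1 ≤ norm z) (sym α≡) (s≤s z≤n)

all-∣ᴳ-∏ᴳ : ∀ 𝔡s → All (_∣ᴳ ∏ᴳ 𝔡s) 𝔡s
all-∣ᴳ-∏ᴳ []        = []
all-∣ᴳ-∏ᴳ (𝔡 ∷ 𝔡s) = (∏ᴳ 𝔡s by *ᴳ-comm (∏ᴳ 𝔡s) 𝔡) ∷ All.map (∣ᴳ-*ˡ 𝔡) (all-∣ᴳ-∏ᴳ 𝔡s)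

∈-𝔱-tuples⁺ : ∀ {k n α 𝔡s} → 1 ≤ norm α → norm α ≤ n * n → length 𝔡s ≡ k → All Quadrant 𝔡s → Associated (∏ᴳ 𝔡s) α → 𝔡s ∈ 𝔱-tuples k n α
∈-𝔱-tuples⁺ {k} {n} {α} {𝔡s} 1≤α α≤n² l quadrants a =
  ∈-filter⁺ (λ 𝔡s → associated? (∏ᴳ 𝔡s) α) (∈-tuples⁺ k l (All.zipWith in-box (quadrants , all-∣ᴳ-∏ᴳ 𝔡s))) a
  where
  N≡ : norm (∏ᴳ 𝔡s) ≡ norm α
  N≡ = associated-norm a
  in-box : ∀ {𝔡} → Quadrant 𝔡 × 𝔡 ∣ᴳ ∏ᴳ 𝔡s → 𝔡 ∈ representatives n
  in-box {𝔡} (quadrant , 𝔡∣) = ∈-representatives⁺ {n} {𝔡} quadrant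
    (≤-trans (norm-∣-≤ {𝔡} {∏ᴳ 𝔡s} (subst (1 ≤_) (sym N≡) 1≤α) 𝔡∣) (≤-trans (≤-reflexive N≡) α≤n²))

-- Quotients are known only up to a unit. Requiring `α` to lie in the quadrant lets `β` determine
-- it, which the counting by replacement relies on.
MultipleOf : ℤ[i] → ℤ[i] → ℤ[i] → Set
MultipleOf π α β = Quadrant α × Associated α (π *ᴳ β)

multipleOf-injective : ∀ π {α α′ β} → MultipleOf π α β → MultipleOf π α′ β → α ≡ α′
multipleOf-injective π (q , a) (q′ , a′) = quadrant-unique q q′ (associated-trans a (associated-sym a′))

divide-by-primeᴳ : ∀ {π} 𝔡s → GaussianPrime π → All Quadrant 𝔡s → π ∣ᴳ ∏ᴳ 𝔡s →
  ∃₂ λ n 𝔡s′ → Replace (MultipleOf π) n 𝔡s 𝔡s′ × All Quadrant 𝔡s′ × Associated (∏ᴳ 𝔡s) (π *ᴳ ∏ᴳ 𝔡s′)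
divide-by-primeᴳ []              prime _        π∣1 = ⊥-elim (p∤1 prime π∣1)
divide-by-primeᴳ {π} (𝔡 ∷ 𝔡s) prime (q ∷ qs) π∣  = choose (split-∣ prime {𝔡} {∏ᴳ 𝔡s} π∣)
  where
  Goal : Set
  Goal = ∃₂ λ n 𝔡s′ → Replace (MultipleOf π) n (𝔡 ∷ 𝔡s) 𝔡s′ × All Quadrant 𝔡s′ × Associated (∏ᴳ (𝔡 ∷ 𝔡s)) (π *ᴳ ∏ᴳ 𝔡s′)
  divide-head : ∀ γ → γ *ᴳ π ≡ 𝔡 → (∃ λ ρ → Quadrant ρ × Associated ρ γ) → Goal
  divide-head γ e (ρ , qρ , ρ~γ) = 0 , ρ ∷ 𝔡s , here (q , 𝔡~πρ) , qρ ∷ qs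
    , subst (Associated (𝔡 *ᴳ ∏ᴳ 𝔡s)) (*ᴳ-assoc π ρ (∏ᴳ 𝔡s)) (associated-*ʳ (∏ᴳ 𝔡s) 𝔡~πρ)
    where
    𝔡~πρ : Associated 𝔡 (π *ᴳ ρ)
    𝔡~πρ = subst (λ z → Associated z (π *ᴳ ρ)) (trans (*ᴳ-comm π γ) e) (associated-*ˡ π (associated-sym ρ~γ))
  swap : ∀ d p x → d *ᴳ (p *ᴳ x) ≡ p *ᴳ (d *ᴳ x)
  swap = RingSolver.solve-∀ ℤ[i]-solverRing
  choose : π ∣ᴳ 𝔡 ⊎ π ∣ᴳ ∏ᴳ 𝔡s → Goal
  choose (inj₁ (γ by e)) = divide-head γ e (quadrant-representative γ
    (1≤norm-*ʳ π γ (subst (λ z → 1 ≤ norm z) (trans (sym e) (*ᴳ-comm γ π)) (quadrant⇒1≤norm q))))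
  choose (inj₂ π∣𝔡s) =
    let n , 𝔡s′ , r , qs′ , a = divide-by-primeᴳ 𝔡s prime qs π∣𝔡s
    in suc n , 𝔡 ∷ 𝔡s′ , there r , q ∷ qs′ , subst (Associated (𝔡 *ᴳ ∏ᴳ 𝔡s)) (swap 𝔡 π (∏ᴳ 𝔡s′)) (associated-*ˡ 𝔡 a)

divide-tuple : ∀ {π α} 𝔡s → GaussianPrime π → All Quadrant 𝔡s → Associated (∏ᴳ 𝔡s) (π *ᴳ α) →
  ∃₂ λ n 𝔡s′ → Replace (MultipleOf π) n 𝔡s 𝔡s′ × All Quadrant 𝔡s′ × Associated (∏ᴳ 𝔡s′) α
divide-tuple {π} {α} 𝔡s prime qs a =
  let n , 𝔡s′ , r , qs′ , a′ = divide-by-primeᴳ 𝔡s prime qs (∣ᴳ-trans (α by *ᴳ-comm α π) (associated-∣ a))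
  in n , 𝔡s′ , r , qs′ , associated-cancelˡ π {∏ᴳ 𝔡s′} {α} (prime⇒1≤norm prime) (associated-trans (associated-sym a′) a)

module _ (k : ℕ) {m n : ℕ} {α β : ℤ[i]} (1≤α : 1 ≤ norm α) (α≤n² : norm α ≤ n * n) where

  𝔱-tuples-prime : ∀ {π} → GaussianPrime π → Associated β (π *ᴳ α) → length (𝔱-tuples k m β) ≤ k * length (𝔱-tuples k n α)
  𝔱-tuples-prime {π} prime β~πα = length-≤-by-replacing (MultipleOf π) (multipleOf-injective π) k (𝔱-tuples-unique k m β) λ {𝔡s} 𝔡s∈ →
    let l , qs , a = ∈-𝔱-tuples⁻ {k} {m} {β} {𝔡s} 𝔡s∈
        j , 𝔡s′ , r , qs′ , a′ = divide-tuple {π} {α} 𝔡s prime qs (associated-trans {∏ᴳ 𝔡s} {β} {π *ᴳ α} a β~πα)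
    in l , j , 𝔡s′ , r , ∈-𝔱-tuples⁺ {k} {n} {α} {𝔡s′} 1≤α α≤n² (trans (sym (replace-length r)) l) qs′ a′

  𝔱-tuples-prime-square : ∀ {π} → GaussianPrime π → Associated β (π *ᴳ (π *ᴳ α)) →
                          length (𝔱-tuples k m β) ≤ (suc k C 2) * length (𝔱-tuples k n α)
  𝔱-tuples-prime-square {π} prime β~ππα = length-≤-by-replacing-two (MultipleOf π) (multipleOf-injective π) k (𝔱-tuples-unique k m β) λ {𝔡s} 𝔡s∈ →
    let l , qs , a = ∈-𝔱-tuples⁻ {k} {m} {β} {𝔡s} 𝔡s∈
        j , 𝔡s′ , r , qs′ , a′ = divide-tuple {π} {π *ᴳ α} 𝔡s prime qs (associated-trans {∏ᴳ 𝔡s} {β} {π *ᴳ (π *ᴳ α)} a β~ππα)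
        j′ , 𝔡s″ , r′ , qs″ , a″ = divide-tuple {π} {α} 𝔡s′ prime qs′ a′
    in l , j , j′ , 𝔡s′ , 𝔡s″ , r , r′ , ∈-𝔱-tuples⁺ {k} {n} {α} {𝔡s″} 1≤α α≤n² (trans (sym (replace-length r′)) (trans (sym (replace-length r)) l)) qs″ a″

1≤norm-ℕ : ∀ {b} → 1 ≤ b → 1 ≤ norm (ℕ→ℤ[i] b)
1≤norm-ℕ {b} 1≤b = subst (1 ≤_) (sym (norm-ℕ→ℤ[i] b)) (*-mono-≤ 1≤b 1≤b)

norm-ℕ≤ : ∀ b → norm (ℕ→ℤ[i] b) ≤ b * b
norm-ℕ≤ b = ≤-reflexive (norm-ℕ→ℤ[i] b)

ℕ→ℤ[i]-* : ∀ m n → ℕ→ℤ[i] (m * n) ≡ ℕ→ℤ[i] m *ᴳ ℕ→ℤ[i] n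
ℕ→ℤ[i]-* m n = cong₂ _+_i (trans (ℤₚ.pos-* m n) (sym (ℤₚ.+-identityʳ (ℤ.+ m ℤ.* ℤ.+ n))))
  (sym (trans (cong₂ ℤ._+_ (ℤₚ.*-zeroʳ (ℤ.+ m)) (ℤₚ.*-zeroˡ (ℤ.+ n))) refl))

1+iᴳ : ℤ[i]
1+iᴳ = ℤ.1ℤ + ℤ.1ℤ i

1+i-prime : GaussianPrime 1+iᴳ
1+i-prime = no-proper-divisor⇒prime 1+iᴳ ≤-refl λ β (_ , 1<β , β<2) → <⇒≱ β<2 1<β

-- 2 = -i (1 + i)², so both divisions are by the same prime and their order can be forgotten.
𝔱[2b]≤ : ∀ k b → 1 ≤ b → 𝔱 k (2 * b) ≤ (suc k C 2) * 𝔱 k b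
𝔱[2b]≤ k b 1≤b = 𝔱-tuples-prime-square k {2 * b} {b} {ℕ→ℤ[i] b} {ℕ→ℤ[i] (2 * b)} (1≤norm-ℕ 1≤b) (norm-ℕ≤ b) 1+i-prime
  (associated⁺ -iᴳ refl (trans (ℕ→ℤ[i]-* 2 b) (trans (cong (_*ᴳ ℕ→ℤ[i] b) 2≡) (regroup -iᴳ 1+iᴳ (ℕ→ℤ[i] b)))))
  where
  2≡ : ℕ→ℤ[i] 2 ≡ -iᴳ *ᴳ (1+iᴳ *ᴳ 1+iᴳ)
  2≡ = refl
  regroup : ∀ ε π β → (ε *ᴳ (π *ᴳ π)) *ᴳ β ≡ ε *ᴳ (π *ᴳ (π *ᴳ β))
  regroup = RingSolver.solve-∀ ℤ[i]-solverRing

-- The factor k² covers two distinct primes above p, at k each, and an inert p costs only k. The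
-- intermediate target `𝔮 *ᴳ b′` need not be a rational integer, so `𝔱-tuples` keeps target and
-- search box separate.
𝔱[pb]≤ : ∀ k p b → 1 ≤ k → Prime p → 1 ≤ b → 𝔱 k (p * b) ≤ k * k * 𝔱 k b
𝔱[pb]≤ k p b 1≤k isPrime 1≤b = split (rational-prime isPrime)
  where
  1≤p : 1 ≤ p
  1≤p = <⇒≤ (prime⇒2≤ isPrime)
  b′ pb : ℤ[i]
  b′ = ℕ→ℤ[i] b
  pb = ℕ→ℤ[i] (p * b)
  regroup : ∀ γ 𝔮 β → (γ *ᴳ 𝔮) *ᴳ β ≡ γ *ᴳ (𝔮 *ᴳ β)
  regroup = RingSolver.solve-∀ ℤ[i]-solverRing
  swap : ∀ γ 𝔮 β → γ *ᴳ (𝔮 *ᴳ β) ≡ 𝔮 *ᴳ (γ *ᴳ β)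
  swap = RingSolver.solve-∀ ℤ[i]-solverRing
  split : (∃₂ λ 𝔮 γ → GaussianPrime 𝔮 × ℕ→ℤ[i] p ≡ γ *ᴳ 𝔮 × (norm γ ≡ 1 ⊎ ∃ λ 𝔮′ → GaussianPrime 𝔮′ × Associated γ 𝔮′)) →
          𝔱 k (p * b) ≤ k * k * 𝔱 k b
  split (𝔮 , γ , prime𝔮 , p≡ , kind) = by-kind kind
    where
    pb≡ : pb ≡ γ *ᴳ (𝔮 *ᴳ b′)
    pb≡ = trans (ℕ→ℤ[i]-* p b) (trans (cong (_*ᴳ b′) p≡) (regroup γ 𝔮 b′))
    by-kind : norm γ ≡ 1 ⊎ (∃ λ 𝔮′ → GaussianPrime 𝔮′ × Associated γ 𝔮′) → 𝔱 k (p * b) ≤ k * k * 𝔱 k b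
    by-kind (inj₁ unit) = ≤-trans
      (𝔱-tuples-prime k {p * b} {b} {b′} {pb} (1≤norm-ℕ 1≤b) (norm-ℕ≤ b) prime𝔮 (associated⁺ γ unit pb≡))
      (*-monoˡ-≤ (𝔱 k b) (m≤m*n k k {{>-nonZero 1≤k}}))
    by-kind (inj₂ (𝔮′ , prime𝔮′ , γ~𝔮′)) = begin
      𝔱 k (p * b)                                       ≤⟨ 𝔱-tuples-prime k {p * b} {p * b} {𝔮 *ᴳ b′} {pb} 1≤𝔮b 𝔮b≤ prime𝔮′
                                                             (subst (λ z → Associated z (𝔮′ *ᴳ (𝔮 *ᴳ b′))) (sym pb≡) (associated-*ʳ (𝔮 *ᴳ b′) γ~𝔮′)) ⟩
      k * length (𝔱-tuples k (p * b) (𝔮 *ᴳ b′))         ≤⟨ *-monoʳ-≤ k (𝔱-tuples-prime k {p * b} {b} {b′} {𝔮 *ᴳ b′} (1≤norm-ℕ 1≤b) (norm-ℕ≤ b) prime𝔮 associated-refl) ⟩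
      k * (k * 𝔱 k b)                                   ≡⟨ sym (*-assoc k k (𝔱 k b)) ⟩
      k * k * 𝔱 k b ∎
      where
      open ≤-Reasoning
      1≤pb : 1 ≤ norm pb
      1≤pb = 1≤norm-ℕ (*-mono-≤ 1≤p 1≤b)
      1≤𝔮b : 1 ≤ norm (𝔮 *ᴳ b′)
      1≤𝔮b = 1≤norm-*ʳ γ (𝔮 *ᴳ b′) (subst (λ z → 1 ≤ norm z) pb≡ 1≤pb)
      𝔮b≤ : norm (𝔮 *ᴳ b′) ≤ p * b * (p * b)
      𝔮b≤ = ≤-trans (norm-∣-≤ {𝔮 *ᴳ b′} {pb} 1≤pb (γ by sym pb≡)) (norm-ℕ≤ (p * b))

𝔱[k,1]≤1 : ∀ k → 𝔱 k 1 ≤ 1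
𝔱[k,1]≤1 k = unique-length-≤-by {B = List ℤ[i]} (λ 𝔡s ρs → length 𝔡s ≡ k × All (_≡ 1ᴳ) 𝔡s) {ys = [] ∷ []} (𝔱-tuples-unique k 1 1ᴳ)
  (λ (l , ones) (l′ , ones′) → all-ones (trans l (sym l′)) ones ones′)
  λ {𝔡s} 𝔡s∈ →
    let l , qs , a = ∈-𝔱-tuples⁻ {k} {1} {1ᴳ} 𝔡s∈
    in [] , here refl , l , All.zipWith (λ (q , 𝔡∣) → is-one (associated-norm a) q 𝔡∣) (qs , all-∣ᴳ-∏ᴳ 𝔡s)
  where
  all-ones : ∀ {𝔡s 𝔡s′} → length 𝔡s ≡ length 𝔡s′ → All (_≡ 1ᴳ) 𝔡s → All (_≡ 1ᴳ) 𝔡s′ → 𝔡s ≡ 𝔡s′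
  all-ones _ []       []         = refl
  all-ones l (e ∷ es) (e′ ∷ es′) = cong₂ _∷_ (trans e (sym e′)) (all-ones (suc-injective l) es es′)
  is-one : ∀ {𝔡 π} → norm π ≡ 1 → Quadrant 𝔡 → 𝔡 ∣ᴳ π → 𝔡 ≡ 1ᴳ
  is-one {𝔡} {π} N≡1 q 𝔡∣ = quadrant-unique q (0 , 0 , refl) (associated⁺ 𝔡
    (≤-antisym (≤-trans (norm-∣-≤ {𝔡} {π} (≤-reflexive (sym N≡1)) 𝔡∣) (≤-reflexive N≡1)) (quadrant⇒1≤norm q))
    (trans (sym (*ᴳ-identityˡ 𝔡)) (*ᴳ-comm 1ᴳ 𝔡)))

2*[suc-k-C-2] : ∀ k → 2 * (suc k C 2) ≡ k * suc k
2*[suc-k-C-2] zero    = refl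
2*[suc-k-C-2] (suc k) = begin
  2 * (suc (suc k) C 2)          ≡⟨ cong (2 *_) (sym (nCk+nC[k+1]≡[n+1]C[k+1] (suc k) 1)) ⟩
  2 * (suc k C 1 + suc k C 2)    ≡⟨ cong (λ z → 2 * (z + suc k C 2)) (nC1≡n (suc k)) ⟩
  2 * (suc k + suc k C 2)        ≡⟨ *-distribˡ-+ 2 (suc k) (suc k C 2) ⟩
  2 * suc k + 2 * (suc k C 2)    ≡⟨ cong (2 * suc k +_) (2*[suc-k-C-2] k) ⟩
  2 * suc k + k * suc k          ≡⟨ sym (*-distribʳ-+ (suc k) 2 k) ⟩
  suc (suc k) * suc k            ≡⟨ *-comm (suc (suc k)) (suc k) ⟩
  suc k * suc (suc k) ∎
  where open Relation.Binary.PropositionalEquality.≡-Reasoning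

k≤suc-k-C-2 : ∀ k → k ≤ suc k C 2
k≤suc-k-C-2 zero    = z≤n
k≤suc-k-C-2 (suc k) = ≤-trans (≤-trans (≤-reflexive (sym (nC1≡n (suc k)))) (m≤m+n (suc k C 1) (suc k C 2))) (≤-reflexive (nCk+nC[k+1]≡[n+1]C[k+1] (suc k) 1))

-- That is, 8 k⁴ ≤ (k (k + 1))³.
k⁴≤C³ : ∀ k → 1 ≤ k → k * k * (k * k) ≤ (suc k C 2) ^ 3
k⁴≤C³ k@(suc m) _ = *-cancelˡ-≤ 8 (begin
  8 * (k * k * (k * k))                        ≤⟨ m≤m+n (8 * (k * k * (k * k))) (k * k * k * (m * m * m + 6 * (m * m) + 4 * m)) ⟩
  8 * (k * k * (k * k)) + k * k * k * (m * m * m + 6 * (m * m) + 4 * m)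
                                               ≡⟨ expand m ⟩
  k * suc k * (k * suc k * (k * suc k * 1))    ≡⟨ cong (_^ 3) (sym (2*[suc-k-C-2] k)) ⟩
  (2 * (suc k C 2)) ^ 3                        ≡⟨ cube (suc k C 2) ⟩
  8 * (suc k C 2) ^ 3 ∎)
  where
  open ≤-Reasoning
  expand : ∀ m → 8 * (suc m * suc m * (suc m * suc m)) + suc m * suc m * suc m * (m * m * m + 6 * (m * m) + 4 * m)
           ≡ suc m * suc (suc m) * (suc m * suc (suc m) * (suc m * suc (suc m) * 1))
  expand = ℕ-Solver.solve-∀
  cube : ∀ c → 2 * c * (2 * c * (2 * c * 1)) ≡ 8 * (c * (c * (c * 1)))
  cube = ℕ-Solver.solve-∀

-- The cost k² of an odd prime meets the allowance K ^ (3/2) because k⁴ ≤ C(k + 1, 2)³.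
tame-𝔱 : ∀ k → 1 ≤ k → Tame (suc k C 2) (𝔱 k)
tame-𝔱 k 1≤k = tame (≤-trans 1≤k (k≤suc-k-C-2 k)) (𝔱[k,1]≤1 k) (𝔱[2b]≤ k) λ p b isPrime 1≤b → begin
    𝔱 k (p * b) * 𝔱 k (p * b)                ≤⟨ *-mono-≤ (𝔱[pb]≤ k p b 1≤k isPrime 1≤b) (𝔱[pb]≤ k p b 1≤k isPrime 1≤b) ⟩
    k * k * 𝔱 k b * (k * k * 𝔱 k b)          ≡⟨ regroup (k * k) (𝔱 k b) ⟩
    k * k * (k * k) * (𝔱 k b * 𝔱 k b)        ≤⟨ *-monoˡ-≤ (𝔱 k b * 𝔱 k b) (k⁴≤C³ k 1≤k) ⟩
    (suc k C 2) ^ 3 * (𝔱 k b * 𝔱 k b) ∎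
  where
  open ≤-Reasoning
  regroup : ∀ c x → c * x * (c * x) ≡ c * c * (x * x)
  regroup = ℕ-Solver.solve-∀

1+2iᴳ 2ᴳ : ℤ[i]
1+2iᴳ = ℤ.1ℤ + (ℤ.+ 2) i
2ᴳ = ℕ→ℤ[i] 2

module _ (k : ℕ) where

  countᴳ : List (List ℤ[i]) → ℤ[i] → ℕ
  countᴳ 𝔡ss α = length (filter (λ 𝔡s → associated? (∏ᴳ 𝔡s) α) 𝔡ss)

  T₂ : List (List ℤ[i])
  T₂ = tuples k (representatives 2)

  prepend-counted : ∀ ξ β α rest → Associated (ξ *ᴳ β) α → countᴳ T₂ β + countᴳ rest α ≤ countᴳ (map (ξ ∷_) T₂ ++ rest) α
  prepend-counted ξ β α rest ξβ~α = length-filter-map-++ (λ 𝔡s → associated? (∏ᴳ 𝔡s) β) (λ 𝔡s → associated? (∏ᴳ 𝔡s) α)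
    (ξ ∷_) (λ a → associated-trans (associated-*ˡ ξ a) ξβ~α) T₂ rest

  append-counted : ∀ ξ α rest → countᴳ rest α ≤ countᴳ (map (ξ ∷_) T₂ ++ rest) α
  append-counted ξ α rest = ≤-trans (m≤n+m (countᴳ rest α) _)
    (length-filter-map-++ {P = λ _ → ⊥} (λ _ → no λ ()) (λ 𝔡s → associated? (∏ᴳ 𝔡s) α) (ξ ∷_) (λ ()) T₂ rest)

  rest : List ℤ[i] → List (List ℤ[i])
  rest ξs = cartesianProductWith _∷_ ξs T₂

  -- `representatives 2` is 1, 1 + i, 1 + 2i, 2, 2 + i, 2 + 2i in this order; these are the suffixes
  -- met when `tuples (suc k)` is unfolded by first entry.
  ξs₁ ξs₂ ξs₃ ξs₄ : List ℤ[i]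
  ξs₄ = (ℤ.+ 2 + ℤ.+ 1 i) ∷ (ℤ.+ 2 + ℤ.+ 2 i) ∷ []
  ξs₃ = 2ᴳ ∷ ξs₄
  ξs₂ = 1+2iᴳ ∷ ξs₃
  ξs₁ = 1+iᴳ ∷ ξs₂

1≤count[1] : ∀ k → 1 ≤ countᴳ k (T₂ k) 1ᴳ
1≤count[1] zero    = ≤-refl
1≤count[1] (suc k) = ≤-trans (1≤count[1] k) (≤-trans (m≤m+n (countᴳ k (T₂ k) 1ᴳ) _) (prepend-counted k 1ᴳ 1ᴳ 1ᴳ (rest k (ξs₁ k)) (here refl)))

k≤count[1+i] : ∀ k → k ≤ countᴳ k (T₂ k) 1+iᴳ
k≤count[1+i] zero    = z≤n
k≤count[1+i] (suc k) = begin
  suc k                                                           ≡⟨ +-comm 1 k ⟩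
  k + 1                                                           ≤⟨ +-mono-≤ (k≤count[1+i] k) (1≤count[1] k) ⟩
  countᴳ k (T₂ k) 1+iᴳ + countᴳ k (T₂ k) 1ᴳ                       ≤⟨ +-monoʳ-≤ (countᴳ k (T₂ k) 1+iᴳ) (≤-trans (m≤m+n (countᴳ k (T₂ k) 1ᴳ) _) (prepend-counted k 1+iᴳ 1ᴳ 1+iᴳ (rest k (ξs₂ k)) (here refl))) ⟩
  countᴳ k (T₂ k) 1+iᴳ + countᴳ k (rest k (ξs₁ k)) 1+iᴳ           ≤⟨ prepend-counted k 1ᴳ 1+iᴳ 1+iᴳ (rest k (ξs₁ k)) (here refl) ⟩
  countᴳ (suc k) (T₂ (suc k)) 1+iᴳ ∎
  where open ≤-Reasoning

-- First entries 1, 1 + i and 2 leave targets 2, 1 + i and 1, with at least C(k + 1, 2), k and 1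
-- tuples. These add up to C(k + 2, 2).
C≤𝔱[k,2] : ∀ k → suc k C 2 ≤ 𝔱 k 2
C≤𝔱[k,2] zero    = z≤n
C≤𝔱[k,2] (suc k) = begin
  suc (suc k) C 2                                                 ≡⟨ sym (nCk+nC[k+1]≡[n+1]C[k+1] (suc k) 1) ⟩
  suc k C 1 + suc k C 2                                           ≡⟨ trans (cong (_+ suc k C 2) (nC1≡n (suc k))) (+-comm (suc k) (suc k C 2)) ⟩
  suc k C 2 + suc k                                               ≤⟨ +-mono-≤ (C≤𝔱[k,2] k) (≤-trans (≤-reflexive (+-comm 1 k)) (+-mono-≤ (k≤count[1+i] k) (1≤count[1] k))) ⟩
  c 2ᴳ + (c 1+iᴳ + c 1ᴳ)                                          ≤⟨ +-monoʳ-≤ (c 2ᴳ) (+-monoʳ-≤ (c 1+iᴳ) from-2) ⟩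
  c 2ᴳ + (c 1+iᴳ + countᴳ k (rest k (ξs₂ k)) 2ᴳ)                  ≤⟨ +-monoʳ-≤ (c 2ᴳ) (prepend-counted k 1+iᴳ 1+iᴳ 2ᴳ (rest k (ξs₂ k)) (there (there (here refl)))) ⟩
  c 2ᴳ + countᴳ k (rest k (ξs₁ k)) 2ᴳ                             ≤⟨ prepend-counted k 1ᴳ 2ᴳ 2ᴳ (rest k (ξs₁ k)) (here refl) ⟩
  𝔱 (suc k) 2 ∎
  where
  open ≤-Reasoning
  c : ℤ[i] → ℕ
  c = countᴳ k (T₂ k)
  from-2 : c 1ᴳ ≤ countᴳ k (rest k (ξs₂ k)) 2ᴳ
  from-2 = ≤-trans (m≤m+n (c 1ᴳ) _) (≤-trans (prepend-counted k 2ᴳ 1ᴳ 2ᴳ (rest k (ξs₄ k)) (here refl)) (append-counted k 1+2iᴳ 2ᴳ (rest k (ξs₃ k))))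

-- Abundance of primes

-- A greedy choice of a maximal independent sublist. It is used for Gaussian primes up to
-- association and for rational primes up to equality.
independent-representatives : ∀ {A : Set} {R : A → A → Set} → (∀ x y → Dec (R x y)) → (∀ {x} → R x x) → ∀ xs →
  ∃ λ ys → (∀ {y} → y ∈ ys → y ∈ xs) × AllPairs (λ x y → ¬ R x y) ys × All (λ x → Any (R x) ys) xs
independent-representatives R? R-refl []       = [] , (λ ()) , [] , []
independent-representatives {R = R} R? R-refl (x ∷ xs) =
  let ys , ys⊆xs , independent , covered = independent-representatives R? R-refl xs
  in extend ys ys⊆xs independent covered (any? (R? x) ys)
  where
  extend : ∀ ys → (∀ {y} → y ∈ ys → y ∈ xs) → AllPairs (λ x y → ¬ R x y) ys → All (λ x → Any (R x) ys) xs → Dec (Any (R x) ys) →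
           ∃ λ ys → (∀ {y} → y ∈ ys → y ∈ x ∷ xs) × AllPairs (λ x y → ¬ R x y) ys × All (λ x → Any (R x) ys) (x ∷ xs)
  extend ys ys⊆xs independent covered (yes p) = ys , (λ y∈ → there (ys⊆xs y∈)) , independent , p ∷ covered
  extend ys ys⊆xs independent covered (no ¬p) = x ∷ ys , (λ { (here e) → here e ; (there y∈) → there (ys⊆xs y∈) })
    , All.¬Any⇒All¬ ys ¬p ∷ independent , here R-refl ∷ All.map there covered

norm∣n⇒∣ᴳ : ∀ π {n} → norm π ∣ n → π ∣ᴳ ℕ→ℤ[i] n
norm∣n⇒∣ᴳ π {n} (divides q n≡) = (ℕ→ℤ[i] q *ᴳ conj π) by
  trans (*ᴳ-assoc (ℕ→ℤ[i] q) (conj π) π) (trans (cong (ℕ→ℤ[i] q *ᴳ_) (conj-*ᴳ π)) (trans (sym (ℕ→ℤ[i]-* q (norm π))) (cong ℕ→ℤ[i] (sym n≡))))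

1≤n⇒n∣n! : ∀ {n} → 1 ≤ n → n ∣ n !
1≤n⇒n∣n! {suc n} _ = divides (n !) (*-comm (suc n) (n !))

same-quotient⇒close : ∀ m n D .{{_ : NonZero D}} → m / D ≡ n / D → ℤ.∣ m ℤ.⊖ n ∣ < D
same-quotient⇒close m n D e = choose (≤-total m n)
  where
  gap : ∀ m n → m / D ≡ n / D → n ∸ m < D
  gap m n e = m<n+o⇒m∸n<o n m (<-≤-trans (m<suc[m/n]*n n D)
    (≤-trans (+-monoʳ-≤ D (≤-trans (≤-reflexive (cong (_* D) (sym e))) (m/n*n≤m m D))) (≤-reflexive (+-comm D m))))
  choose : m ≤ n ⊎ n ≤ m → ℤ.∣ m ℤ.⊖ n ∣ < D
  choose (inj₁ m≤n) = subst (_< D) (sym (trans (cong ℤ.∣_∣ (ℤₚ.⊖-≤ m≤n)) (ℤₚ.∣-i∣≡∣i∣ (ℤ.+ (n ∸ m))))) (gap m n e)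
  choose (inj₂ n≤m) = subst (_< D) (sym (cong ℤ.∣_∣ (ℤₚ.⊖-≥ n≤m))) (gap n m (sym e))

-- The real part is shifted by 1 to be positive, so that 1 + Q times the point has norm greater than
-- 1 and hence a prime divisor.
point : ℕ × ℕ → ℤ[i]
point (x , y) = (ℤ.+ suc x) + (ℤ.+ y) i

same-cell⇒close : ∀ x y x′ y′ D .{{_ : NonZero D}} → x / D ≡ x′ / D → y / D ≡ y′ / D →
                  norm (point (x , y) +ᴳ -ᴳ point (x′ , y′)) < 2 * (D * D)
same-cell⇒close x y x′ y′ D ex ey = subst (_< 2 * (D * D)) (sym (cong₂ (λ a b → ℤ.∣ a ∣ ^ 2 + ℤ.∣ b ∣ ^ 2) (trans (difference (suc x) (suc x′)) (ℤₚ.[1+m]⊖[1+n]≡m⊖n x x′)) (difference y y′)))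
  (subst (ℤ.∣ x ℤ.⊖ x′ ∣ ^ 2 + ℤ.∣ y ℤ.⊖ y′ ∣ ^ 2 <_) (twice (D * D)) (+-mono-<-≤ (square-< (same-quotient⇒close x x′ D ex)) (<⇒≤ (square-< (same-quotient⇒close y y′ D ey)))))
  where
  difference : ∀ m n → ℤ.+ m ℤ.+ ℤ.- (ℤ.+ n) ≡ m ℤ.⊖ n
  difference m n = ℤₚ.m-n≡m⊖n m n
  square-< : ∀ {m} → m < D → m ^ 2 < D * D
  square-< {m} m<D = subst (_< D * D) (cong (m *_) (sym (*-identityʳ m))) (*-mono-< m<D m<D)
  twice : ∀ n → n + n ≡ 2 * n
  twice = ℕ-Solver.solve-∀

point-injective : ∀ {p q} → point p ≡ point q → p ≡ q
point-injective {x , y} {x′ , y′} e = cong₂ _,_ (suc-injective (ℤₚ.+-injective (proj₁ (re-im e)))) (ℤₚ.+-injective (proj₂ (re-im e)))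

-- The numbers 1 + Q β with Q = z ! have no prime divisor of norm at most z. A prime
-- of norm at least 2 · 4 ^ j divides at most one of them in each cell of side 2 ^ j.
module Sieve (z b : ℕ) where

  Q : ℕ
  Q = z !

  1≤Q : 1 ≤ Q
  1≤Q = >-nonZero⁻¹ Q {{z !≢0}}

  number : ℕ × ℕ → ℤ[i]
  number p = 1ᴳ +ᴳ ℕ→ℤ[i] Q *ᴳ point p

  number≡ : ∀ x y → number (x , y) ≡ (ℤ.+ suc (Q * suc x)) + (ℤ.+ (Q * y)) i
  number≡ x y = cong₂ _+_i
    (cong (ℤ._+_ ℤ.1ℤ) (trans (real (ℤ.+ Q) (ℤ.+ suc x) (ℤ.+ y)) (sym (ℤₚ.pos-* Q (suc x)))))
    (trans (imaginary (ℤ.+ Q) (ℤ.+ suc x) (ℤ.+ y)) (sym (ℤₚ.pos-* Q y)))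
    where
    real : ∀ q a b → q ℤ.* a ℤ.- ℤ.0ℤ ℤ.* b ≡ q ℤ.* a
    real = ℤ-Solver.solve-∀
    imaginary : ∀ q a b → ℤ.0ℤ ℤ.+ (q ℤ.* b ℤ.+ ℤ.0ℤ ℤ.* a) ≡ q ℤ.* b
    imaginary = ℤ-Solver.solve-∀

  norm-number : ∀ x y → norm (number (x , y)) ≡ suc (Q * suc x) ^ 2 + (Q * y) ^ 2
  norm-number x y = cong norm (number≡ x y)

  1<norm-number : ∀ p → 1 < norm (number p)
  1<norm-number (x , y) = subst (1 <_) (sym (norm-number x y)) (<-≤-trans 1<N (≤-trans (m≤m*n N (N * 1) {{m*n≢0 N 1}}) (m≤m+n (N ^ 2) ((Q * y) ^ 2))))
    where
    N : ℕ
    N = suc (Q * suc x)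
    1<N : 1 < N
    1<N = s≤s (*-mono-≤ 1≤Q (s≤s z≤n))

  prime-of : ℕ × ℕ → ℤ[i]
  prime-of p = proj₁ (prime-divisor (number p) (1<norm-number p))

  prime-of-prime : ∀ p → GaussianPrime (prime-of p)
  prime-of-prime p = proj₁ (proj₂ (prime-divisor (number p) (1<norm-number p)))

  prime-of-∣ : ∀ p → prime-of p ∣ᴳ number p
  prime-of-∣ p = proj₂ (proj₂ (prime-divisor (number p) (1<norm-number p)))

  ∣number⇒∤Q : ∀ {π} p → GaussianPrime π → π ∣ᴳ number p → ¬ (π ∣ᴳ ℕ→ℤ[i] Q)
  ∣number⇒∤Q {π} p prime π∣ π∣Q = p∤1 prime (subst (π ∣ᴳ_) (isolate 1ᴳ (ℕ→ℤ[i] Q) (point p)) (∣ᴳ-minus π∣ (∣ᴳ-*ʳ (point p) π∣Q)))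
    where
    isolate : ∀ ι q β → (ι +ᴳ q *ᴳ β) +ᴳ -ᴳ (q *ᴳ β) ≡ ι
    isolate = RingSolver.solve-∀ ℤ[i]-solverRing

  -- A prime divides its own norm, being a factor of π times its conjugate. A norm at most z divides
  -- z !, so the prime would divide Q and therefore 1.
  prime-of-large : ∀ p → z < norm (prime-of p)
  prime-of-large p = ≰⇒> λ N≤z → ∣number⇒∤Q p (prime-of-prime p) (prime-of-∣ p)
    (norm∣n⇒∣ᴳ (prime-of p) (∣-trans (1≤n⇒n∣n! (prime⇒1≤norm (prime-of-prime p))) (m≤n⇒m!∣n! N≤z)))

  -- π divides Q times the difference of the two points but does not divide Q, so it divides the
  -- difference, whose norm is smaller than that of π.
  cell-injective : ∀ {π} D .{{_ : NonZero D}} x y x′ y′ → GaussianPrime π → 2 * (D * D) ≤ norm π →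
                   π ∣ᴳ number (x , y) → π ∣ᴳ number (x′ , y′) → x / D ≡ x′ / D → y / D ≡ y′ / D → (x , y) ≡ (x′ , y′)
  cell-injective {π} D x y x′ y′ prime large π∣ π∣′ ex ey = point-injective (-ᴳ-zero β β′ (decide (split-∣ prime {ℕ→ℤ[i] Q} {β +ᴳ -ᴳ β′} π∣QΔ)))
    where
    β β′ : ℤ[i]
    β = point (x , y)
    β′ = point (x′ , y′)
    factor : ∀ ι q β β′ → (ι +ᴳ q *ᴳ β) +ᴳ -ᴳ (ι +ᴳ q *ᴳ β′) ≡ q *ᴳ (β +ᴳ -ᴳ β′)
    factor = RingSolver.solve-∀ ℤ[i]-solverRing
    π∣QΔ : π ∣ᴳ (ℕ→ℤ[i] Q *ᴳ (β +ᴳ -ᴳ β′))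
    π∣QΔ = subst (π ∣ᴳ_) (factor 1ᴳ (ℕ→ℤ[i] Q) β β′) (∣ᴳ-minus π∣ π∣′)
    vanish : π ∣ᴳ (β +ᴳ -ᴳ β′) → Dec (β +ᴳ -ᴳ β′ ≡ 0ᴳ) → β +ᴳ -ᴳ β′ ≡ 0ᴳ
    vanish π∣Δ (yes Δ≡0) = Δ≡0
    vanish π∣Δ (no Δ≢0)  = ⊥-elim (<⇒≱ (same-cell⇒close x y x′ y′ D ex ey) (≤-trans large (norm-∣-≤ (≢0⇒1≤norm (β +ᴳ -ᴳ β′) Δ≢0) π∣Δ)))
    decide : π ∣ᴳ ℕ→ℤ[i] Q ⊎ π ∣ᴳ (β +ᴳ -ᴳ β′) → β +ᴳ -ᴳ β′ ≡ 0ᴳ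
    decide (inj₁ π∣Q) = ⊥-elim (∣number⇒∤Q (x , y) prime π∣ π∣Q)
    decide (inj₂ π∣Δ) = vanish π∣Δ ((β +ᴳ -ᴳ β′) ≟ᴳ 0ᴳ)

  items : List (ℕ × ℕ)
  items = cartesianProduct (upTo (2 ^ b)) (upTo (2 ^ b))

  items-unique : Unique items
  items-unique = Unique.cartesianProduct⁺ (Unique.upTo⁺ (2 ^ b)) (Unique.upTo⁺ (2 ^ b))

  primes-data : ∃ λ 𝔭s → (∀ {𝔭} → 𝔭 ∈ 𝔭s → 𝔭 ∈ map prime-of items) × AllPairs (λ 𝔭 𝔮 → ¬ Associated 𝔭 𝔮) 𝔭s × All (λ 𝔭 → Any (Associated 𝔭) 𝔭s) (map prime-of items)
  primes-data = independent-representatives associated? associated-refl (map prime-of items)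

  primes : List ℤ[i]
  primes = proj₁ primes-data

  primes-independent : AllPairs (λ 𝔭 𝔮 → ¬ Associated 𝔭 𝔮) primes
  primes-independent = proj₁ (proj₂ (proj₂ primes-data))

  ∈-primes : ∀ {𝔭} → 𝔭 ∈ primes → ∃ λ p → p ∈ items × 𝔭 ≡ prime-of p
  ∈-primes 𝔭∈ = ∈-map⁻ prime-of (proj₁ (proj₂ primes-data) 𝔭∈)

  items-below : ℕ → List (ℕ × ℕ)
  items-below u = filter (λ p → norm (prime-of p) <? u) items

  primes-below : ℕ → List ℤ[i]
  primes-below u = filter (λ 𝔭 → norm 𝔭 <? u) primes

  -- An item whose prime has norm at least 2 · 4 ^ j is determined by its cell of side 2 ^ j and the
  -- class of its prime; there are 4 ^ c cells. The other items are simply counted again.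
  sieve-step : ∀ j c u → j + c ≡ b → length (items-below u) ≤ length (items-below (2 * 4 ^ j)) + 2 ^ c * 2 ^ c * length (primes-below u)
  sieve-step j c u j+c≡b = subst (length (items-below u) ≤_) length-targets
    (unique-length-≤-by R (Unique.filter⁺ (λ p → norm (prime-of p) <? u) items-unique) (λ {p} {q} {t} → R-injective p q t) covered)
    where
    D : ℕ
    D = 2 ^ j
    instance
      D≢0 : NonZero D
      D≢0 = m^n≢0 2 j
    cells : List (ℕ × ℕ)
    cells = cartesianProduct (upTo (2 ^ c)) (upTo (2 ^ c))
    Target : Set
    Target = (ℕ × ℕ) ⊎ ((ℕ × ℕ) × ℤ[i])
    targets : List Target
    targets = map inj₁ (items-below (2 * 4 ^ j)) ++ map inj₂ (cartesianProduct cells (primes-below u))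
    length-targets : length targets ≡ length (items-below (2 * 4 ^ j)) + 2 ^ c * 2 ^ c * length (primes-below u)
    length-targets = trans (length-++ (map inj₁ (items-below (2 * 4 ^ j))))
      (cong₂ _+_ (length-map inj₁ (items-below (2 * 4 ^ j)))
        (trans (length-map inj₂ (cartesianProduct cells (primes-below u)))
          (trans (length-cartesianProductWith _,_ cells (primes-below u))
            (cong (_* length (primes-below u)) (trans (length-cartesianProductWith _,_ (upTo (2 ^ c)) (upTo (2 ^ c))) (cong₂ _*_ (length-upTo (2 ^ c)) (length-upTo (2 ^ c))))))))
    cell : ℕ × ℕ → ℕ × ℕ
    cell (x , y) = x / D , y / D
    R : ℕ × ℕ → Target → Set
    R p (inj₁ q)       = p ≡ q
    R p (inj₂ (e , 𝔭)) = 2 * 4 ^ j ≤ norm (prime-of p) × cell p ≡ e × Associated (prime-of p) 𝔭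
    4^j≡D² : 4 ^ j ≡ D * D
    4^j≡D² = trans (^-*-assoc 2 2 j) (trans (cong (λ e → 2 ^ (j + e)) (+-identityʳ j)) (^-distribˡ-+-* 2 j j))
    R-injective : ∀ p q t → R p t → R q t → p ≡ q
    R-injective p q (inj₁ _) e e′ = trans e (sym e′)
    R-injective p@(x , y) q@(x′ , y′) (inj₂ (_ , 𝔭)) (large , e , a) (_ , e′ , a′) =
      cell-injective D x y x′ y′ (prime-of-prime p) (subst (λ n → 2 * n ≤ norm (prime-of p)) 4^j≡D² large) (prime-of-∣ p)
        (∣ᴳ-trans (associated-∣ {prime-of q} {prime-of p} (associated-trans {prime-of q} {𝔭} {prime-of p} a′ (associated-sym a))) (prime-of-∣ q))
        (cong proj₁ (trans e (sym e′))) (cong proj₂ (trans e (sym e′)))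
    bound : ∀ {x} → x ∈ upTo (2 ^ b) → x / D ∈ upTo (2 ^ c)
    bound {x} x∈ = ∈-upTo⁺ (m<n*o⇒m/o<n (subst (x <_) (trans (cong (2 ^_) (trans (sym j+c≡b) (+-comm j c))) (^-distribˡ-+-* 2 c j)) (∈-upTo⁻ x∈)))
    covered : ∀ {p} → p ∈ items-below u → ∃ λ t → t ∈ targets × R p t
    covered {p} p∈ = choose (∈-filter⁻ (λ p → norm (prime-of p) <? u) {xs = items} p∈) (norm (prime-of p) <? 2 * 4 ^ j)
      where
      choose : p ∈ items × norm (prime-of p) < u → Dec (norm (prime-of p) < 2 * 4 ^ j) → ∃ λ t → t ∈ targets × R p t
      choose (p∈ , _)  (yes small) = inj₁ p , ∈-++⁺ˡ (∈-map⁺ inj₁ (∈-filter⁺ (λ p → norm (prime-of p) <? 2 * 4 ^ j) p∈ small)) , refl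
      choose (p∈ , <u) (no large)  =
        let 𝔭 , 𝔭∈ , a = find (All.lookup (proj₂ (proj₂ (proj₂ primes-data))) (∈-map⁺ prime-of p∈))
            x∈ , y∈ = ∈-cartesianProduct⁻ (upTo (2 ^ b)) (upTo (2 ^ b)) p∈
        in inj₂ (cell p , 𝔭)
         , ∈-++⁺ʳ (map inj₁ (items-below (2 * 4 ^ j))) (∈-map⁺ inj₂ (∈-cartesianProduct⁺ (∈-cartesianProduct⁺ (bound x∈) (bound y∈))
             (∈-filter⁺ (λ 𝔭 → norm 𝔭 <? u) 𝔭∈ (subst (_< u) (associated-norm {prime-of p} {𝔭} a) <u))))
         , ≮⇒≥ large , refl , a

  -- The bound Q ≤ 2 ^ Q is crude but harmless: Q is fixed before b grows, so the exponent is 2 b +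
  -- O(1).
  norm-primes-≤ : ∀ {𝔭} → 𝔭 ∈ primes → norm 𝔭 ≤ 2 ^ (3 + 2 * Q + 2 * b)
  norm-primes-≤ {𝔭} 𝔭∈ = from (∈-primes 𝔭∈)
    where
    open ≤-Reasoning
    from : (∃ λ p → p ∈ items × 𝔭 ≡ prime-of p) → norm 𝔭 ≤ 2 ^ (3 + 2 * Q + 2 * b)
    from ((x , y) , p∈ , 𝔭≡) = begin
      norm 𝔭                                       ≡⟨ cong norm 𝔭≡ ⟩
      norm (prime-of (x , y))                       ≤⟨ norm-∣-≤ (<⇒≤ (1<norm-number (x , y))) (prime-of-∣ (x , y)) ⟩
      norm (number (x , y))                         ≡⟨ norm-number x y ⟩
      suc (Q * suc x) ^ 2 + (Q * y) ^ 2             ≤⟨ +-mono-≤ (^-monoˡ-≤ 2 (+-mono-≤ 1≤E (*-mono-≤ Q≤ (∈-upTo⁻ x∈)))) (^-monoˡ-≤ 2 (*-mono-≤ Q≤ (<⇒≤ (∈-upTo⁻ y∈)))) ⟩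
      (E + E) ^ 2 + E ^ 2                           ≤⟨ m≤m+n _ (3 * (E * E)) ⟩
      (E + E) ^ 2 + E ^ 2 + 3 * (E * E)             ≡⟨ eightfold E ⟩
      8 * (E * E)                                   ≡⟨ cong (8 *_) (cong₂ _*_ (sym (^-distribˡ-+-* 2 Q b)) (sym (^-distribˡ-+-* 2 Q b))) ⟩
      8 * (2 ^ (Q + b) * 2 ^ (Q + b))               ≡⟨ cong (8 *_) (sym (^-distribˡ-+-* 2 (Q + b) (Q + b))) ⟩
      2 ^ 3 * 2 ^ (Q + b + (Q + b))                 ≡⟨ sym (^-distribˡ-+-* 2 3 (Q + b + (Q + b))) ⟩
      2 ^ (3 + (Q + b + (Q + b)))                   ≡⟨ cong (2 ^_) (exponent Q b) ⟩
      2 ^ (3 + 2 * Q + 2 * b) ∎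
      where
      E : ℕ
      E = 2 ^ Q * 2 ^ b
      1≤E : 1 ≤ E
      1≤E = *-mono-≤ (m^n>0 2 Q) (m^n>0 2 b)
      Q≤ : Q ≤ 2 ^ Q
      Q≤ = <⇒≤ (n<2^n Q)
      x∈ : x ∈ upTo (2 ^ b)
      x∈ = proj₁ (∈-cartesianProduct⁻ (upTo (2 ^ b)) (upTo (2 ^ b)) p∈)
      y∈ : y ∈ upTo (2 ^ b)
      y∈ = proj₂ (∈-cartesianProduct⁻ (upTo (2 ^ b)) (upTo (2 ^ b)) p∈)
      eightfold : ∀ e → (e + e) * ((e + e) * 1) + e * (e * 1) + 3 * (e * e) ≡ 8 * (e * e)
      eightfold = ℕ-Solver.solve-∀
      exponent : ∀ q b → 3 + (q + b + (q + b)) ≡ 3 + 2 * q + 2 * b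
      exponent = ℕ-Solver.solve-∀

  primes-prime : ∀ {𝔭} → 𝔭 ∈ primes → GaussianPrime 𝔭
  primes-prime 𝔭∈ = let p , _ , 𝔭≡ = ∈-primes 𝔭∈ in subst GaussianPrime (sym 𝔭≡) (prime-of-prime p)

  -- For X = 2 · 4 ^ (j + 1) this provides a number of primes of norm below X of order at least X /
  -- (log X)².
  Abundant : ℕ → ℕ → Set
  Abundant j₀ j = j₀ ≤ j × 4 ^ j < 4 * (j * suc j) * length (primes-below (2 * 4 ^ suc j))

  4^b≡ : 4 ^ b ≡ 2 ^ b * 2 ^ b
  4^b≡ = trans (^-*-assoc 2 2 b) (trans (cong (λ e → 2 ^ (b + e)) (+-identityʳ b)) (^-distribˡ-+-* 2 b b))

  -- The weights j₀ / (j (j + 1)) telescope to 1 - j₀ / (j₀ + d).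
  telescope : ∀ j₀ → z ≡ 2 * 4 ^ j₀ → 1 ≤ j₀ → ∀ d → j₀ + d ≤ b →
              (∃ λ j → Abundant j₀ j) ⊎ 4 * length (items-below (2 * 4 ^ (j₀ + d))) * (j₀ + d) ≤ 4 ^ b * d
  telescope j₀ z≡ 1≤j₀ zero _ = inj₂ (subst (λ m → 4 * m * (j₀ + 0) ≤ 4 ^ b * 0) (sym none) z≤n)
    where
    none : length (items-below (2 * 4 ^ (j₀ + 0))) ≡ 0
    none = cong length (filter-none (λ p → norm (prime-of p) <? 2 * 4 ^ (j₀ + 0)) {items} (All.tabulate λ {p} _ →
      <⇒≯ (subst (λ j → 2 * 4 ^ j < norm (prime-of p)) (sym (+-identityʳ j₀)) (subst (_< norm (prime-of p)) z≡ (prime-of-large p)))))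
  telescope j₀ z≡ 1≤j₀ (suc d) j≤b = step (telescope j₀ z≡ 1≤j₀ d (<⇒≤ j<b))
    where
    open ≤-Reasoning
    j c A A′ n′ : ℕ
    j = j₀ + d
    c = b ∸ j
    A = length (items-below (2 * 4 ^ j))
    A′ = length (items-below (2 * 4 ^ suc j))
    n′ = length (primes-below (2 * 4 ^ suc j))
    j<b : j < b
    j<b = subst (_≤ b) (+-suc j₀ d) j≤b
    1≤j : 1 ≤ j
    1≤j = ≤-trans 1≤j₀ (m≤m+n j₀ d)
    j+c≡b : j + c ≡ b
    j+c≡b = m+[n∸m]≡n (<⇒≤ j<b)
    C*4^j : 2 ^ c * 2 ^ c * 4 ^ j ≡ 4 ^ b
    C*4^j = trans (cong (_* 4 ^ j) (trans (sym (^-distribˡ-+-* 2 c c)) (trans (cong (λ e → 2 ^ (c + e)) (sym (+-identityʳ c))) (sym (^-*-assoc 2 2 c)))))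
      (trans (sym (^-distribˡ-+-* 4 c j)) (cong (4 ^_) (trans (+-comm c j) j+c≡b)))
    Goal : Set
    Goal = (∃ λ j → Abundant j₀ j) ⊎ 4 * length (items-below (2 * 4 ^ (j₀ + suc d))) * (j₀ + suc d) ≤ 4 ^ b * suc d
    -- If the prime count at j is low, the items newly counted make up at most j₀ / (4 j (j + 1)) of
    -- all 4 ^ b, by multiplying `few` with the number of cells.
    scarce : 4 * A * j ≤ 4 ^ b * d → 4 * (j * suc j) * n′ ≤ 4 ^ j * j₀ → 4 * A′ * suc j ≤ 4 ^ b * suc d
    scarce IH few = *-cancelʳ-≤ (4 * A′ * suc j) (4 ^ b * suc d) j {{>-nonZero 1≤j}} (begin
      4 * A′ * suc j * j                                           ≤⟨ *-monoˡ-≤ j (*-monoˡ-≤ (suc j) (*-monoʳ-≤ 4 (sieve-step j c (2 * 4 ^ suc j) j+c≡b))) ⟩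
      4 * (A + 2 ^ c * 2 ^ c * n′) * suc j * j                     ≡⟨ regroup A (2 ^ c * 2 ^ c) n′ j ⟩
      4 * A * j * suc j + 2 ^ c * 2 ^ c * (4 * (j * suc j) * n′)   ≤⟨ +-mono-≤ (*-monoˡ-≤ (suc j) IH) (*-monoʳ-≤ (2 ^ c * 2 ^ c) few) ⟩
      4 ^ b * d * suc j + 2 ^ c * 2 ^ c * (4 ^ j * j₀)             ≡⟨ cong (4 ^ b * d * suc j +_) (trans (sym (*-assoc (2 ^ c * 2 ^ c) (4 ^ j) j₀)) (cong (_* j₀) C*4^j)) ⟩
      4 ^ b * d * suc j + 4 ^ b * j₀                               ≡⟨ collect (4 ^ b) d j₀ ⟩
      4 ^ b * suc d * j ∎)
      where
      regroup : ∀ A C n j → 4 * (A + C * n) * suc j * j ≡ 4 * A * j * suc j + C * (4 * (j * suc j) * n)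
      regroup = ℕ-Solver.solve-∀
      collect : ∀ B d j₀ → B * d * suc (j₀ + d) + B * j₀ ≡ B * suc d * (j₀ + d)
      collect = ℕ-Solver.solve-∀
    test : 4 * A * j ≤ 4 ^ b * d → Dec (4 ^ j * j₀ < 4 * (j * suc j) * n′) → Goal
    test _  (yes many) = inj₁ (j , m≤m+n j₀ d , ≤-<-trans (m≤m*n (4 ^ j) j₀ {{>-nonZero 1≤j₀}}) many)
    test IH (no few)   = inj₂ (subst (λ k → 4 * length (items-below (2 * 4 ^ k)) * k ≤ 4 ^ b * suc d) (sym (+-suc j₀ d)) (scarce IH (≮⇒≥ few)))
    step : (∃ λ j → Abundant j₀ j) ⊎ 4 * A * j ≤ 4 ^ b * d → Goal
    step (inj₁ found) = inj₁ found
    step (inj₂ IH)    = test IH (4 ^ j * j₀ <? 4 * (j * suc j) * n′)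

  -- If no scale from j₀ up to b is rich, at most a quarter of the items have a prime of norm below
  -- 2 · 4 ^ b. At scale b the whole square is one cell, so the remaining three quarters have
  -- pairwise non-associated primes.
  abundance : ∀ j₀ → z ≡ 2 * 4 ^ j₀ → 1 ≤ j₀ → j₀ ≤ b → (∃ λ j → Abundant j₀ j) ⊎ 3 * 4 ^ b ≤ 4 * length primes
  abundance j₀ z≡ 1≤j₀ j₀≤b = finish (telescope j₀ z≡ 1≤j₀ (b ∸ j₀) (≤-reflexive (m+[n∸m]≡n j₀≤b)))
    where
    open ≤-Reasoning
    u A : ℕ
    u = suc (2 ^ (3 + 2 * Q + 2 * b))
    A = length (items-below (2 * 4 ^ b))
    all-below : length (items-below u) ≡ 2 ^ b * 2 ^ b
    all-below = trans (cong length (filter-all (λ p → norm (prime-of p) <? u) {items} (All.tabulate λ {p} p∈ → s≤s (bounded p p∈))))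
      (trans (length-cartesianProductWith _,_ (upTo (2 ^ b)) (upTo (2 ^ b))) (cong₂ _*_ (length-upTo (2 ^ b)) (length-upTo (2 ^ b))))
      where
      bounded : ∀ p → p ∈ items → norm (prime-of p) ≤ 2 ^ (3 + 2 * Q + 2 * b)
      bounded p p∈ =
        let 𝔭 , 𝔭∈ , a = find (All.lookup (proj₂ (proj₂ (proj₂ primes-data))) (∈-map⁺ prime-of p∈))
        in subst (_≤ 2 ^ (3 + 2 * Q + 2 * b)) (sym (associated-norm {prime-of p} {𝔭} a)) (norm-primes-≤ 𝔭∈)
    finish : (∃ λ j → Abundant j₀ j) ⊎ 4 * length (items-below (2 * 4 ^ (j₀ + (b ∸ j₀)))) * (j₀ + (b ∸ j₀)) ≤ 4 ^ b * (b ∸ j₀) →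
             (∃ λ j → Abundant j₀ j) ⊎ 3 * 4 ^ b ≤ 4 * length primes
    finish (inj₁ found) = inj₁ found
    finish (inj₂ few)   = inj₂ (+-cancelˡ-≤ (4 ^ b) (3 * 4 ^ b) (4 * length primes) (begin
      4 ^ b + 3 * 4 ^ b                          ≡⟨ cong (4 *_) 4^b≡ ⟩
      4 * (2 ^ b * 2 ^ b)                        ≡⟨ cong (4 *_) (sym all-below) ⟩
      4 * length (items-below u)                 ≤⟨ *-monoʳ-≤ 4 (sieve-step b 0 u (+-identityʳ b)) ⟩
      4 * (A + 1 * length (primes-below u))      ≤⟨ *-monoʳ-≤ 4 (+-monoʳ-≤ A (≤-trans (≤-reflexive (*-identityˡ (length (primes-below u)))) (length-filter (λ 𝔭 → norm 𝔭 <? u) primes))) ⟩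
      4 * (A + length primes)                    ≡⟨ *-distribˡ-+ 4 A (length primes) ⟩
      4 * A + 4 * length primes                  ≤⟨ +-monoˡ-≤ (4 * length primes) 4A≤ ⟩
      4 ^ b + 4 * length primes ∎))
      where
      4A≤ : 4 * A ≤ 4 ^ b
      4A≤ = *-cancelʳ-≤ (4 * A) (4 ^ b) b {{>-nonZero (≤-trans 1≤j₀ j₀≤b)}}
        (≤-trans (subst (λ k → 4 * length (items-below (2 * 4 ^ k)) * k ≤ 4 ^ b * (b ∸ j₀)) (m+[n∸m]≡n j₀≤b) few) (*-monoʳ-≤ (4 ^ b) (m∸n≤m b j₀)))

-- At least X ^ (1 - ε) primes, for arbitrarily large X

record ManyPrimes (s N₀ : ℕ) : Set where
  field
    𝔭s          : List ℤ[i]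
    ρ ξ         : ℕ
    prime       : All GaussianPrime 𝔭s
    independent : AllPairs (λ 𝔭 𝔮 → ¬ Associated 𝔭 𝔮) 𝔭s
    bounded     : All (λ 𝔭 → norm 𝔭 ≤ 2 ^ ξ) 𝔭s
    many        : 2 ^ ρ ≤ length 𝔭s
    ratio       : ξ * s ≤ suc s * ρ
    large       : N₀ ≤ ρ

many-gaussian-primes : ∀ s N₀ → ManyPrimes s N₀
many-gaussian-primes s N₀ = choose-threshold (exponential-dominates-square (4 * (suc s * suc s)))
  where
  open ≤-Reasoning
  choose-threshold : (∃ λ κ₀ → ∀ κ → κ₀ ≤ κ → 4 * (suc s * suc s) * (suc κ * suc κ) ≤ 2 ^ κ) → ManyPrimes s N₀
  choose-threshold (κ₀ , dominates) = finish (abundance j₀ refl (m≤n+m 1 _) j₀≤b)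
    where
    j₀ Q b′ b : ℕ
    -- For j ≥ j₀ and κ = j / (s + 1), the terms ensure κ ≥ κ₀, 3 s ≤ j, N₀ ≤ j and j₀ ≥ 1 in turn.
    -- The first gives 4 j (j + 1) ≤ 2 ^ κ.
    j₀ = κ₀ * suc s + 3 * s + N₀ + 1
    Q = (2 * 4 ^ j₀) !
    -- Chosen after Q, so that s times the constant part 5 + 2 Q of the exponent ξ = 5 + 2 Q + 2 b′
    -- is at most b′.
    b′ = (5 + 2 * Q) * s + N₀ + j₀
    b = suc b′
    open Sieve (2 * 4 ^ j₀) b hiding (Q)
    j₀≤b : j₀ ≤ b
    j₀≤b = ≤-trans (m≤n+m j₀ ((5 + 2 * Q) * s + N₀)) (n≤1+n b′)
    finish : (∃ λ j → Abundant j₀ j) ⊎ 3 * 4 ^ b ≤ 4 * length primes → ManyPrimes s N₀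
    finish (inj₁ (j , j₀≤j , abundant)) = record
      { 𝔭s          = primes-below (2 * 4 ^ suc j)
      -- Dividing 4 ^ j by 4 j (j + 1) loses at most κ binary digits.
      ; ρ           = 2 * j ∸ κ
      ; ξ           = 3 + 2 * j
      ; prime       = All.tabulate λ 𝔭∈ → primes-prime (proj₁ (member 𝔭∈))
      ; independent = AllPairs.filter⁺ (λ 𝔭 → norm 𝔭 <? 2 * 4 ^ suc j) primes-independent
      ; bounded     = All.tabulate λ {𝔭} 𝔭∈ → <⇒≤ (subst (norm 𝔭 <_) 2*4^suc-j (proj₂ (member 𝔭∈)))
      ; many        = *-cancelˡ-≤ (2 ^ κ) {{m^n≢0 2 κ}} (begin
          2 ^ κ * 2 ^ (2 * j ∸ κ)     ≡⟨ sym (^-distribˡ-+-* 2 κ (2 * j ∸ κ)) ⟩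
          2 ^ (κ + (2 * j ∸ κ))       ≡⟨ cong (2 ^_) (m+[n∸m]≡n κ≤2j) ⟩
          2 ^ (2 * j)                 ≡⟨ sym (^-*-assoc 2 2 j) ⟩
          4 ^ j                       ≤⟨ <⇒≤ abundant ⟩
          4 * (j * suc j) * n         ≤⟨ *-monoˡ-≤ n (≤-trans 4j[j+1]≤ (dominates κ κ₀≤κ)) ⟩
          2 ^ κ * n ∎)
      ; ratio       = +-cancelʳ-≤ (suc s * κ) ((3 + 2 * j) * s) (suc s * (2 * j ∸ κ)) (begin
          (3 + 2 * j) * s + suc s * κ             ≡⟨ regroup s j (suc s * κ) ⟩
          2 * j * s + (suc s * κ + 3 * s)         ≤⟨ +-monoʳ-≤ (2 * j * s) (+-mono-≤ (≤-trans (≤-reflexive (*-comm (suc s) κ)) (m/n*n≤m j (suc s))) 3s≤j) ⟩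
          2 * j * s + (j + j)                     ≡⟨ collect s j ⟩
          suc s * (2 * j)                         ≡⟨ cong (suc s *_) (sym (m∸n+n≡m κ≤2j)) ⟩
          suc s * (2 * j ∸ κ + κ)                 ≡⟨ *-distribˡ-+ (suc s) (2 * j ∸ κ) κ ⟩
          suc s * (2 * j ∸ κ) + suc s * κ ∎)
      ; large       = +-cancelʳ-≤ κ N₀ (2 * j ∸ κ) (begin
          N₀ + κ                 ≤⟨ +-mono-≤ N₀≤j κ≤j ⟩
          j + j                  ≡⟨ cong (j +_) (sym (+-identityʳ j)) ⟩
          2 * j                  ≡⟨ sym (m∸n+n≡m κ≤2j) ⟩
          2 * j ∸ κ + κ ∎)
      }
      where
      κ n : ℕ
      κ = j / suc s
      n = length (primes-below (2 * 4 ^ suc j))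
      member : ∀ {𝔭} → 𝔭 ∈ primes-below (2 * 4 ^ suc j) → 𝔭 ∈ primes × norm 𝔭 < 2 * 4 ^ suc j
      member = ∈-filter⁻ (λ 𝔭 → norm 𝔭 <? 2 * 4 ^ suc j) {xs = primes}
      2*4^suc-j : 2 * 4 ^ suc j ≡ 2 ^ (3 + 2 * j)
      2*4^suc-j = trans (cong (λ m → 2 * (4 * m)) (^-*-assoc 2 2 j)) (sym (trans (^-distribˡ-+-* 2 3 (2 * j)) (*-assoc 2 4 (2 ^ (2 * j)))))
      κ≤j : κ ≤ j
      κ≤j = m/n≤m j (suc s)
      κ≤2j : κ ≤ 2 * j
      κ≤2j = ≤-trans κ≤j (m≤m+n j (j + 0))
      3s≤j : 3 * s ≤ j
      3s≤j = ≤-trans (≤-trans (m≤n+m (3 * s) (κ₀ * suc s)) (≤-trans (m≤m+n _ N₀) (m≤m+n _ 1))) j₀≤j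
      N₀≤j : N₀ ≤ j
      N₀≤j = ≤-trans (≤-trans (m≤n+m N₀ (κ₀ * suc s + 3 * s)) (m≤m+n _ 1)) j₀≤j
      κ₀≤κ : κ₀ ≤ κ
      κ₀≤κ = subst (_≤ κ) (m*n/n≡m κ₀ (suc s)) (/-monoˡ-≤ (suc s)
        (≤-trans (≤-trans (m≤m+n (κ₀ * suc s) (3 * s)) (≤-trans (m≤m+n _ N₀) (m≤m+n _ 1))) j₀≤j))
      4j[j+1]≤ : 4 * (j * suc j) ≤ 4 * (suc s * suc s) * (suc κ * suc κ)
      4j[j+1]≤ = ≤-trans (*-monoʳ-≤ 4 (*-mono-≤ (<⇒≤ (m<suc[m/n]*n j (suc s))) (m<suc[m/n]*n j (suc s)))) (≤-reflexive (square (suc κ) (suc s)))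
        where
        square : ∀ k t → 4 * (k * t * (k * t)) ≡ 4 * (t * t) * (k * k)
        square = ℕ-Solver.solve-∀
      regroup : ∀ s j x → (3 + 2 * j) * s + x ≡ 2 * j * s + (x + 3 * s)
      regroup = ℕ-Solver.solve-∀
      collect : ∀ s j → 2 * j * s + (j + j) ≡ suc s * (2 * j)
      collect = ℕ-Solver.solve-∀
    finish (inj₂ abundant) = record
      { 𝔭s          = primes
      -- Three quarters of 4 ^ b are weakened to the power 4 ^ (b - 1) = 2 ^ (2 b′).
      ; ρ           = 2 * b′
      ; ξ           = 3 + 2 * Q + 2 * b
      ; prime       = All.tabulate primes-prime
      ; independent = primes-independent
      ; bounded     = All.tabulate norm-primes-≤
      ; many        = *-cancelˡ-≤ 4 (begin
          4 * 2 ^ (2 * b′)        ≡⟨ cong (4 *_) (sym (^-*-assoc 2 2 b′)) ⟩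
          4 ^ b                   ≤⟨ m≤m+n (4 ^ b) (2 * 4 ^ b) ⟩
          3 * 4 ^ b               ≤⟨ abundant ⟩
          4 * length primes ∎)
      ; ratio       = begin
          (3 + 2 * Q + 2 * suc b′) * s          ≡⟨ regroup Q b′ s ⟩
          2 * b′ * s + (5 + 2 * Q) * s          ≤⟨ +-monoʳ-≤ (2 * b′ * s) (≤-trans (≤-trans (m≤m+n ((5 + 2 * Q) * s) N₀) (m≤m+n _ j₀)) (m≤m+n b′ (b′ + 0))) ⟩
          2 * b′ * s + 2 * b′                   ≡⟨ collect b′ s ⟩
          suc s * (2 * b′) ∎
      ; large       = ≤-trans (≤-trans (m≤n+m N₀ ((5 + 2 * Q) * s)) (m≤m+n _ j₀)) (m≤m+n b′ (b′ + 0))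
      }
      where
      regroup : ∀ Q b s → (3 + 2 * Q + 2 * suc b) * s ≡ 2 * b * s + (5 + 2 * Q) * s
      regroup = ℕ-Solver.solve-∀
      collect : ∀ b s → 2 * b * s + 2 * b ≡ suc s * (2 * b)
      collect = ℕ-Solver.solve-∀

-- Values of exponential functions

prime-∣-prime⇒≡ : ∀ {p q} → Prime p → Prime q → p ∣ q → p ≡ q
prime-∣-prime⇒≡ {p} {q} p-prime q-prime p∣q = choose (prime⇒irreducible q-prime p∣q)
  where
  choose : p ≡ 1 ⊎ p ≡ q → p ≡ q
  choose (inj₁ p≡1) = ⊥-elim (<⇒≢ (prime⇒2≤ p-prime) (sym p≡1))
  choose (inj₂ p≡q) = p≡q

prime-∣-^ : ∀ {p} m n → Prime p → p ∣ m ^ n → p ∣ m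
prime-∣-^ m zero    p-prime p∣1 = ⊥-elim (<⇒≱ (prime⇒2≤ p-prime) (∣⇒≤ p∣1))
prime-∣-^ m (suc n) p-prime p∣  = [ (λ p∣m → p∣m) , prime-∣-^ m n p-prime ]′ (euclidsLemma m (m ^ n) p-prime p∣)

coprime-prime-power : ∀ {p m} a → Prime p → 1 ≤ m → ¬ (p ∣ m) → Coprime (p ^ a) m
coprime-prime-power {p} {m} a p-prime 1≤m p∤m {d} (d∣p^a , d∣m) = choose d d∣p^a d∣m
  where
  choose : ∀ d → d ∣ p ^ a → d ∣ m → d ≡ 1
  choose 0               _     0∣m = ⊥-elim (<⇒≢ 1≤m (sym (0∣⇒≡0 0∣m)))
  choose 1               _     _   = refl
  choose d@(suc (suc _)) d∣p^a d∣m =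
    let r , e , r-prime , d≡ = prime-factor d (s≤s (s≤s z≤n))
        r∣d = divides e (trans d≡ (*-comm r e))
    in ⊥-elim (p∤m (subst (_∣ m) (prime-∣-prime⇒≡ r-prime p-prime (prime-∣-^ p a r-prime (∣-trans r∣d d∣p^a))) (∣-trans r∣d d∣m)))

PrimePowersℕ : List (ℕ × ℕ) → Set
PrimePowersℕ pas = All (λ (p , a) → Prime p × 1 ≤ a) pas × AllPairs (λ (p , _) (q , _) → p ≢ q) pas

1≤prodOfPrimePowers : ∀ {pas} → PrimePowersℕ pas → 1 ≤ prodOfPowers pas
1≤prodOfPrimePowers ([] , _) = s≤s z≤n
1≤prodOfPrimePowers {(p , a) ∷ _} ((p-prime , _) ∷ primes , _ ∷ distinct) =
  *-mono-≤ (1≤m^n a (<⇒≤ (prime⇒2≤ p-prime))) (1≤prodOfPrimePowers (primes , distinct))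

prime∤prodOfPowers : ∀ {p pas} → Prime p → PrimePowersℕ pas → All (λ (q , _) → p ≢ q) pas → ¬ (p ∣ prodOfPowers pas)
prime∤prodOfPowers p-prime ([] , _) _ p∣1 = <⇒≱ (prime⇒2≤ p-prime) (∣⇒≤ p∣1)
prime∤prodOfPowers {pas = (q , a) ∷ pas} p-prime ((q-prime , _) ∷ primes , _ ∷ distinct) (p≢q ∷ p≢) p∣ =
  [ (λ p∣q^a → p≢q (prime-∣-prime⇒≡ p-prime q-prime (prime-∣-^ q a p-prime p∣q^a)))
  , prime∤prodOfPowers p-prime (primes , distinct) p≢ ]′ (euclidsLemma (q ^ a) (prodOfPowers pas) p-prime p∣)

exponential-value : ∀ {g f} → IsExponential g f → ∀ {pas} → PrimePowersℕ pas → f (prodOfPowers pas) ≡ product (map (λ (_ , a) → g a) pas)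
exponential-value isExp ([] , _) = IsExponential.at-1 isExp
exponential-value {g} {f} isExp {(p , a) ∷ pas} ((p-prime , 1≤a) ∷ primes , p≢ ∷ distinct) =
  trans (multiplicative (p ^ a) (prodOfPowers pas) {{>-nonZero (1≤m^n a (<⇒≤ (prime⇒2≤ p-prime)))}} {{>-nonZero (1≤prodOfPrimePowers (primes , distinct))}}
          (coprime-prime-power a p-prime (1≤prodOfPrimePowers (primes , distinct)) (prime∤prodOfPowers p-prime (primes , distinct) p≢)))
    (cong₂ _*_ (at-prime-power p a {{>-nonZero 1≤a}} p-prime) (exponential-value isExp (primes , distinct)))
  where open IsExponential isExp

prime-power-partℕ : ∀ {p n} → Prime p → 1 ≤ n → ∃₂ λ a m → n ≡ p ^ a * m × 1 ≤ m × ¬ (p ∣ m)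
prime-power-partℕ {p} {n} p-prime 1≤n = go n 1≤n (<-wellFounded n)
  where
  go : ∀ n → 1 ≤ n → Acc _<_ n → ∃₂ λ a m → n ≡ p ^ a * m × 1 ≤ m × ¬ (p ∣ m)
  go n 1≤n (acc rec) = choose (p ∣? n)
    where
    choose : Dec (p ∣ n) → ∃₂ λ a m → n ≡ p ^ a * m × 1 ≤ m × ¬ (p ∣ m)
    choose (no p∤n)             = 0 , n , sym (*-identityˡ n) , 1≤n , p∤n
    choose (yes (divides q n≡)) =
      let 1≤q = n≢0⇒n>0 λ q≡0 → <⇒≢ 1≤n (sym (trans n≡ (cong (_* p) q≡0)))
          a , m , q≡ , 1≤m , p∤m = go q 1≤q (rec (subst (q <_) (sym n≡) (m<m*n q p {{>-nonZero 1≤q}} (prime⇒2≤ p-prime))))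
      in suc a , m , trans n≡ (trans (*-comm q p) (trans (cong (p *_) q≡) (sym (*-assoc p (p ^ a) m)))) , 1≤m , p∤m

p∣p^a*m : ∀ p a m → 1 ≤ a → p ∣ p ^ a * m
p∣p^a*m p (suc a) m _ = divides (p ^ a * m) (trans (*-assoc p (p ^ a) m) (*-comm p (p ^ a * m)))

prime-divides : ∀ {pas} → PrimePowersℕ pas → All (λ (p , _) → p ∣ prodOfPowers pas) pas
prime-divides ([] , _) = []
prime-divides {(p , a) ∷ pas} ((_ , 1≤a) ∷ primes , _ ∷ distinct) =
  p∣p^a*m p a (prodOfPowers pas) 1≤a ∷ All.map (λ q∣ → ∣-trans q∣ (divides (p ^ a) refl)) (prime-divides (primes , distinct))

factorisationℕ : ∀ n → 1 ≤ n → ∃ λ pas → PrimePowersℕ pas × n ≡ prodOfPowers pas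
factorisationℕ n 1≤n = go n 1≤n (<-wellFounded n)
  where
  go : ∀ n → 1 ≤ n → Acc _<_ n → ∃ λ pas → PrimePowersℕ pas × n ≡ prodOfPowers pas
  go 1               _   _         = [] , ([] , []) , refl
  go n@(suc (suc _)) 1≤n (acc rec) = from (prime-factor n (s≤s (s≤s z≤n)))
    where
    divide : ∀ {p} → Prime p → p ∣ n → (∃₂ λ a m → n ≡ p ^ a * m × 1 ≤ m × ¬ (p ∣ m)) → ∃ λ pas → PrimePowersℕ pas × n ≡ prodOfPowers pas
    divide p-prime p∣n (zero , m , n≡ , _ , p∤m) = ⊥-elim (p∤m (subst (_ ∣_) (trans n≡ (*-identityˡ m)) p∣n))
    divide {p} p-prime _ (suc a , m , n≡ , 1≤m , p∤m) =
      let 2≤p = prime⇒2≤ p-prime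
          2≤p^a = *-mono-≤ 2≤p (1≤m^n a (<⇒≤ 2≤p))
          pas , pp , m≡ = go m 1≤m (rec (subst (m <_) (trans (*-comm m (p ^ suc a)) (sym n≡)) (m<m*n m (p ^ suc a) {{>-nonZero 1≤m}} 2≤p^a)))
      in (p , suc a) ∷ pas
       , ( (p-prime , s≤s z≤n) ∷ proj₁ pp
         , All.map (λ q∣ p≡q → p∤m (subst (_∣ m) (sym p≡q) (subst (_ ∣_) (sym m≡) q∣))) (prime-divides pp) ∷ proj₂ pp)
       , trans n≡ (cong (p ^ suc a *_) m≡)
    from : (∃₂ λ p m → Prime p × n ≡ p * m) → ∃ λ pas → PrimePowersℕ pas × n ≡ prodOfPowers pas
    from (p , m , p-prime , n≡) = divide p-prime (divides m (trans n≡ (*-comm p m))) (prime-power-partℕ p-prime 1≤n)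

factoredℕ : ∀ {g f} → IsExponential g f → Factored (λ n → n) f g
factoredℕ {g} {f} isExp n 1≤n =
  let pas , pp , n≡ = factorisationℕ n 1≤n
  in pas , All.map (λ (p-prime , 1≤a) → prime⇒2≤ p-prime , 1≤a) (proj₁ pp) , n≡ , trans (cong f n≡) (exponential-value isExp pp)
   , λ μ → ≤-trans (count μ pas (proj₂ pp)) (m≤n*m (2 ^ μ) 8)
  where
  count : ∀ μ pas → AllPairs (λ (p , _) (q , _) → p ≢ q) pas → countBelow μ pas ≤ 2 ^ μ
  count μ pas distinct = subst (countBelow μ pas ≤_) (length-upTo (2 ^ μ)) (length-≤-by (λ (p , _) q → p ≡ q)
    (AllPairs.map (λ p≢q {_} e e′ → p≢q (trans e (sym e′))) (AllPairs.filter⁺ (λ (q , _) → q <? 2 ^ μ) distinct))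
    (All.tabulate λ pa∈ → lose (∈-upTo⁺ (proj₂ (∈-filter⁻ (λ (q , _) → q <? 2 ^ μ) {xs = pas} pa∈))) refl))

length-filter-map⁻ : ∀ {A B : Set} {P : A → Set} {Q : B → Set} (P? : Decidable P) (Q? : Decidable Q) f → (∀ {x} → Q (f x) → P x) → ∀ xs →
                     length (filter Q? (map f xs)) ≤ length (filter P? xs)
length-filter-map⁻ P? Q? f Q⇒P []       = z≤n
length-filter-map⁻ P? Q? f Q⇒P (x ∷ xs) with Q? (f x) | P? x
... | yes _  | yes _  = s≤s (length-filter-map⁻ P? Q? f Q⇒P xs)
... | yes qx | no ¬px = ⊥-elim (¬px (Q⇒P qx))
... | no _   | yes _  = m≤n⇒m≤1+n (length-filter-map⁻ P? Q? f Q⇒P xs)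
... | no _   | no _   = length-filter-map⁻ P? Q? f Q⇒P xs

-- Non-associated primes of norm below 2 ^ μ have distinct representatives in the box of size n = 2
-- ^ (μ / 2 + 1), since n² ≥ 2 ^ μ. The box has n (n + 1) ≤ 2 n² ≤ 8 · 2 ^ μ elements, which is the
-- origin of the 8.
count-small-primes : ∀ μ 𝔭as → PrimePowers 𝔭as → length (filter (λ (𝔭 , _) → norm 𝔭 <? 2 ^ μ) 𝔭as) ≤ 8 * 2 ^ μ
count-small-primes μ 𝔭as (primes , distinct) = ≤-trans covered size
  where
  open ≤-Reasoning
  e h n : ℕ
  e = μ / 2
  h = suc e
  n = 2 ^ h
  n²≡ : n * n ≡ 4 * 2 ^ (e * 2)
  n²≡ = trans (regroup (2 ^ e)) (cong (4 *_) (trans (sym (^-distribˡ-+-* 2 e e)) (cong (2 ^_) (sym (twice e)))))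
    where
    regroup : ∀ x → 2 * x * (2 * x) ≡ 4 * (x * x)
    regroup = ℕ-Solver.solve-∀
    twice : ∀ e → e * 2 ≡ e + e
    twice = ℕ-Solver.solve-∀
  2^μ≤n² : 2 ^ μ ≤ n * n
  2^μ≤n² = begin
    2 ^ μ            ≤⟨ ^-monoʳ-≤ 2 (<⇒≤ (m<suc[m/n]*n μ 2)) ⟩
    2 ^ (h * 2)      ≡⟨ sym (^-*-assoc 2 h 2) ⟩
    n ^ 2            ≡⟨ cong (n *_) (*-identityʳ n) ⟩
    n * n ∎
  in-box : ∀ {𝔭a} → GaussianPrime (proj₁ 𝔭a) → norm (proj₁ 𝔭a) < 2 ^ μ → Any (λ ρ → Associated (proj₁ 𝔭a) ρ) (representatives n)
  in-box {𝔭 , _} prime <2^μ =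
    let ρ , quadrant , ρ~𝔭 = quadrant-representative 𝔭 (prime⇒1≤norm prime)
    in lose (∈-representatives⁺ {n} {ρ} quadrant (≤-trans (≤-reflexive (associated-norm {ρ} {𝔭} ρ~𝔭)) (≤-trans (<⇒≤ <2^μ) 2^μ≤n²))) (associated-sym {ρ} {𝔭} ρ~𝔭)
  covered : length (filter (λ (𝔭 , _) → norm 𝔭 <? 2 ^ μ) 𝔭as) ≤ length (representatives n)
  covered = length-≤-by (λ (𝔭 , _) ρ → Associated 𝔭 ρ)
    (AllPairs.map (λ {(𝔭 , _) (𝔮 , _)} 𝔭≁𝔮 {ρ} a a′ → 𝔭≁𝔮 (associated-trans {𝔭} {ρ} {𝔮} a (associated-sym {𝔮} {ρ} a′)))
      (AllPairs.filter⁺ (λ (𝔭 , _) → norm 𝔭 <? 2 ^ μ) distinct))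
    (All.tabulate λ {𝔭a} 𝔭a∈ → let 𝔭a∈′ , <2^μ = ∈-filter⁻ (λ (𝔭 , _) → norm 𝔭 <? 2 ^ μ) {xs = 𝔭as} 𝔭a∈
                                in in-box {𝔭a} (proj₁ (All.lookup primes 𝔭a∈′)) <2^μ)
  size : length (representatives n) ≤ 8 * 2 ^ μ
  size = begin
    length (representatives n)     ≡⟨ trans (length-cartesianProductWith _ (map suc (upTo n)) (upTo (suc n)))
                                        (cong₂ _*_ (trans (length-map suc (upTo n)) (length-upTo n)) (length-upTo (suc n))) ⟩
    n * suc n                      ≤⟨ *-monoʳ-≤ n (+-monoˡ-≤ n (m^n>0 2 h)) ⟩
    n * (n + n)                    ≡⟨ twice n ⟩
    2 * (n * n)                    ≡⟨ cong (2 *_) n²≡ ⟩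
    2 * (4 * 2 ^ (e * 2))          ≡⟨ sym (*-assoc 2 4 (2 ^ (e * 2))) ⟩
    8 * 2 ^ (e * 2)                ≤⟨ *-monoʳ-≤ 8 (^-monoʳ-≤ 2 (m/n*n≤m μ 2)) ⟩
    8 * 2 ^ μ ∎
    where
    twice : ∀ n → n * (n + n) ≡ 2 * (n * n)
    twice = ℕ-Solver.solve-∀

factoredᴳ : ∀ {g f} → IsExponentialᴳ g f → Factored norm f g
factoredᴳ {g} {f} isExp α 1≤α = from (factorisationᴳ α 1≤α)
  where
  from : (∃₂ λ ε 𝔭as → ε ∈ units × PrimePowers 𝔭as × α ≡ ε *ᴳ ∏^ 𝔭as) → ∃ λ fs →
    All (λ (q , a) → 2 ≤ q × 1 ≤ a) fs × norm α ≡ prodOfPowers fs × f α ≡ product (map (λ (_ , a) → g a) fs) × ∀ μ → countBelow μ fs ≤ 8 * 2 ^ μ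
  from (ε , 𝔭as , ε∈ , pp , α≡) = map (λ (𝔭 , a) → norm 𝔭 , a) 𝔭as
    , All.map⁺ (All.map (λ {(_ , a)} (prime , a≢0) → prime⇒2≤norm prime , >-nonZero⁻¹ a {{a≢0}}) (proj₁ pp))
    , trans (cong norm α≡) (trans (norm-* ε (∏^ 𝔭as)) (trans (cong₂ _*_ (unit⇒norm≡1 ε∈) (norm-∏^ 𝔭as)) (*-identityˡ _)))
    , trans (cong f α≡) (trans (isExp ε 𝔭as ε∈ (proj₁ pp) (proj₂ pp)) (cong product (map-∘ 𝔭as)))
    , λ μ → ≤-trans (length-filter-map⁻ (λ (𝔭 , _) → norm 𝔭 <? 2 ^ μ) (λ (q , _) → q <? 2 ^ μ) (λ (𝔭 , a) → norm 𝔭 , a) (λ lt → lt) 𝔭as)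
              (count-small-primes μ 𝔭as pp)

-- Squares of products of distinct primes

SquareValues : {I : Set} → (I → ℕ) → (I → ℕ) → (ℕ → ℕ) → Set
SquareValues size f g = ∀ s N₀ → ∃ λ qs → ∃₂ λ ρ ξ → All (2 ≤_) qs × All (_≤ 2 ^ ξ) qs × 2 ^ ρ ≤ length qs × ξ * s ≤ suc s * ρ × N₀ ≤ ρ ×
  ∃ λ x → size x ≡ prodOfPowers (map (_, 2) qs) × f x ≡ g 2 ^ length qs

lowerCore : ∀ {I K g} {size f : I → ℕ} → K ≤ g 2 → SquareValues size f g → LowerCore K size f
lowerCore {I} {K} {g} {size} {f} K≤g2 values s N₀ =
  -- Asking for `suc N₀` also secures ρ ≥ 1; then N₀ ≤ ρ ≤ 2 ^ ρ ≤ r ≤ 4 ^ r ≤ N.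
  let qs , ρ , ξ , 2≤qs , qs≤ , many , ratio , large , x , N≡ , t≡ = values s (suc N₀)
      r = length qs
      4^r≤N = subst (4 ^ r ≤_) (sym N≡) (below 2≤qs)
      1≤r = ≤-trans (m^n>0 2 ρ) many
  in x , r , ρ , ξ
   , ≤-trans (≤-trans (≤-trans (n≤1+n N₀) large) (<⇒≤ (n<2^n ρ))) (≤-trans many (≤-trans (≤-trans (<⇒≤ (n<2^n r)) (^-monoˡ-≤ r (s≤s (s≤s (z≤n {2}))))) 4^r≤N))
   , ≤-trans (s≤s z≤n) large , 1≤ξ qs ξ 1≤r 2≤qs qs≤ , many , 4^r≤N
   , subst (_≤ 2 ^ (ξ * (2 * r))) (sym N≡) (above ξ qs≤)
   , subst (K ^ r ≤_) (sym t≡) (^-monoˡ-≤ r K≤g2) , ratio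
  where
  open ≤-Reasoning
  below : ∀ {qs} → All (2 ≤_) qs → 4 ^ length qs ≤ prodOfPowers (map (_, 2) qs)
  below []           = ≤-refl
  below (2≤q ∷ 2≤qs) = *-mono-≤ (^-monoˡ-≤ 2 2≤q) (below 2≤qs)
  above : ∀ ξ {qs} → All (_≤ 2 ^ ξ) qs → prodOfPowers (map (_, 2) qs) ≤ 2 ^ (ξ * (2 * length qs))
  above ξ []                    = ≤-reflexive (sym (cong (2 ^_) (*-zeroʳ ξ)))
  above ξ (_∷_ {q} {qs} q≤ qs≤) = begin
    q ^ 2 * prodOfPowers (map (_, 2) qs)               ≤⟨ *-mono-≤ (^-monoˡ-≤ 2 q≤) (above ξ qs≤) ⟩
    (2 ^ ξ) ^ 2 * 2 ^ (ξ * (2 * length qs))            ≡⟨ cong (_* 2 ^ (ξ * (2 * length qs))) (^-*-assoc 2 ξ 2) ⟩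
    2 ^ (ξ * 2) * 2 ^ (ξ * (2 * length qs))            ≡⟨ sym (^-distribˡ-+-* 2 (ξ * 2) (ξ * (2 * length qs))) ⟩
    2 ^ (ξ * 2 + ξ * (2 * length qs))                  ≡⟨ cong (2 ^_) (exponent ξ (length qs)) ⟩
    2 ^ (ξ * (2 * suc (length qs))) ∎
    where
    exponent : ∀ ξ r → ξ * 2 + ξ * (2 * r) ≡ ξ * (2 * suc r)
    exponent = ℕ-Solver.solve-∀
  1≤ξ : ∀ qs ξ → 1 ≤ length qs → All (2 ≤_) qs → All (_≤ 2 ^ ξ) qs → 1 ≤ ξ
  1≤ξ _       (suc ξ) _  _         _         = s≤s z≤n
  1≤ξ (_ ∷ _) zero    _  (2≤q ∷ _) (q≤1 ∷ _) = ⊥-elim (<⇒≱ 2≤q q≤1)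

product-map-const : ∀ {A : Set} c (xs : List A) → product (map (λ _ → c) xs) ≡ c ^ length xs
product-map-const c []       = refl
product-map-const c (x ∷ xs) = cong (c *_) (product-map-const c xs)

squareValuesᴳ : ∀ {g f} → IsExponentialᴳ g f → SquareValues norm f g
squareValuesᴳ {g} {f} isExp s N₀ =
    map norm 𝔭s , ρ , ξ , All.map⁺ (All.map prime⇒2≤norm prime) , All.map⁺ bounded
  , subst (2 ^ ρ ≤_) (sym (length-map norm 𝔭s)) many , ratio , large
  , 1ᴳ *ᴳ ∏^ (map (_, 2) 𝔭s)
  , trans (norm-* 1ᴳ (∏^ (map (_, 2) 𝔭s))) (trans (*-identityˡ _) (trans (norm-∏^ (map (_, 2) 𝔭s))
      (cong prodOfPowers (trans (sym (map-∘ 𝔭s)) (map-∘ 𝔭s)))))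
  , trans (isExp 1ᴳ (map (_, 2) 𝔭s) (here refl) (All.map⁺ (All.map (λ p → p , _) prime)) (AllPairs.map⁺ independent))
      (trans (cong product (sym (map-∘ 𝔭s))) (trans (product-map-const (g 2) 𝔭s) (cong (g 2 ^_) (sym (length-map norm 𝔭s)))))
  where open ManyPrimes (many-gaussian-primes s N₀)

-- From Gaussian primes to rational primes

rational-prime-below : ∀ {π n} → GaussianPrime π → 1 ≤ n → π ∣ᴳ ℕ→ℤ[i] n → ∃ λ p → Prime p × p ≤ n × π ∣ᴳ ℕ→ℤ[i] p
rational-prime-below {π} {n} prime 1≤n π∣n = go n 1≤n π∣n (<-wellFounded n)
  where
  go : ∀ n → 1 ≤ n → π ∣ᴳ ℕ→ℤ[i] n → Acc _<_ n → ∃ λ p → Prime p × p ≤ n × π ∣ᴳ ℕ→ℤ[i] p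
  go 1               _   π∣1 _         = ⊥-elim (p∤1 prime π∣1)
  go n@(suc (suc _)) 1≤n π∣n (acc rec) = from (prime-factor n (s≤s (s≤s z≤n)))
    where
    from : (∃₂ λ p m → Prime p × n ≡ p * m) → ∃ λ p → Prime p × p ≤ n × π ∣ᴳ ℕ→ℤ[i] p
    from (p , m , p-prime , n≡) = choose (split-∣ prime {ℕ→ℤ[i] p} {ℕ→ℤ[i] m} (subst (π ∣ᴳ_) (trans (cong ℕ→ℤ[i] n≡) (ℕ→ℤ[i]-* p m)) π∣n))
      where
      1≤m : 1 ≤ m
      1≤m = n≢0⇒n>0 λ m≡0 → <⇒≢ 1≤n (sym (trans n≡ (trans (cong (p *_) m≡0) (*-zeroʳ p))))
      m<n : m < n
      m<n = subst (m <_) (sym (trans n≡ (*-comm p m))) (m<m*n m p {{>-nonZero 1≤m}} (prime⇒2≤ p-prime))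
      choose : π ∣ᴳ ℕ→ℤ[i] p ⊎ π ∣ᴳ ℕ→ℤ[i] m → ∃ λ p → Prime p × p ≤ n × π ∣ᴳ ℕ→ℤ[i] p
      choose (inj₁ π∣p) = p , p-prime , subst (p ≤_) (sym n≡) (m≤m*n p m {{>-nonZero 1≤m}}) , π∣p
      choose (inj₂ π∣m) = let q , q-prime , q≤m , π∣q = go m 1≤m π∣m (rec m<n) in q , q-prime , ≤-trans q≤m (<⇒≤ m<n) , π∣q

-- By `rational-prime`, each p is a unit times one prime or times two primes, and a Gaussian prime
-- dividing p is associated to one of these.
primes-above : ∀ {ps} → All Prime ps → ∃ λ 𝔮s → length 𝔮s ≤ 2 * length ps × (∀ {𝔭} → GaussianPrime 𝔭 → Any (λ p → 𝔭 ∣ᴳ ℕ→ℤ[i] p) ps → Any (Associated 𝔭) 𝔮s)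
primes-above []                 = [] , z≤n , λ _ ()
primes-above {p ∷ ps} (p-prime ∷ ps-prime) =
  let 𝔮s , few , covered = primes-above ps-prime in extend 𝔮s few covered (rational-prime p-prime)
  where
  Goal : Set
  Goal = ∃ λ 𝔮s → length 𝔮s ≤ 2 * suc (length ps) × (∀ {𝔭} → GaussianPrime 𝔭 → Any (λ p → 𝔭 ∣ᴳ ℕ→ℤ[i] p) (p ∷ ps) → Any (Associated 𝔭) 𝔮s)
  extend : ∀ 𝔮s → length 𝔮s ≤ 2 * length ps → (∀ {𝔭} → GaussianPrime 𝔭 → Any (λ p → 𝔭 ∣ᴳ ℕ→ℤ[i] p) ps → Any (Associated 𝔭) 𝔮s) →
    (∃₂ λ 𝔮 γ → GaussianPrime 𝔮 × ℕ→ℤ[i] p ≡ γ *ᴳ 𝔮 × (norm γ ≡ 1 ⊎ ∃ λ 𝔮′ → GaussianPrime 𝔮′ × Associated γ 𝔮′)) → Goal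
  extend 𝔮s few covered (𝔮 , γ , prime𝔮 , p≡ , kind) = by-kind kind
    where
    few₂ : 2 + length 𝔮s ≤ 2 * suc (length ps)
    few₂ = ≤-trans (+-monoʳ-≤ 2 few) (≤-reflexive (sym (*-suc 2 (length ps))))
    by-kind : norm γ ≡ 1 ⊎ (∃ λ 𝔮′ → GaussianPrime 𝔮′ × Associated γ 𝔮′) → Goal
    by-kind (inj₁ unit) = 𝔮 ∷ 𝔮s , ≤-trans (n≤1+n _) few₂ , cover
      where
      cover : ∀ {𝔭} → GaussianPrime 𝔭 → Any (λ p → 𝔭 ∣ᴳ ℕ→ℤ[i] p) (p ∷ ps) → Any (Associated 𝔭) (𝔮 ∷ 𝔮s)
      cover prime𝔭 (there 𝔭∣) = there (covered prime𝔭 𝔭∣)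
      cover {𝔭} prime𝔭 (here 𝔭∣p) = here (associated-sym {𝔮} {𝔭} (primes-∣⇒associated prime𝔭 prime𝔮
        (∣ᴳ-trans 𝔭∣p (subst (_∣ᴳ 𝔮) (sym p≡) (conj γ by conj-cancel γ 𝔮 unit)))))
    by-kind (inj₂ (𝔮′ , prime𝔮′ , γ~𝔮′)) = 𝔮 ∷ 𝔮′ ∷ 𝔮s , few₂ , cover
      where
      cover : ∀ {𝔭} → GaussianPrime 𝔭 → Any (λ p → 𝔭 ∣ᴳ ℕ→ℤ[i] p) (p ∷ ps) → Any (Associated 𝔭) (𝔮 ∷ 𝔮′ ∷ 𝔮s)
      cover prime𝔭 (there 𝔭∣) = there (there (covered prime𝔭 𝔭∣))
      cover {𝔭} prime𝔭 (here 𝔭∣p) = choose (split-∣ prime𝔭 {γ} {𝔮} (subst (𝔭 ∣ᴳ_) p≡ 𝔭∣p))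
        where
        choose : 𝔭 ∣ᴳ γ ⊎ 𝔭 ∣ᴳ 𝔮 → Any (Associated 𝔭) (𝔮 ∷ 𝔮′ ∷ 𝔮s)
        choose (inj₂ 𝔭∣𝔮) = here (associated-sym {𝔮} {𝔭} (primes-∣⇒associated prime𝔭 prime𝔮 𝔭∣𝔮))
        choose (inj₁ 𝔭∣γ) = there (here (associated-sym {𝔮′} {𝔭} (primes-∣⇒associated prime𝔭 prime𝔮′ (∣ᴳ-trans 𝔭∣γ (associated-∣ {𝔮′} {γ} (associated-sym {γ} {𝔮′} γ~𝔮′))))))

many-rational-primes : ∀ s N₀ → ∃ λ ps → ∃₂ λ ρ ξ → All Prime ps × AllPairs _≢_ ps × All (_≤ 2 ^ ξ) ps × 2 ^ ρ ≤ length ps × ξ * s ≤ suc s * ρ × N₀ ≤ ρ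
many-rational-primes s N₀ = from-below (below prime bounded)
  where
  -- Two Gaussian primes may lie above one rational prime, which halves the count and lowers ρ by 1.
  -- Using 2 s for s and requiring 2 s + 1 ≤ ρ after that loss restores the ratio: (2 s + 1) (ρ + 1)
  -- ≤ 2 (s + 1) ρ.
  open ManyPrimes (many-gaussian-primes (2 * s) (suc (N₀ + suc (2 * s))))
  open ≤-Reasoning
  Below : List ℤ[i] → Set
  Below 𝔭s = ∃ λ ps → All (λ p → Prime p × p ≤ 2 ^ ξ) ps × All (λ 𝔭 → Any (λ p → 𝔭 ∣ᴳ ℕ→ℤ[i] p) ps) 𝔭s
  below : ∀ {𝔭s} → All GaussianPrime 𝔭s → All (λ 𝔭 → norm 𝔭 ≤ 2 ^ ξ) 𝔭s → Below 𝔭s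
  below []                []             = [] , [] , []
  below (_∷_ {𝔭} prime primes) (bound ∷ bounds) =
    let p , p-prime , p≤ , 𝔭∣p = rational-prime-below prime (prime⇒1≤norm prime) (conj 𝔭 by conj-*ᴳ 𝔭)
        ps , ok , covered = below primes bounds
    in p ∷ ps , (p-prime , ≤-trans p≤ bound) ∷ ok , here 𝔭∣p ∷ All.map there covered
  from-below : Below 𝔭s → ∃ λ ps → ∃₂ λ ρ ξ → All Prime ps × AllPairs _≢_ ps × All (_≤ 2 ^ ξ) ps × 2 ^ ρ ≤ length ps × ξ * s ≤ suc s * ρ × N₀ ≤ ρ
  from-below (ps₀ , ok , covered₀) = from-distinct (independent-representatives _≟_ refl ps₀)
    where
    from-distinct : (∃ λ ps → (∀ {p} → p ∈ ps → p ∈ ps₀) × AllPairs _≢_ ps × All (λ p → Any (p ≡_) ps) ps₀) →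
      ∃ λ ps → ∃₂ λ ρ ξ → All Prime ps × AllPairs _≢_ ps × All (_≤ 2 ^ ξ) ps × 2 ^ ρ ≤ length ps × ξ * s ≤ suc s * ρ × N₀ ≤ ρ
    from-distinct (ps , ps⊆ , distinct , represented) = finish ρ large many ratio (primes-above ps-prime)
      where
      ps-prime : All Prime ps
      ps-prime = All.tabulate λ p∈ → proj₁ (All.lookup ok (ps⊆ p∈))
      covered : All (λ 𝔭 → Any (λ p → 𝔭 ∣ᴳ ℕ→ℤ[i] p) ps) 𝔭s
      covered = All.map (λ {𝔭} any → let p , p∈ , 𝔭∣p = find any
                                         q , q∈ , p≡q = find (All.lookup represented p∈)
                                     in lose q∈ (subst (λ p → 𝔭 ∣ᴳ ℕ→ℤ[i] p) p≡q 𝔭∣p)) covered₀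
      finish : ∀ ρ → suc (N₀ + suc (2 * s)) ≤ ρ → 2 ^ ρ ≤ length 𝔭s → ξ * (2 * s) ≤ suc (2 * s) * ρ →
        (∃ λ 𝔮s → length 𝔮s ≤ 2 * length ps × (∀ {𝔭} → GaussianPrime 𝔭 → Any (λ p → 𝔭 ∣ᴳ ℕ→ℤ[i] p) ps → Any (Associated 𝔭) 𝔮s)) →
        ∃ λ ps → ∃₂ λ ρ ξ → All Prime ps × AllPairs _≢_ ps × All (_≤ 2 ^ ξ) ps × 2 ^ ρ ≤ length ps × ξ * s ≤ suc s * ρ × N₀ ≤ ρ
      finish (suc ρ) (s≤s large) many ratio (𝔮s , few , above) =
        ps , ρ , ξ , ps-prime , distinct , All.tabulate (λ p∈ → proj₂ (All.lookup ok (ps⊆ p∈)))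
        , *-cancelˡ-≤ 2 (≤-trans many (≤-trans (length-≤-by Associated
            (AllPairs.map (λ {𝔭} {𝔮} 𝔭≁𝔮 {ρ} a a′ → 𝔭≁𝔮 (associated-trans {𝔭} {ρ} {𝔮} a (associated-sym {𝔮} {ρ} a′))) independent)
            (All.zipWith (λ (prime , any) → above prime any) (prime , covered))) few))
        , *-cancelˡ-≤ 2 (begin
            2 * (ξ * s)                       ≡⟨ swap ξ s ⟩
            ξ * (2 * s)                       ≤⟨ ratio ⟩
            suc (2 * s) * suc ρ               ≡⟨ *-suc (suc (2 * s)) ρ ⟩
            suc (2 * s) + suc (2 * s) * ρ     ≤⟨ +-monoˡ-≤ (suc (2 * s) * ρ) (≤-trans (m≤n+m (suc (2 * s)) N₀) large) ⟩
            ρ + suc (2 * s) * ρ               ≡⟨ collect s ρ ⟩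
            2 * (suc s * ρ) ∎)
        , ≤-trans (m≤m+n N₀ (suc (2 * s))) large
        where
        swap : ∀ ξ s → 2 * (ξ * s) ≡ ξ * (2 * s)
        swap = ℕ-Solver.solve-∀
        collect : ∀ s ρ → ρ + suc (2 * s) * ρ ≡ 2 * (suc s * ρ)
        collect = ℕ-Solver.solve-∀

squareValuesℕ : ∀ {g f} → IsExponential g f → SquareValues (λ n → n) f g
squareValuesℕ {g} {f} isExp s N₀ =
  let ps , ρ , ξ , primes , distinct , bounded , many , ratio , large = many-rational-primes s N₀
  in ps , ρ , ξ , All.map prime⇒2≤ primes , bounded , many , ratio , large
   , prodOfPowers (map (_, 2) ps) , refl
   , trans (exponential-value isExp (All.map⁺ (All.map (λ p → p , s≤s z≤n) primes) , AllPairs.map⁺ distinct))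
       (trans (cong product (sym (map-∘ ps))) (product-map-const (g 2) ps))

isLimSupℕ : ∀ {K g f} → 2 ≤ K → Tame K g → K ≤ g 2 → IsExponential g f →
            IsLimSup (λ n → n) (λ n → logRatio (f n) n) (fromℚ ½ *ℝ logℕ K)
isLimSupℕ {K} {g} {f} 2≤K tame K≤g2 isExp = isLimSup {K} {ℕ} {λ n → n} {f} 2≤K
  (upperCore {K} {g} 2≤K tame {ℕ} {λ n → n} {f} (factoredℕ isExp))
  (lowerCore {ℕ} {K} {g} {λ n → n} {f} K≤g2 (squareValuesℕ isExp))

isLimSupᴳ : ∀ {K g f} → 2 ≤ K → Tame K g → K ≤ g 2 → IsExponentialᴳ g f →
            IsLimSup norm (λ α → logRatio (f α) (norm α)) (fromℚ ½ *ℝ logℕ K)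
isLimSupᴳ {K} {g} {f} 2≤K tame K≤g2 isExp = isLimSup {K} {ℤ[i]} {norm} {f} 2≤K
  (upperCore {K} {g} 2≤K tame {ℤ[i]} {norm} {f} (factoredᴳ {g} {f} isExp))
  (lowerCore {ℤ[i]} {K} {g} {norm} {f} K≤g2 (squareValuesᴳ {g} {f} isExp))

theorem2 : (k : ℕ) → 2 ≤ k →
    (τᵉ τᵉ* : ℕ → ℕ) → IsExponential (τ k) τᵉ → IsExponential (𝔱 k) τᵉ* →
    (𝔱ᵉ 𝔱ᵉ* : ℤ[i] → ℕ) → IsExponentialᴳ (τ k) 𝔱ᵉ → IsExponentialᴳ (𝔱 k) 𝔱ᵉ* →
    IsLimSup (λ n → n) (λ n → logRatio (τᵉ n) n) (fromℚ ½ *ℝ logℕ k)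
    × IsLimSup (λ n → n) (λ n → logRatio (τᵉ* n) n) (fromℚ ½ *ℝ logℕ (suc k C 2))
    × IsLimSup norm (λ α → logRatio (𝔱ᵉ α) (norm α)) (fromℚ ½ *ℝ logℕ k)
    × IsLimSup norm (λ α → logRatio (𝔱ᵉ* α) (norm α)) (fromℚ ½ *ℝ logℕ (suc k C 2))
theorem2 k 2≤k τᵉ τᵉ* isτᵉ isτᵉ* 𝔱ᵉ 𝔱ᵉ* is𝔱ᵉ is𝔱ᵉ* =
    isLimSupℕ {k} {τ k} {τᵉ} 2≤k (tame-τ k 1≤k) (k≤τ[k,2] k) isτᵉ
  , isLimSupℕ {suc k C 2} {𝔱 k} {τᵉ*} 2≤C (tame-𝔱 k 1≤k) (C≤𝔱[k,2] k) isτᵉ*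
  , isLimSupᴳ {k} {τ k} {𝔱ᵉ} 2≤k (tame-τ k 1≤k) (k≤τ[k,2] k) is𝔱ᵉ
  , isLimSupᴳ {suc k C 2} {𝔱 k} {𝔱ᵉ*} 2≤C (tame-𝔱 k 1≤k) (C≤𝔱[k,2] k) is𝔱ᵉ*
  where
  1≤k : 1 ≤ k
  1≤k = <⇒≤ 2≤k
  2≤C : 2 ≤ suc k C 2
  2≤C = ≤-trans 2≤k (k≤suc-k-C-2 k)
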